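{- Let $k\ge 3$. There exists a randomized algorithm, running in time $O^*\!\left(2^{(1-1/(k\ln 2))n}\right)$, that takes as input a $k$-CNF formula $\mathbf F$ on $n$ variables and an assignment $z_0\in\{0,1\}^n$ and, if $\mathbf F$ is satisfiable, outputs with probability at least $1-2^{ -n}$ a satisfying assignment $z^*\in\Omega_{\mathbf F}$ such that $$d_H(z_0,z^*)\ \ge\ \left(1-\frac{4(k-1)}{(k-2)^2}\right)\cdot\max_{z'\in\Omega_{\mathbf F}} d_H(z_0,z').$$
   Context: $\Omega_{\mathbf F}\subseteq\{0,1\}^n$ is the set of satisfying assignments of $\mathbf F$; $d_H$ is Hamming distance. A $k$-CNF formula is a conjunction of clauses, each a disjunction of at most $k$ literals; formulas have $n^{O(1)}$ clauses. $k$ is a constant and $O^*$ hides factors polynomial in $n$. -}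

module Defs where

open import Data.Bool.Base using (Bool; true; false; if_then_else_; _xor_)
import Data.Bool.Properties as Bool
open import Data.Fin.Base using (Fin; zero; toℕ)
open import Data.Integer.Base using (+_)
open import Data.List.Base as List using (List; []; _∷_; _++_; length; filter)
open import Data.List.Extrema.Nat using (max)
open import Data.List.Relation.Unary.All as All using (All)
open import Data.List.Relation.Unary.Any as Any using (Any)
open import Data.Nat.Base as ℕ using (ℕ; zero; suc; _∸_; _^_; NonZero)
import Data.Nat.Properties as ℕ
open import Data.Product.Base using (∃-syntax; Σ-syntax; _×_; _,_; proj₁; proj₂)
open import Data.Rational.Base as ℚ using (ℚ; _/_; 1ℚ)
import Data.Rational.Properties as ℚ
open import Data.Vec.Base as Vec using (Vec; []; _∷_; lookup; _[_]≔_; toList)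
open import Level using (Level)
open import Relation.Binary.Definitions using (DecidableEquality)
open import Relation.Binary.PropositionalEquality.Core using (_≡_; refl; cong₂)
open import Relation.Nullary.Decidable using (yes; no; map′; _×-dec_)
open import Relation.Unary using (Pred; Decidable)

private
  variable
    n v : ℕ
    ℓ : Level

------------------------------------------------------------------------
-- CNF formulas and assignments

Assignment : ℕ → Set
Assignment n = Vec Bool n

-- The literal (true , i) is xᵢ, and (false , i) is its negation.
Literal : ℕ → Set
Literal n = Bool × Fin n

Clause : ℕ → Set
Clause n = List (Literal n)

CNF : ℕ → Set
CNF n = List (Clause n)

Is_-CNF : ℕ → CNF n → Set
Is k -CNF F = All (λ C → length C ℕ.≤ k) F

LitTrue : Assignment n → Literal n → Set
LitTrue z (s , i) = lookup z i ≡ s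

Satisfies : CNF n → Assignment n → Set
Satisfies F z = All (Any (LitTrue z)) F

satisfies? : (F : CNF n) → Decidable (Satisfies F)
satisfies? F z = All.all? (Any.any? (λ l → lookup z (proj₂ l) Bool.≟ proj₁ l)) F

Satisfiable : CNF n → Set
Satisfiable {n} F = ∃[ z ] Satisfies {n} F z

bitStrings : ∀ n → List (Vec Bool n)
bitStrings zero    = [] ∷ []
bitStrings (suc n) =
  List.map (false ∷_) (bitStrings n) ++ List.map (true ∷_) (bitStrings n)

Ω : CNF n → List (Assignment n)
Ω {n} F = filter (satisfies? F) (bitStrings n)

dH : Vec Bool n → Vec Bool n → ℕ
dH []       []       = 0
dH (x ∷ xs) (y ∷ ys) = (if x xor y then 1 else 0) ℕ.+ dH xs ys

-- The default value 0 is only relevant when Ω F is empty.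
maxDistance : CNF n → Assignment n → ℕ
maxDistance F z₀ = max 0 (List.map (dH z₀) (Ω F))

------------------------------------------------------------------------
-- Randomized computation
--
-- The machine model is the imperative language WHILE over binary trees
-- (Jones, "Computability and Complexity from a Programming Perspective"),
-- extended with fair coin tosses.  A program has finitely many variables.
-- A step performs one assignment of a bounded-size expression, one test of
-- a root, or one unfolding of a command; it takes constant time on a pointer
-- machine or unit-cost RAM when trees are represented by shared pointers.

data Tree : Set where
  nil  : Tree
  node : Tree → Tree → Tree

infix 4 _≟ᵗ_

_≟ᵗ_ : DecidableEquality Tree
nil      ≟ᵗ nil        = yes refl
nil      ≟ᵗ node _ _   = no λ ()
node _ _ ≟ᵗ nil        = no λ ()
node l r ≟ᵗ node l′ r′ =
  map′ (λ (p , q) → cong₂ node p q) (λ { refl → refl , refl })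
       ((l ≟ᵗ l′) ×-dec (r ≟ᵗ r′))

data Expr (v : ℕ) : Set where
  nil   : Expr v
  var   : Fin v → Expr v
  cons  : Fin v → Fin v → Expr v
  hd tl : Fin v → Expr v
  coin  : Expr v

infix  6 _≔_
infixr 5 _⨾_

data Cmd (v : ℕ) : Set where
  _≔_   : Fin v → Expr v → Cmd v
  _⨾_   : Cmd v → Cmd v → Cmd v
  cond  : Fin v → Cmd v → Cmd v → Cmd v
  while : Fin v → Cmd v → Cmd v

Store : ℕ → Set
Store v = Vec Tree v

left right : Tree → Tree
left  nil        = nil
left  (node l _) = l
right nil        = nil
right (node _ r) = r

⌜_⌝ᵇ : Bool → Tree
⌜ false ⌝ᵇ = nil
⌜ true  ⌝ᵇ = node nil nil

eval : Bool → Expr v → Store v → Tree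
eval b nil        σ = nil
eval b (var x)    σ = lookup σ x
eval b (cons x y) σ = node (lookup σ x) (lookup σ y)
eval b (hd x)     σ = left (lookup σ x)
eval b (tl x)     σ = right (lookup σ x)
eval b coin       σ = ⌜ b ⌝ᵇ

-- A configuration is a stack of commands still to be executed, and a store.
Config : ℕ → Set
Config v = List (Cmd v) × Store v

-- Every step is supplied with a fresh random bit, which only `coin` looks at.
-- In tests, nil is false and every other tree is true.
step : Bool → Config v → Config v
step b ([]          , σ) = [] , σ
step b ((x ≔ e) ∷ K , σ) = K , σ [ x ]≔ eval b e σ
step b ((c ⨾ d) ∷ K , σ) = c ∷ d ∷ K , σ
step b (cond x c d ∷ K , σ) with lookup σ x
... | nil      = d ∷ K , σ
... | node _ _ = c ∷ K , σ
step b (while x c ∷ K , σ) with lookup σ x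
... | nil      = K , σ
... | node _ _ = c ∷ while x c ∷ K , σ

run : ∀ {t} → Vec Bool t → Config v → Config v
run []      κ = κ
run (b ∷ ω) κ = run ω (step b κ)

-- Variable 0 holds the input at the start and the output at the end;
-- all other variables are initially nil.
Program : Set
Program = Σ[ m ∈ ℕ ] Cmd (suc m)

start : (P : Program) → Tree → Config (suc (proj₁ P))
start (m , c) x = c ∷ [] , x ∷ Vec.replicate m nil

output : Config (suc v) → Tree
output (_ , σ) = lookup σ zero

Halted : Config v → Set
Halted (K , _) = K ≡ []

-- P halts on input x after at most t steps, whatever the coin tosses.
HaltsWithin : Program → Tree → ℕ → Set
HaltsWithin P x t = (ω : Vec Bool t) → Halted (run ω (start P x))

_/2^_ : ℕ → ℕ → ℚ
m /2^ n = _/_ (+ m) (2 ^ n) {{ℕ.m^n≢0 2 n}}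

-- The probability that a uniformly random ω ∈ {0,1}ᵗ has the property Q.
Pr : ∀ t {Q : Pred (Vec Bool t) ℓ} → Decidable Q → ℚ
Pr t Q? = length (filter Q? (bitStrings t)) /2^ t

-- The probability that the output of P on x after t steps has the property Q.
-- When HaltsWithin P x t, this is the distribution of the final output.
PrOutput : ∀ (P : Program) (x : Tree) (t : ℕ) {Q : Pred Tree ℓ} → Decidable Q → ℚ
PrOutput P x t Q? = Pr t λ ω → Q? (output (run ω (start P x)))

------------------------------------------------------------------------
-- Encoding of inputs and outputs; variable indices are written in unary.

⌜_⌝ⁿ : ℕ → Tree
⌜ zero  ⌝ⁿ = nil
⌜ suc m ⌝ⁿ = node nil ⌜ m ⌝ⁿ

⌜_⌝ˡ : List Tree → Tree
⌜ []     ⌝ˡ = nil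
⌜ t ∷ ts ⌝ˡ = node t ⌜ ts ⌝ˡ

encodeLiteral : Literal n → Tree
encodeLiteral (s , i) = node ⌜ s ⌝ᵇ ⌜ toℕ i ⌝ⁿ

encodeClause : Clause n → Tree
encodeClause C = ⌜ List.map encodeLiteral C ⌝ˡ

encodeCNF : CNF n → Tree
encodeCNF F = ⌜ List.map encodeClause F ⌝ˡ

encodeAssignment : Assignment n → Tree
encodeAssignment z = ⌜ List.map ⌜_⌝ᵇ (toList z) ⌝ˡ

encodeInput : CNF n → Assignment n → Tree
encodeInput F z₀ = node (encodeCNF F) (encodeAssignment z₀)

------------------------------------------------------------------------
-- The approximation guarantee

fromℕ : ℕ → ℚ
fromℕ m = + m / 1

approxRatio : (k : ℕ) → 3 ℕ.≤ k → ℚ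
approxRatio k 3≤k = 1ℚ ℚ.- _/_ (+ (4 ℕ.* (k ∸ 1))) ((k ∸ 2) ^ 2) {{nonZero}}
  where
  nonZero : NonZero ((k ∸ 2) ^ 2)
  nonZero = ℕ.m^n≢0 (k ∸ 2) 2 {{ℕ.>-nonZero (ℕ.m<n⇒0<n∸m 3≤k)}}

-- The tree w encodes some z* ∈ Ω F with dH z₀ z* ≥ r · max_{z′ ∈ Ω F} dH z₀ z′.
FarSolution : ℚ → CNF n → Assignment n → Pred Tree _
FarSolution r F z₀ w =
  Any (λ z* → w ≡ encodeAssignment z*
            × r ℚ.* fromℕ (maxDistance F z₀) ℚ.≤ fromℕ (dH z₀ z*))
      (Ω F)

farSolution? : ∀ r (F : CNF n) z₀ → Decidable (FarSolution r F z₀)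
farSolution? r F z₀ w =
  Any.any? (λ z* → (w ≟ᵗ encodeAssignment z*) ×-dec (_ ℚ.≤? _)) (Ω F)

------------------------------------------------------------------------
-- Time bounds

-- A function of n is n^O(1) iff it is at most poly c for some c.  Using suc n
-- instead of n makes this meaningful for n ≤ 1 too.
poly : ℕ → ℕ → ℕ
poly c n = c ℕ.* suc n ^ c

-- ln 2 = (1 - 1/2) + (1/3 - 1/4) + (1/5 - 1/6) + ⋯.  All terms
-- 1/(2i+1) - 1/(2i+2) = 1/((2i+1)(2i+2)) are positive, so the partial sums
-- increase to ln 2.
ln2Term : ℕ → ℚ
ln2Term i = + 1 / (suc (2 ℕ.* i) ℕ.* suc (suc (2 ℕ.* i)))

ln2Sum : ℕ → ℚ
ln2Sum zero    = ln2Term 0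
ln2Sum (suc N) = ln2Sum N ℚ.+ ln2Term (suc N)

ln2Sum-pos : ∀ N → ℚ.Positive (ln2Sum N)
ln2Sum-pos zero    = _
ln2Sum-pos (suc N) =
  ℚ.pos+pos⇒pos (ln2Sum N) {{ln2Sum-pos N}} (ln2Term (suc N))
    {{ℚ.normalize-pos 1 (suc (2 ℕ.* suc N) ℕ.* suc (suc (2 ℕ.* suc N)))}}

-- These rationals increase to 1 - 1/(k ln 2).
exponentApprox : (k : ℕ) .{{_ : NonZero k}} → ℕ → ℚ
exponentApprox k N = 1ℚ ℚ.- ℚ.1/_ (fromℕ k ℚ.* ln2Sum N) {{nonZero}}
  where
  nonZero : ℚ.NonZero (fromℕ k ℚ.* ln2Sum N)
  nonZero = ℚ.pos⇒nonZero (fromℕ k ℚ.* ln2Sum N)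
    {{ℚ.pos*pos⇒pos (fromℕ k) {{ℚ.normalize-pos k 1}}
                    (ln2Sum N) {{ln2Sum-pos N}}}}

-- A real number is represented by the set of its rational upper bounds.
UpperCut : Set₁
UpperCut = ℚ → Set

-- 1 - 1/(k ln 2)
exponent : (k : ℕ) → 3 ℕ.≤ k → UpperCut
exponent k 3≤k q = ∀ N → exponentApprox k {{nonZero}} N ℚ.≤ q
  where
  nonZero : NonZero k
  nonZero = ℕ.>-nonZero (ℕ.≤-trans (ℕ.s≤s ℕ.z≤n) 3≤k)

-- t ≤ p · 2^(αn) for real α ≥ 0.  Since 2^(αn) is the infimum of 2^((a/b)n)
-- over the rationals a/b ≥ α, this says that t ≤ p · 2^((a/b)n) for all these
-- a/b; both sides are raised to the power b to stay within ℕ.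
_≤_·2^[_·_] : ℕ → ℕ → UpperCut → ℕ → Set
t ≤ p ·2^[ α · n ] =
  ∀ (a b : ℕ) .{{_ : NonZero b}} → α (+ a / b) →
  t ^ b ℕ.≤ p ^ b ℕ.* 2 ^ (a ℕ.* n)

{-# OPTIONS --safe #-}

-- Schöning's random walk, started near the assignments at the unknown optimal distance D from z₀.  Call a variable free
-- with probability ν, independently, give the free variables random values and the others their values in z₀.  Let x be a
-- farthest satisfying assignment.  If the start has j errors with respect to x and the walk reaches a satisfying
-- assignment after l steps, then that one has distance at least D - j - l from z₀.  For ν = min(1, 2 (k-1)/(k-2) D/n)
-- the sum of the walk's success probabilities (k-1)^(-j) over the starts without a fixed error is at least
-- (k / 2(k-1))^n for all D, by Gibbs' inequality, and under the measure tilted by these factors j + l is less than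
-- 4 (k-1)/(k-2)² D on average, up to a factor 1 - 1/k.  So Markov's inequality gives an attempt a probability of at
-- least (k / 2(k-1))^n / k of a good outcome.  As D is unknown, all values of ν in a geometric progression are tried,
-- and the farthest satisfying assignment found is kept.
-- Dice with k sides are replaced by dice with a power of two as number of sides.  The loss is absorbed in the gap between
-- 1 - 1/k and e^(-1/k), which also makes the number of attempts computable with a rational base.
-- The program tosses all coins first, so that each execution of its main part is deterministic.
module Submission where

-- Sides of dice are counted instead of probabilities: of the `M = 2 ^ s` sides `g` pick a given
-- slot, `h = M - g` do not, and `r = h - g` is the drift. Weighting the chance to get from `j`
-- errors to 0 by `(h / g) ^ j` swaps the weights of down and up, so the tilted walk drifts down and
-- takes `j M / r` steps on average. Together with the `j` errors of the start this makes
-- `2 h j / r`, because `M + r = 2 h`. Averaging over the starts with ν = `2 h D / (r n)` gives at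
-- most `4 h² g D / (r² M)`, which `g k ≤ M` and `h / r ≤ (k-1)/(k-2)` turn into
-- `(1 - 1/k) · 4 (k-1)/(k-2)² · D`. The factor `1 - 1/k` is what leaves Markov's inequality a share
-- of `1/k`. The available values of ν are powers of `μ / M` with `μ = M - 1`. The mismatch costs at
-- most a factor `M / μ` per variable, so the attempts grow like `(2 h / μ) ^ n`. The number
-- `(1 - 1/2k)²` splits the gap between `1 - 1/k` and `e ^ (-1/k)`: the choice of the dice keeps
-- `h / μ` below it, and its comparison with the upper end takes a single partial sum of the series
-- for `ln 2`, so no real number is ever formed.

module LogTwo where

  -- Partial sums of the series for `ln 2`, and the passage from ℚ to ℕ

  open import Defs
  open import Data.Nat.Base as ℕ using (ℕ; zero; suc; NonZero)
  import Data.Nat.Properties as ℕ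
  open import Data.Integer.Base as ℤ using (ℤ; +_)
  import Data.Integer.Properties as ℤ
  open import Data.Rational.Base hiding (NonZero)
  open import Data.Rational.Properties
  open import Data.Rational.Solver
  open import Data.Rational.Unnormalised.Base as ℚᵘ using (mkℚᵘ; *≡*; *≤*)
  import Data.Rational.Unnormalised.Properties as ℚᵘ
  open import Relation.Binary.PropositionalEquality
  open +-*-Solver using (solve; _:+_; _:*_; _:-_; :-_; _:=_; con)

  -- harmonicNum m j / harmonicDen m j = 1/(m+1) + ⋯ + 1/(m+j)
  harmonicNum harmonicDen : ℕ → ℕ → ℕ
  harmonicDen m zero    = 1
  harmonicDen m (suc j) = harmonicDen m j ℕ.* suc (m ℕ.+ j)
  harmonicNum m zero    = 0
  harmonicNum m (suc j) = harmonicNum m j ℕ.* suc (m ℕ.+ j) ℕ.+ harmonicDen m j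

  toℚᵘ-/ : ∀ i d → toℚᵘ (i / suc d) ℚᵘ.≃ mkℚᵘ i d
  toℚᵘ-/ i d = toℚᵘ-fromℚᵘ (mkℚᵘ i d)

  opaque
    fromℕ-* : ∀ m n → fromℕ (m ℕ.* n) ≡ fromℕ m * fromℕ n
    fromℕ-* m n = toℚᵘ-injective (ℚᵘ.≃-trans (toℚᵘ-/ (+ (m ℕ.* n)) 0) (ℚᵘ.≃-sym
      (ℚᵘ.≃-trans (toℚᵘ-homo-* (fromℕ m) (fromℕ n)) (ℚᵘ.≃-trans (ℚᵘ.*-cong (toℚᵘ-/ (+ m) 0) (toℚᵘ-/ (+ n) 0))
        (*≡* (cong (ℤ._* + 1) (sym (ℤ.pos-* m n))))))))

    fromℕ-+ : ∀ m n → fromℕ (m ℕ.+ n) ≡ fromℕ m + fromℕ n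
    fromℕ-+ m n = toℚᵘ-injective (ℚᵘ.≃-trans (toℚᵘ-/ (+ (m ℕ.+ n)) 0) (ℚᵘ.≃-sym
      (ℚᵘ.≃-trans (toℚᵘ-homo-+ (fromℕ m) (fromℕ n)) (ℚᵘ.≃-trans (ℚᵘ.+-cong (toℚᵘ-/ (+ m) 0) (toℚᵘ-/ (+ n) 0))
        (*≡* (cong (ℤ._* + 1) (cong₂ ℤ._+_ (ℤ.*-identityʳ (+ m)) (ℤ.*-identityʳ (+ n)))))))))

    fromℕ-mono-≤ : ∀ {m n} → m ℕ.≤ n → fromℕ m ≤ fromℕ n
    fromℕ-mono-≤ {m} {n} m≤n = toℚᵘ-cancel-≤ (ℚᵘ.≤-respˡ-≃ (ℚᵘ.≃-sym (toℚᵘ-/ (+ m) 0)) (ℚᵘ.≤-respʳ-≃ (ℚᵘ.≃-sym (toℚᵘ-/ (+ n) 0))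
      (*≤* (ℤ.*-monoʳ-≤-nonNeg (+ 1) (ℤ.+≤+ m≤n)))))

    fromℕ-cancel-≤ : ∀ {m n} → fromℕ m ≤ fromℕ n → m ℕ.≤ n
    fromℕ-cancel-≤ {m} {n} le with ℚᵘ.≤-respˡ-≃ (toℚᵘ-/ (+ m) 0) (ℚᵘ.≤-respʳ-≃ (toℚᵘ-/ (+ n) 0) (toℚᵘ-mono-≤ le))
    ... | *≤* p = ℤ.drop‿+≤+ (subst₂ ℤ._≤_ (ℤ.*-identityʳ (+ m)) (ℤ.*-identityʳ (+ n)) p)

    /-*-cancel : ∀ a b .{{_ : NonZero b}} → (+ a / b) * fromℕ b ≡ fromℕ a
    /-*-cancel a (suc b) = toℚᵘ-injective (ℚᵘ.≃-trans (toℚᵘ-homo-* (+ a / suc b) (fromℕ (suc b))) (ℚᵘ.≃-trans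
      (ℚᵘ.*-cong (toℚᵘ-/ (+ a) b) (toℚᵘ-/ (+ suc b) 0)) (ℚᵘ.≃-trans (*≡* (trans (ℤ.*-identityʳ _) (cong (+ a ℤ.*_)
        (sym (trans (cong +_ (ℕ.*-identityʳ (suc b))) refl))))) (ℚᵘ.≃-sym (toℚᵘ-/ (+ a) 0)))))

  fromℕ-nonNeg : ∀ m → NonNegative (fromℕ m)
  fromℕ-nonNeg m = normalize-nonNeg m 1

  recip : ℕ → ℚ
  recip d = + 1 / suc d

  recip-inverse : ∀ d → recip d * fromℕ (suc d) ≡ 1ℚ
  recip-inverse d = /-*-cancel 1 (suc d)

  inverse-unique : ∀ x y z → x * z ≡ 1ℚ → y * z ≡ 1ℚ → x ≡ y
  inverse-unique x y z p q = begin
    x             ≡⟨ *-identityʳ x ⟨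
    x * 1ℚ        ≡⟨ cong (x *_) q ⟨
    x * (y * z)   ≡⟨ solve 3 (λ x y z → x :* (y :* z) := x :* z :* y) refl x y z ⟩
    x * z * y     ≡⟨ cong (_* y) p ⟩
    1ℚ * y        ≡⟨ *-identityˡ y ⟩
    y             ∎
    where open ≡-Reasoning

  opaque
    ln2Term-split : ∀ i → ln2Term i + recip (suc (2 ℕ.* i)) ≡ recip (2 ℕ.* i)
    ln2Term-split i = begin
      ln2Term i + r₂                 ≡⟨ cong (_+ r₂) (inverse-unique (ln2Term i) (r₁ * r₂) (f₁ * f₂) (trans (cong (ln2Term i *_) (sym (fromℕ-* (suc (2 ℕ.* i)) (suc (suc (2 ℕ.* i))))))
                                          (/-*-cancel 1 (suc (2 ℕ.* i) ℕ.* suc (suc (2 ℕ.* i)))))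
                                          (trans (solve 4 (λ a b c d → a :* b :* (c :* d) := a :* c :* (b :* d)) refl r₁ r₂ f₁ f₂)
                                            (cong₂ _*_ (recip-inverse (2 ℕ.* i)) (recip-inverse (suc (2 ℕ.* i)))))) ⟩
      r₁ * r₂ + r₂                   ≡⟨ cong (λ u → r₁ * r₂ + u) (sym (*-identityˡ r₂)) ⟩
      r₁ * r₂ + 1ℚ * r₂              ≡⟨ cong (λ u → r₁ * r₂ + u * r₂) (sym (recip-inverse (2 ℕ.* i))) ⟩
      r₁ * r₂ + r₁ * f₁ * r₂         ≡⟨ solve 3 (λ r s f → r :* s :+ r :* f :* s := r :* (s :* (con 1ℚ :+ f))) refl r₁ r₂ f₁ ⟩
      r₁ * (r₂ * (1ℚ + f₁))          ≡⟨ cong (λ u → r₁ * (r₂ * u)) (fromℕ-+ 1 (suc (2 ℕ.* i))) ⟨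
      r₁ * (r₂ * f₂)                 ≡⟨ cong (r₁ *_) (recip-inverse (suc (2 ℕ.* i))) ⟩
      r₁ * 1ℚ                        ≡⟨ *-identityʳ r₁ ⟩
      r₁                             ∎
      where
      open ≡-Reasoning
      r₁ r₂ f₁ f₂ : ℚ
      r₁ = recip (2 ℕ.* i)
      r₂ = recip (suc (2 ℕ.* i))
      f₁ = fromℕ (suc (2 ℕ.* i))
      f₂ = fromℕ (suc (suc (2 ℕ.* i)))

    recip-double : ∀ i → recip (suc (2 ℕ.* i)) + recip (suc (2 ℕ.* i)) ≡ recip i
    recip-double i = inverse-unique (r + r) (recip i) (fromℕ (suc i)) (begin
      (r + r) * f      ≡⟨ solve 2 (λ r f → (r :+ r) :* f := r :* (f :+ f)) refl r f ⟩
      r * (f + f)      ≡⟨ cong (r *_) (fromℕ-+ (suc i) (suc i)) ⟨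
      r * fromℕ (suc i ℕ.+ suc i) ≡⟨ cong (λ u → r * fromℕ u) (trans (cong suc (ℕ.+-suc i i)) (cong (λ u → suc (suc (i ℕ.+ u))) (sym (ℕ.+-identityʳ i)))) ⟩
      r * fromℕ (suc (suc (2 ℕ.* i))) ≡⟨ recip-inverse (suc (2 ℕ.* i)) ⟩
      1ℚ ∎) (recip-inverse i)
      where
      open ≡-Reasoning
      r f : ℚ
      r = recip (suc (2 ℕ.* i))
      f = fromℕ (suc i)

  harmonic : ℕ → ℕ → ℚ
  harmonic m zero    = 0ℚ
  harmonic m (suc j) = harmonic m j + recip (m ℕ.+ j)

  opaque
    harmonic-fraction : ∀ m j → harmonic m j * fromℕ (harmonicDen m j) ≡ fromℕ (harmonicNum m j)
    harmonic-fraction m zero    = refl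
    harmonic-fraction m (suc j) = begin
      (H + r) * fromℕ (Q ℕ.* suc (m ℕ.+ j))  ≡⟨ cong ((H + r) *_) (fromℕ-* Q (suc (m ℕ.+ j))) ⟩
      (H + r) * (fromℕ Q * f)                ≡⟨ solve 4 (λ H r Q f → (H :+ r) :* (Q :* f) := H :* Q :* f :+ r :* f :* Q) refl H r (fromℕ Q) f ⟩
      H * fromℕ Q * f + r * f * fromℕ Q      ≡⟨ cong₂ (λ u v → u * f + v * fromℕ Q) (harmonic-fraction m j) (recip-inverse (m ℕ.+ j)) ⟩
      fromℕ P * f + 1ℚ * fromℕ Q             ≡⟨ cong₂ _+_ (sym (fromℕ-* P (suc (m ℕ.+ j)))) (*-identityˡ (fromℕ Q)) ⟩
      fromℕ (P ℕ.* suc (m ℕ.+ j)) + fromℕ Q  ≡⟨ fromℕ-+ (P ℕ.* suc (m ℕ.+ j)) Q ⟨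
      fromℕ (P ℕ.* suc (m ℕ.+ j) ℕ.+ Q)      ∎
      where
      open ≡-Reasoning
      H r f : ℚ
      P Q : ℕ
      H = harmonic m j
      r = recip (m ℕ.+ j)
      f = fromℕ (suc (m ℕ.+ j))
      P = harmonicNum m j
      Q = harmonicDen m j

    harmonic-shift : ∀ m j → harmonic m (suc j) ≡ recip m + harmonic (suc m) j
    harmonic-shift m zero    = trans (+-comm 0ℚ (recip (m ℕ.+ 0))) (cong (λ u → recip u + 0ℚ) (ℕ.+-identityʳ m))
    harmonic-shift m (suc j) = trans (cong₂ _+_ (harmonic-shift m j) (cong recip (ℕ.+-suc m j))) (+-assoc (recip m) (harmonic (suc m) j) (recip (suc m ℕ.+ j)))

    -- 1 - 1/2 + ⋯ - 1/2m = 1/(m+1) + ⋯ + 1/2m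
    ln2Sum-harmonic : ∀ N → ln2Sum N ≡ harmonic (suc N) (suc N)
    ln2Sum-harmonic zero    = refl
    ln2Sum-harmonic (suc N) = +-cancelˡ (recip i) _ _ (begin
      recip i + (ln2Sum N + t)     ≡⟨ cong (_+ (ln2Sum N + t)) (sym (recip-double i)) ⟩
      r₂ + r₂ + (ln2Sum N + t)     ≡⟨ solve 3 (λ r s t → r :+ r :+ (s :+ t) := s :+ (t :+ r) :+ r) refl r₂ (ln2Sum N) t ⟩
      ln2Sum N + (t + r₂) + r₂     ≡⟨ cong₂ (λ u v → u + v + r₂) (ln2Sum-harmonic N) (ln2Term-split i) ⟩
      harmonic i i + recip (2 ℕ.* i) + r₂ ≡⟨ cong₂ (λ u v → harmonic i i + recip u + recip v) (cong (i ℕ.+_) (ℕ.+-identityʳ i)) (trans (cong suc (cong (i ℕ.+_) (ℕ.+-identityʳ i))) (sym (ℕ.+-suc i i))) ⟩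
      harmonic i (suc (suc i))     ≡⟨ harmonic-shift i (suc i) ⟩
      recip i + harmonic (suc i) (suc i) ∎)
      where
      open ≡-Reasoning
      i : ℕ
      i = suc N
      t r₂ : ℚ
      t = ln2Term i
      r₂ = recip (suc (2 ℕ.* i))
      +-cancelˡ : ∀ x y z → x + y ≡ x + z → y ≡ z
      +-cancelˡ x y z eq = trans (lem x y) (trans (cong (λ u → (- x) + u) eq) (sym (lem x z)))
        where
        lem : ∀ x y → y ≡ (- x) + (x + y)
        lem = solve 2 (λ x y → y := :- x :+ (x :+ y)) refl

  opaque
    -- Writing `L = ln2Sum N = P / Q` and `e = b - a`, the hypothesis `1 - 1/(k L) ≤ a / b` is
    -- `k L e ≤ b`. Clearing `Q` moves it to ℕ, where the rest of the time bound is proved.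
    exponentApprox-≤ : ∀ k N a b e .{{_ : NonZero k}} .{{_ : NonZero b}} → b ≡ a ℕ.+ e →
      exponentApprox k N ≤ + a / b →
      k ℕ.* harmonicNum (suc N) (suc N) ℕ.* e ℕ.≤ b ℕ.* harmonicDen (suc N) (suc N)
    exponentApprox-≤ k N a b e b≡a+e le = fromℕ-cancel-≤ (begin
      fromℕ (k ℕ.* P ℕ.* e)              ≡⟨ trans (fromℕ-* (k ℕ.* P) e) (cong (_* fe) (fromℕ-* k P)) ⟩
      fk * fromℕ P * fe                  ≡⟨ cong (λ u → fk * u * fe) (sym (harmonic-fraction (suc N) (suc N))) ⟩
      fk * (harmonic (suc N) (suc N) * fQ) * fe ≡⟨ cong (λ u → fk * (u * fQ) * fe) (sym (ln2Sum-harmonic N)) ⟩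
      fk * (L * fQ) * fe                 ≡⟨ solve 4 (λ k l q e → k :* (l :* q) :* e := e :* (k :* l) :* q) refl fk L fQ fe ⟩
      fe * x * fQ                        ≤⟨ *-monoʳ-≤-nonNeg fQ ⦃ fromℕ-nonNeg Q ⦄ main ⟩
      fb * fQ                            ≡⟨ fromℕ-* b Q ⟨
      fromℕ (b ℕ.* Q)                    ∎)
      where
      open ≤-Reasoning
      P Q : ℕ
      P = harmonicNum (suc N) (suc N)
      Q = harmonicDen (suc N) (suc N)
      fk fa fb fe fQ L x α : ℚ
      fk = fromℕ k
      fa = fromℕ a
      fb = fromℕ b
      fe = fromℕ e
      fQ = fromℕ Q
      L = ln2Sum N
      x = fk * L
      α = + a / b
      x-pos : Positive x
      x-pos = pos*pos⇒pos fk {{normalize-pos k 1}} L {{ln2Sum-pos N}}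
      1/x : ℚ
      1/x = 1/_ x {{pos⇒nonZero x {{x-pos}}}}
      main : fe * x ≤ fb
      main = begin
        fe * x                              ≡⟨ solve 3 (λ e x a → e :* x := (a :+ e) :* x :+ :- (a :* x)) refl fe x fa ⟩
        (fa + fe) * x - fa * x              ≡⟨ cong₂ (λ u v → u * x - v * x) (trans (sym (fromℕ-+ a e)) (cong fromℕ (sym b≡a+e))) (sym (/-*-cancel a b)) ⟩
        fb * x - α * fb * x                 ≡⟨ solve 3 (λ b x α → b :* x :+ :- (α :* b :* x) := b :* x :+ :- (α :* (x :* b))) refl fb x α ⟩
        fb * x - α * (x * fb)               ≤⟨ +-monoʳ-≤ (fb * x) (neg-antimono-≤ (*-monoʳ-≤-nonNeg (x * fb) ⦃ xb ⦄ le)) ⟩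
        fb * x - (1ℚ - 1/x) * (x * fb)      ≡⟨ solve 3 (λ b x y → b :* x :+ :- ((con 1ℚ :+ :- y) :* (x :* b)) := (y :* x) :* b) refl fb x 1/x ⟩
        1/x * x * fb                        ≡⟨ cong (_* fb) (*-inverseˡ x {{pos⇒nonZero x {{x-pos}}}}) ⟩
        1ℚ * fb                             ≡⟨ *-identityˡ fb ⟩
        fb                                  ∎
        where
        xb : NonNegative (x * fb)
        xb = nonNeg*nonNeg⇒nonNeg x {{pos⇒nonNeg x {{x-pos}}}} fb {{fromℕ-nonNeg b}}

open import Data.Bool.Base using (Bool; true; false; _∨_; _∧_; not; if_then_else_; _xor_)
open import Data.List.Base as List using (List; []; _∷_; _++_; _ʳ++_; length; filter)
open import Data.Nat.Base
open import Data.Nat.Properties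
open import Data.Nat.Tactic.RingSolver using (solve-∀)
open import Data.Product.Base using (_,_; _×_; ∃-syntax; proj₁; proj₂)
open import Data.Sum.Base using (_⊎_; inj₁; inj₂)
open import Data.Vec.Base as Vec using (Vec; []; _∷_; lookup; _[_]≔_; toList)
open import Function.Base using (_∘_; id)
open import Relation.Binary.PropositionalEquality.Core using (_≡_; _≢_; refl; sym; trans; cong; cong₂; subst; subst₂)
open import Relation.Nullary.Decidable using (Dec; yes; no; _×-dec_)
open import Relation.Nullary.Negation using (¬_; contradiction)

-- Bernoulli, AM-GM and Gibbs' inequality for natural numbers

module PowerInequalities where
  open ≤-Reasoning

  opaque
    -- Stands in for subtraction: a term `c` is added to both sides, and the two equations can be
    -- left to the ring solver.
    ≤-cancel : ∀ {a b x y} c → a + c ≡ x → b + c ≡ y → x ≤ y → a ≤ b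
    ≤-cancel c refl refl p = +-cancelʳ-≤ c _ _ p

    *-cancel-≤ : ∀ {a b} c .⦃ _ : NonZero c ⦄ → a * c ≤ b * c → a ≤ b
    *-cancel-≤ {a} {b} c = *-cancelʳ-≤ a b c

  ^-distribʳ-* : ∀ n x y → (x * y) ^ n ≡ x ^ n * y ^ n
  ^-distribʳ-* zero    x y = refl
  ^-distribʳ-* (suc n) x y = trans (cong (x * y *_) (^-distribʳ-* n x y)) (lem x y (x ^ n) (y ^ n))
    where
    lem : ∀ x y p q → x * y * (p * q) ≡ x * p * (y * q)
    lem = solve-∀

  2xy≤x²+y² : ∀ x y → 2 * (x * y) ≤ x * x + y * y
  2xy≤x²+y² x y with ≤-total x y
  ... | inj₁ x≤y with m≤n⇒∃[o]m+o≡n x≤y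
  ...   | d , refl = ≤-trans (m≤m+n _ (d * d)) (≤-reflexive (lem x d))
    where
    lem : ∀ x d → 2 * (x * (x + d)) + d * d ≡ x * x + (x + d) * (x + d)
    lem = solve-∀
  2xy≤x²+y² x y | inj₂ y≤x with m≤n⇒∃[o]m+o≡n y≤x
  ...   | d , refl = ≤-trans (m≤m+n _ (d * d)) (≤-reflexive (lem y d))
    where
    lem : ∀ y d → 2 * ((y + d) * y) + d * d ≡ (y + d) * (y + d) + y * y
    lem = solve-∀

  bernoulli : ∀ x y n → x ^ suc n + suc n * (y * x ^ n) ≤ (x + y) ^ suc n
  bernoulli x y zero    = ≤-reflexive (lem x y)
    where
    lem : ∀ x y → x * 1 + 1 * (y * 1) ≡ (x + y) * 1
    lem = solve-∀
  bernoulli x y (suc n) = begin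
    x ^ (2 + n) + (2 + n) * (y * x ^ suc n)
      ≤⟨ m≤m+n _ (suc n * (y * y * x ^ n)) ⟩
    x ^ (2 + n) + (2 + n) * (y * x ^ suc n) + suc n * (y * y * x ^ n)
      ≡⟨ lem x y n (x ^ n) ⟩
    (x + y) * (x ^ suc n + suc n * (y * x ^ n))
      ≤⟨ *-monoʳ-≤ (x + y) (bernoulli x y n) ⟩
    (x + y) ^ (2 + n) ∎
    where
    lem : ∀ x y n p → x * (x * p) + (2 + n) * (y * (x * p)) + (1 + n) * (y * y * p)
        ≡ (x + y) * (x * p + (1 + n) * (y * p))
    lem = solve-∀

  -- The graph of `t ^ (n+1)` lies above its tangent at `t = y`; the negative term of the tangent is
  -- moved to the other side.
  tangent : ∀ x y n → suc n * (x * y ^ n) ≤ x ^ suc n + n * y ^ suc n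
  tangent x y zero    = ≤-reflexive (lem x)
    where
    lem : ∀ x → 1 * (x * 1) ≡ x * 1 + 0
    lem = solve-∀
  tangent x y (suc n) = step (x ^ suc n) (y ^ n) (tangent x y n)
    where
    lem₁ : ∀ x y n q → suc (suc n) * (x * (y * q)) + (suc n * (x * x * q) + n * (x * (y * q)))
         ≡ x * (suc n * (x * q)) + suc n * q * (2 * (x * y))
    lem₁ = solve-∀
    lem₂ : ∀ x y n q p → x * p + suc n * (y * (y * q)) + (suc n * (x * x * q) + n * (x * (y * q)))
         ≡ x * (p + n * (y * q)) + suc n * q * (x * x + y * y)
    lem₂ = solve-∀
    step : ∀ p q → suc n * (x * q) ≤ p + n * (y * q) →
           suc (suc n) * (x * (y * q)) ≤ x * p + suc n * (y * (y * q))
    step p q hyp = ≤-cancel (suc n * (x * x * q) + n * (x * (y * q))) (lem₁ x y n q) (lem₂ x y n q p)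
      (+-mono-≤ (*-monoʳ-≤ x hyp) (*-monoʳ-≤ (suc n * q) (2xy≤x²+y² x y)))

  -- Compares the mean `(s + b) / (n + 1)` of `n + 1` numbers with the mean `s / n` of the first
  -- `n`: this is `tangent` for `n (s + b)` and `(n + 1) s`, divided by `n`.
  amgm-step : ∀ n s b → s ^ n * b * suc n ^ suc n ≤ n ^ n * (s + b) ^ suc n
  amgm-step zero s b = ≤-trans (m≤n+m _ s) (≤-reflexive (lem s b))
    where
    lem : ∀ s b → s + 1 * b * (1 * 1) ≡ 1 * ((s + b) * 1)
    lem = solve-∀
  amgm-step n@(suc m) s b = *-cancelˡ-≤ n (≤-cancel (n * (suc n * s) ^ suc n) (trans eq₁ refl) eq₂ (tangent (n * (s + b)) (suc n * s) n))
    where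
    lem₁ : ∀ n s b q p → n * (q * b * ((1 + n) * p)) + n * ((1 + n) * s * (p * q))
         ≡ (1 + n) * (n * (s + b) * (p * q))
    lem₁ = solve-∀
    eq₁ : n * (s ^ n * b * suc n ^ suc n) + n * (suc n * s) ^ suc n ≡ suc n * (n * (s + b) * (suc n * s) ^ n)
    eq₁ rewrite ^-distribʳ-* n (suc n) s = lem₁ n s b (s ^ n) (suc n ^ n)
    lem₂ : ∀ n x p z → n * (p * x) + z ≡ n * p * x + z
    lem₂ = solve-∀
    eq₂ : n * (n ^ n * (s + b) ^ suc n) + n * (suc n * s) ^ suc n ≡ (n * (s + b)) ^ suc n + n * (suc n * s) ^ suc n
    eq₂ rewrite ^-distribʳ-* (suc n) n (s + b) = lem₂ n ((s + b) ^ suc n) (n ^ n) _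

  -- P is the product and s the sum of n numbers.
  amgm-cons : ∀ n s P b → P * n ^ n ≤ s ^ n → P * b * suc n ^ suc n ≤ (s + b) ^ suc n
  amgm-cons n s P b hyp = *-cancel-≤ (n ^ n) ⦃ nn n ⦄ (begin
    P * b * suc n ^ suc n * n ^ n   ≡⟨ lem P b (suc n ^ suc n) (n ^ n) ⟩
    P * n ^ n * (b * suc n ^ suc n) ≤⟨ *-monoˡ-≤ _ hyp ⟩
    s ^ n * (b * suc n ^ suc n)     ≡⟨ *-assoc (s ^ n) b _ ⟨
    s ^ n * b * suc n ^ suc n       ≤⟨ amgm-step n s b ⟩
    n ^ n * (s + b) ^ suc n         ≡⟨ *-comm (n ^ n) _ ⟩
    (s + b) ^ suc n * n ^ n         ∎)
    where
    nn : ∀ n → NonZero (n ^ n)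
    nn zero    = _
    nn (suc n) = m^n≢0 (suc n) (suc n)
    lem : ∀ P b x y → P * b * x * y ≡ P * y * (b * x)
    lem = solve-∀

  -- Appends `m` copies of `b`. A family of numbers enters only through its length, its sum and its
  -- product.
  amgm-replicate : ∀ m n s P b → P * n ^ n ≤ s ^ n →
                   P * b ^ m * (m + n) ^ (m + n) ≤ (m * b + s) ^ (m + n)
  amgm-replicate zero    n s P b hyp rewrite *-identityʳ P = hyp
  amgm-replicate (suc m) n s P b hyp =
    subst₂ (λ x y → x * suc (m + n) ^ suc (m + n) ≤ y ^ suc (m + n)) (lem₁ P (b ^ m) b) (lem₂ (m * b) s b)
      (amgm-cons (m + n) (m * b + s) (P * b ^ m) b (amgm-replicate m n s P b hyp))
    where
    lem₁ : ∀ P q b → P * q * b ≡ P * (b * q)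
    lem₁ = solve-∀
    lem₂ : ∀ q s b → q + s + b ≡ b + q + s
    lem₂ = solve-∀

  gibbs⁺ : ∀ x y D a .⦃ _ : NonZero D ⦄ .⦃ _ : NonZero a ⦄ →
           x ^ D * y ^ a * (D + a) ^ (D + a) ≤ (x + y) ^ (D + a) * (D ^ D * a ^ a)
  gibbs⁺ x y D a =
    -- This factor turns each `x` into `x a` and each `y` into `y D`. With these weights the sum of
    -- all `D + a` numbers is `(x + y) D a`.
    *-cancel-≤ (a ^ D * D ^ a) ⦃ m*n≢0 (a ^ D) (D ^ a) ⦃ m^n≢0 a D ⦄ ⦃ m^n≢0 D a ⦄ ⦄ (begin
      x ^ D * y ^ a * (D + a) ^ (D + a) * (a ^ D * D ^ a)
        ≡⟨ lem₁ (x ^ D) (y ^ a) _ (a ^ D) (D ^ a) ⟩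
      1 * (y ^ a * D ^ a) * (x ^ D * a ^ D) * (D + a) ^ (D + a)
        ≡⟨ cong₂ (λ u v → 1 * u * v * (D + a) ^ (D + a)) (^-distribʳ-* a y D) (^-distribʳ-* D x a) ⟨
      1 * (y * D) ^ a * (x * a) ^ D * (D + a) ^ (D + a)
        ≤⟨ subst (λ m → 1 * (y * D) ^ a * (x * a) ^ D * (D + m) ^ (D + m) ≤ (D * (x * a) + (a * (y * D) + 0)) ^ (D + m)) (+-identityʳ a)
             (amgm-replicate D (a + 0) (a * (y * D) + 0) (1 * (y * D) ^ a) (x * a) (amgm-replicate a 0 0 1 (y * D) ≤-refl)) ⟩
      (D * (x * a) + (a * (y * D) + 0)) ^ (D + a)
        ≡⟨ cong (_^ (D + a)) (lem₂ x y D a) ⟩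
      ((x + y) * (D * a)) ^ (D + a)
        ≡⟨ ^-distribʳ-* (D + a) (x + y) (D * a) ⟩
      (x + y) ^ (D + a) * (D * a) ^ (D + a)
        ≡⟨ cong ((x + y) ^ (D + a) *_) (trans (^-distribʳ-* (D + a) D a) (cong₂ _*_ (^-distribˡ-+-* D D a) (^-distribˡ-+-* a D a))) ⟩
      (x + y) ^ (D + a) * (D ^ D * D ^ a * (a ^ D * a ^ a))
        ≡⟨ lem₃ ((x + y) ^ (D + a)) (D ^ D) (D ^ a) (a ^ D) (a ^ a) ⟩
      (x + y) ^ (D + a) * (D ^ D * a ^ a) * (a ^ D * D ^ a) ∎)
    where
    lem₁ : ∀ p q t u v → p * q * t * (u * v) ≡ 1 * (q * v) * (p * u) * t
    lem₁ = solve-∀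
    lem₂ : ∀ x y D a → D * (x * a) + (a * (y * D) + 0) ≡ (x + y) * (D * a)
    lem₂ = solve-∀
    lem₃ : ∀ p q t u v → p * (q * t * (u * v)) ≡ p * (q * v) * (u * t)
    lem₃ = solve-∀

  -- AM-GM for D copies of x a and a copies of y D.
  gibbs : ∀ x y D a → x ^ D * y ^ a * (D + a) ^ (D + a) ≤ (x + y) ^ (D + a) * (D ^ D * a ^ a)
  gibbs x y zero a = *-mono-≤ (≤-trans (≤-reflexive (*-identityˡ _)) (^-monoˡ-≤ a (m≤n+m y x))) (≤-reflexive (sym (*-identityˡ _)))
  gibbs x y D@(suc d) zero rewrite +-identityʳ d | *-identityʳ (x ^ D) | *-identityʳ (D ^ D) = *-monoˡ-≤ (D ^ D) (^-monoˡ-≤ D (m≤m+n x y))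
  gibbs x y D@(suc _) a@(suc _) = gibbs⁺ x y D a

-- Powers of 2 against powers of `(κ + 1) / κ`

module LogTwoPowers where
  open PowerInequalities
  open LogTwo

  open ≤-Reasoning

  opaque
    ^-cancelˡ-≤ : ∀ {x y} q .⦃ _ : NonZero q ⦄ → x ^ q ≤ y ^ q → x ≤ y
    ^-cancelˡ-≤ {x} {y} q le with x ≤? y
    ... | yes p = p
    ... | no ¬p = contradiction le (<⇒≱ (^-monoˡ-< q {y} {x} (≰⇒> ¬p)))

  opaque
    -- Transitivity of fractions: `a / a′ ≤ b / p ≤ c′ / c`, cross-multiplied.
    chain-≤ : ∀ {a a′ b c c′} p .⦃ _ : NonZero p ⦄ →
              a * p ≤ a′ * b → b * c ≤ c′ * p → a * c ≤ a′ * c′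
    chain-≤ {a} {a′} {b} {c} {c′} p le₁ le₂ = *-cancel-≤ p (begin
      a * c * p     ≡⟨ lem₁ a c p ⟩
      a * p * c     ≤⟨ *-monoˡ-≤ c le₁ ⟩
      a′ * b * c    ≡⟨ *-assoc a′ b c ⟩
      a′ * (b * c)  ≤⟨ *-monoʳ-≤ a′ le₂ ⟩
      a′ * (c′ * p) ≡⟨ *-assoc a′ c′ p ⟨
      a′ * c′ * p   ∎)
      where
      lem₁ : ∀ a b c → a * b * c ≡ a * c * b
      lem₁ = solve-∀

  opaque
    -- (1 + 1/p)^(p+1) decreases in p.
    euler-step : ∀ p → suc (suc p) ^ suc (suc p) * p ^ suc p ≤ suc p ^ suc (suc p) * suc p ^ suc p
    euler-step p = step (suc (suc p) ^ suc p) (suc p ^ suc p) (p ^ suc p) ((suc (suc p) * p) ^ p) (bernoulli (suc (suc p) * p) 1 p)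
      (^-distribʳ-* (suc p) (suc (suc p)) p)
      (trans (cong (_^ suc p) (lem₃ p)) (^-distribʳ-* (suc p) (suc p) (suc p)))
      where
      lem₂ : ∀ p q → suc (suc p) * (suc (suc p) * p * q) + q ≡ suc p * (suc (suc p) * p * q + suc p * (1 * q))
      lem₂ = solve-∀
      lem₃ : ∀ p → suc (suc p) * p + 1 ≡ suc p * suc p
      lem₃ = solve-∀
      lem₁ : ∀ a b c → a * b * c ≡ a * (b * c)
      lem₁ = solve-∀
      lem₄ : ∀ a b → a * (b * b) ≡ a * b * b
      lem₄ = solve-∀
      step : ∀ x y z n {w} → suc (suc p) * p * n + suc p * (1 * n) ≤ w →
             suc (suc p) * p * n ≡ x * z → w ≡ y * y → suc (suc p) * x * z ≤ suc p * y * y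
      step x y z n hyp eq refl = begin
        suc (suc p) * x * z                     ≡⟨ lem₁ (suc (suc p)) x z ⟩
        suc (suc p) * (x * z)                   ≡⟨ cong (suc (suc p) *_) eq ⟨
        suc (suc p) * (suc (suc p) * p * n)     ≤⟨ m≤m+n _ n ⟩
        suc (suc p) * (suc (suc p) * p * n) + n ≡⟨ lem₂ p n ⟩
        suc p * (suc (suc p) * p * n + suc p * (1 * n)) ≤⟨ *-monoʳ-≤ (suc p) hyp ⟩
        suc p * (y * y)                         ≡⟨ lem₄ (suc p) y ⟩
        suc p * y * y                           ∎

  opaque
    euler-antitone : ∀ κ d .⦃ _ : NonZero κ ⦄ →
      suc (d + κ) ^ suc (d + κ) * κ ^ suc κ ≤ (d + κ) ^ suc (d + κ) * suc κ ^ suc κ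
    euler-antitone κ zero    = ≤-reflexive (*-comm (suc κ ^ suc κ) (κ ^ suc κ))
    euler-antitone κ (suc d) =
      chain-≤ {suc (suc p) ^ suc (suc p)} {suc p ^ suc (suc p)} {suc p ^ suc p} {κ ^ suc κ} {suc κ ^ suc κ} (p ^ suc p) ⦃ m^n≢0 p (suc p) ⦃ >-nonZero (≤-trans (>-nonZero⁻¹ κ) (m≤n+m κ d)) ⦄ ⦄
        (euler-step p) (≤-trans (euler-antitone κ d) (≤-reflexive (*-comm (p ^ suc p) (suc κ ^ suc κ))))
      where
      p : ℕ
      p = d + κ

  harmonicDen≢0 : ∀ m j → NonZero (harmonicDen m j)
  harmonicDen≢0 m zero    = _
  harmonicDen≢0 m (suc j) = m*n≢0 (harmonicDen m j) (suc (m + j)) ⦃ harmonicDen≢0 m j ⦄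

  opaque
    ^-swap : ∀ x a b → (x ^ a) ^ b ≡ (x ^ b) ^ a
    ^-swap x a b = trans (^-*-assoc x a b) (trans (cong (x ^_) (*-comm a b)) (sym (^-*-assoc x b a)))

  opaque
    ^-split : ∀ x a e b Q → x ^ (a * e + b * Q) ≡ (x ^ a) ^ e * (x ^ b) ^ Q
    ^-split x a e b Q = trans (^-distribˡ-+-* x (a * e) (b * Q)) (sym (cong₂ _*_ (^-*-assoc x a e) (^-*-assoc x b Q)))

  opaque
    -- Multiplies bounds with rational exponents: `p / m ≤ (K/κ) ^ (a/Q)` and
    -- `i / p ≤ (K/κ) ^ (b/e)` give a bound for `i / m`, in which `Q e` is the common denominator of
    -- the exponents.
    combine : ∀ i e p κ m K a b Q .⦃ _ : NonZero p ⦄ →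
              p ^ Q * κ ^ a ≤ m ^ Q * K ^ a → i ^ e * κ ^ b ≤ p ^ e * K ^ b →
              i ^ (Q * e) * κ ^ (a * e + b * Q) ≤ m ^ (Q * e) * K ^ (a * e + b * Q)
    combine i e p κ m K a b Q hyp₁ hyp₂ rewrite ^-split κ a e b Q | ^-split K a e b Q
      | sym (^-*-assoc i Q e) | sym (^-*-assoc m Q e) | ^-swap i Q e =
      *-cancel-≤ ((p ^ Q) ^ e) ⦃ m^n≢0 (p ^ Q) e ⦃ m^n≢0 p Q ⦄ ⦄ (subst₂ _≤_
        (trans (cong₂ _*_ (^-distribʳ-* e (p ^ Q) (κ ^ a)) (^-distribʳ-* Q (i ^ e) (κ ^ b))) (lem₁ ((p ^ Q) ^ e) ((κ ^ a) ^ e) ((i ^ e) ^ Q) ((κ ^ b) ^ Q)))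
        (trans (cong₂ _*_ (^-distribʳ-* e (m ^ Q) (K ^ a)) (trans (^-distribʳ-* Q (p ^ e) (K ^ b)) (cong (_* (K ^ b) ^ Q) (^-swap p e Q)))) (lem₂ ((m ^ Q) ^ e) ((K ^ a) ^ e) ((p ^ Q) ^ e) ((K ^ b) ^ Q)))
        (*-mono-≤ (^-monoˡ-≤ e hyp₁) (^-monoˡ-≤ Q hyp₂)))
      where
      lem₁ : ∀ a b c d → a * b * (c * d) ≡ c * (b * d) * a
      lem₁ = solve-∀
      lem₂ : ∀ a b c d → a * b * (c * d) ≡ a * (b * d) * c
      lem₂ = solve-∀

  opaque
    -- (m+j)/m = ∏ i/(i-1) over m < i ≤ m+j, and (i/(i-1))^i ≤ ((κ+1)/κ)^(κ+1) for every factor.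
    product-bound : ∀ κ d j .⦃ _ : NonZero κ ⦄ → let m = d + κ in
      (m + j) ^ harmonicDen m j * κ ^ (suc κ * harmonicNum m j) ≤ m ^ harmonicDen m j * suc κ ^ (suc κ * harmonicNum m j)
    product-bound κ d zero = ≤-reflexive (cong₂ (λ u v → u ^ 1 * v) (+-identityʳ (d + κ))
      (trans (cong (κ ^_) (*-zeroʳ κ)) (cong (suc κ ^_) (sym (*-zeroʳ κ)))))
    product-bound κ d (suc j) =
      subst₂ (λ u v → u ^ (Q * suc p) * κ ^ v ≤ m ^ (Q * suc p) * suc κ ^ v) (sym (+-suc m j)) (lem (suc κ) P (suc p) Q)
        (combine (suc p) (suc p) p κ m (suc κ) (suc κ * P) (suc κ) Q ⦃ p≢0 ⦄ (product-bound κ d j) factor)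
      where
      m p P Q : ℕ
      m = d + κ
      p = m + j
      P = harmonicNum m j
      Q = harmonicDen m j
      p≢0 : NonZero p
      p≢0 = >-nonZero (≤-trans (>-nonZero⁻¹ κ) (≤-trans (m≤n+m κ d) (m≤m+n m j)))
      lem : ∀ K P i Q → K * P * i + K * Q ≡ K * (P * i + Q)
      lem = solve-∀
      lem′ : ∀ j d κ → j + d + κ ≡ d + κ + j
      lem′ = solve-∀
      factor : suc p ^ suc p * κ ^ suc κ ≤ p ^ suc p * suc κ ^ suc κ
      factor = subst (λ u → suc u ^ suc u * κ ^ suc κ ≤ u ^ suc u * suc κ ^ suc κ) (lem′ j d κ) (euler-antitone κ (j + d))

  opaque
    -- From `x ≤ (K/κ) ^ (a/Q)` follows `x ^ e ≤ (K/κ) ^ B` once `a e / Q ≤ B`. The difference `c`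
    -- is filled up with factors `κ ≤ K` before the root of order `Q` is taken.
    root-bound : ∀ x κ K e a c B Q .⦃ _ : NonZero Q ⦄ → κ ≤ K → a * e + c ≡ B * Q →
                 x ^ Q * κ ^ a ≤ K ^ a → x ^ e * κ ^ B ≤ K ^ B
    root-bound x κ K e a c B Q κ≤K eq base = ^-cancelˡ-≤ Q (begin
      (x ^ e * κ ^ B) ^ Q               ≡⟨ ^-distribʳ-* Q (x ^ e) (κ ^ B) ⟩
      (x ^ e) ^ Q * (κ ^ B) ^ Q         ≡⟨ cong₂ _*_ (^-swap x e Q) (split κ) ⟩
      (x ^ Q) ^ e * ((κ ^ a) ^ e * κ ^ c) ≡⟨ *-assoc ((x ^ Q) ^ e) ((κ ^ a) ^ e) (κ ^ c) ⟨
      (x ^ Q) ^ e * (κ ^ a) ^ e * κ ^ c   ≡⟨ cong (_* κ ^ c) (^-distribʳ-* e (x ^ Q) (κ ^ a)) ⟨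
      (x ^ Q * κ ^ a) ^ e * κ ^ c       ≤⟨ *-mono-≤ (^-monoˡ-≤ e base) (^-monoˡ-≤ c κ≤K) ⟩
      (K ^ a) ^ e * K ^ c               ≡⟨ split K ⟨
      (K ^ B) ^ Q                       ∎)
      where
      split : ∀ x → (x ^ B) ^ Q ≡ (x ^ a) ^ e * x ^ c
      split x = trans (^-*-assoc x B Q) (trans (cong (x ^_) (sym eq)) (trans (^-distribˡ-+-* x (a * e) c)
        (cong (_* x ^ c) (sym (^-*-assoc x a e)))))

  opaque
    -- For `j = m` the product in `product-bound` telescopes to 2. So this is
    -- `ln 2 ≤ (κ + 1) · ln (1 + 1/κ) · P / Q`, with `P / Q = 1/(m+1) + ⋯ + 1/2m`, in a form that
    -- mentions integers only.
    2^-bound : ∀ κ d e B .⦃ _ : NonZero κ ⦄ → let m = d + κ in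
      suc κ * harmonicNum m m * e ≤ B * harmonicDen m m → 2 ^ e * κ ^ B ≤ suc κ ^ B
    2^-bound κ d e B hyp = root-bound 2 κ (suc κ) e (suc κ * P) (proj₁ gap) B Q ⦃ harmonicDen≢0 m m ⦄ (n≤1+n κ) (proj₂ gap) base
      where
      m P Q : ℕ
      m = d + κ
      P = harmonicNum m m
      Q = harmonicDen m m
      gap : ∃[ c ] suc κ * P * e + c ≡ B * Q
      gap = m≤n⇒∃[o]m+o≡n hyp
      lem : ∀ a b c → a * b * c ≡ a * c * b
      lem = solve-∀
      lem′ : ∀ m → m + m ≡ 2 * m
      lem′ = solve-∀
      base : 2 ^ Q * κ ^ (suc κ * P) ≤ suc κ ^ (suc κ * P)
      base = *-cancel-≤ (m ^ Q) ⦃ m^n≢0 m Q ⦃ >-nonZero (≤-trans (>-nonZero⁻¹ κ) (m≤n+m κ d)) ⦄ ⦄ (subst₂ _≤_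
        (trans (cong (_* κ ^ (suc κ * P)) (trans (cong (_^ Q) (lem′ m)) (^-distribʳ-* Q 2 m))) (lem (2 ^ Q) (m ^ Q) (κ ^ (suc κ * P))))
        (*-comm (m ^ Q) (suc κ ^ (suc κ * P)))
        (product-bound κ d m))

open import Defs

-- Composing runs of the machine

module Execution where
  open import Data.Fin.Base using (Fin; zero; suc)

  private variable
    v : ℕ

  -- The bits come from a stream, so runs can be split and joined without casts between lengths of
  -- vectors.
  runS : ℕ → (ℕ → Bool) → Config v → Config v
  runS zero    β κ = κ
  runS (suc t) β κ = runS t (β ∘ suc) (step (β 0) κ)

  runS-+ : ∀ s t β (κ : Config v) → runS (s + t) β κ ≡ runS t (β ∘ (s +_)) (runS s β κ)
  runS-+ zero    t β κ = refl
  runS-+ (suc s) t β κ = runS-+ s t (β ∘ suc) (step (β 0) κ)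

  -- The number `s` of steps is chosen before the bits are known, and so is the result. This
  -- determinism allows the coin sequences to be counted later; the bound `b` leaves room for
  -- branches of different length.
  _↠[_]_ : Config v → ℕ → Config v → Set
  κ ↠[ b ] κ′ = ∃[ s ] (s ≤ b × (∀ β → runS s β κ ≡ κ′))

  ↠-trans : ∀ {κ₁ κ₂ κ₃ : Config v} {a b} → κ₁ ↠[ a ] κ₂ → κ₂ ↠[ b ] κ₃ → κ₁ ↠[ a + b ] κ₃
  ↠-trans (s , s≤a , p) (t , t≤b , q) = s + t , +-mono-≤ s≤a t≤b ,
    λ β → trans (runS-+ s t β _) (trans (cong (runS t _) (p β)) (q _))

  record Exec (c : Cmd v) (σ : Store v) (b : ℕ) (σ′ : Store v) : Set where
    constructor exec
    field reach : ∀ K → (c ∷ K , σ) ↠[ b ] (K , σ′)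
  open Exec public

  private variable
    c d : Cmd v
    σ σ′ σ₁ σ₂ : Store v
    x : Fin v
    a b : ℕ
    l r : Tree

  -- Code without loops runs by computation, so the equation is usually `refl`.
  straight : ∀ n → (∀ K β → runS n β (c ∷ K , σ) ≡ (K , σ′)) → Exec c σ n σ′
  straight n eq = exec λ K → n , ≤-refl , eq K

  weaken : a ≤ b → Exec c σ a σ′ → Exec c σ b σ′
  weaken a≤b e = exec λ K → proj₁ (reach e K) , ≤-trans (proj₁ (proj₂ (reach e K))) a≤b , proj₂ (proj₂ (reach e K))

  retarget : σ₁ ≡ σ₂ → Exec c σ a σ₁ → Exec c σ a σ₂
  retarget refl e = e

  infixr 5 _▸_

  _▸_ : Exec c σ a σ₁ → Exec d σ₁ b σ₂ → Exec (c ⨾ d) σ (suc (a + b)) σ₂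
  e ▸ f = exec λ K → ↠-trans {a = 1} (1 , ≤-refl , λ _ → refl) (↠-trans (reach e _) (reach f K))

  step-node : ∀ {σ : Store v} → lookup σ x ≡ node l r → ∀ b K → step b (while x c ∷ K , σ) ≡ (c ∷ while x c ∷ K , σ)
  step-node eq b K rewrite eq = refl

  step-nil : ∀ {σ : Store v} → lookup σ x ≡ nil → ∀ b K → step b (while x c ∷ K , σ) ≡ (K , σ)
  step-nil eq b K rewrite eq = refl

  step-then : ∀ {σ : Store v} → lookup σ x ≡ node l r → ∀ b K → step b (cond x c d ∷ K , σ) ≡ (c ∷ K , σ)
  step-then eq b K rewrite eq = refl

  step-else : ∀ {σ : Store v} → lookup σ x ≡ nil → ∀ b K → step b (cond x c d ∷ K , σ) ≡ (d ∷ K , σ)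
  step-else eq b K rewrite eq = refl

  while-nil : lookup σ x ≡ nil → Exec (while x c) σ 1 σ
  while-nil eq = exec λ K → 1 , ≤-refl , λ β → step-nil eq (β 0) K

  while-node : lookup σ x ≡ node l r → Exec c σ a σ₁ → Exec (while x c) σ₁ b σ₂ →
               Exec (while x c) σ (suc (a + b)) σ₂
  while-node eq e f = exec λ K →
    ↠-trans {a = 1} (1 , ≤-refl , λ β → step-node eq (β 0) K) (↠-trans (reach e _) (reach f K))

  cond-node : lookup σ x ≡ node l r → Exec c σ a σ′ → Exec (cond x c d) σ (suc a) σ′
  cond-node eq e = exec λ K → ↠-trans {a = 1} (1 , ≤-refl , λ β → step-then eq (β 0) K) (reach e K)

  cond-nil : lookup σ x ≡ nil → Exec d σ a σ′ → Exec (cond x c d) σ (suc a) σ′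
  cond-nil eq e = exec λ K → ↠-trans {a = 1} (1 , ≤-refl , λ β → step-else eq (β 0) K) (reach e K)

  loopTime : ℕ → ℕ → ℕ
  loopTime c zero    = 1
  loopTime c (suc m) = suc (c + loopTime c m)

  loopTime-mono : ∀ {c c′ m m′} → c ≤ c′ → m ≤ m′ → loopTime c m ≤ loopTime c′ m′
  loopTime-mono {m′ = zero}   c≤ z≤n = s≤s z≤n
  loopTime-mono {m′ = suc m′} c≤ z≤n = s≤s z≤n
  loopTime-mono c≤ (s≤s m≤) = s≤s (+-mono-≤ c≤ (loopTime-mono c≤ m≤))

-- The algorithm as a function of its random bits

module Algorithm where
  open import Data.Nat.DivMod using (_%_)
  open import Data.Unit.Base using (⊤)

  private variable
    n : ℕ

  -- A universe for the types of random choices: reading a choice from the tape and summing over all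
  -- choices become recursions of the same shape.
  data Code : Set where
    unit bit : Code
    _⊗_      : Code → Code → Code
    _^^_     : Code → ℕ → Code

  infixr 6 _⊗_
  infixr 7 _^^_

  El : Code → Set
  El unit     = ⊤
  El bit      = Bool
  El (c ⊗ d)  = El c × El d
  El (c ^^ m) = Vec (El c) m

  size : Code → ℕ
  size unit     = 0
  size bit      = 1
  size (c ⊗ d)  = size c + size d
  size (c ^^ m) = m * size c

  writeBits : ∀ c → El c → List Bool → List Bool
  writeBits unit     x        w = w
  writeBits bit      b        w = b ∷ w
  writeBits (c ⊗ d)  (x , y)  w = writeBits c x (writeBits d y w)
  writeBits (c ^^ zero)  []       w = w
  writeBits (c ^^ suc m) (x ∷ xs) w = writeBits c x (writeBits (c ^^ m) xs w)

  literalTrue : Assignment n → Literal n → Bool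
  literalTrue y (s , i) = not (s xor lookup y i)

  clauseTrue : Assignment n → Clause n → Bool → Bool
  clauseTrue y []      q = q
  clauseTrue y (l ∷ C) q = clauseTrue y C (q ∨ literalTrue y l)

  -- The last falsified clause, not the first: the loop that computes it overwrites its result and
  -- needs no early exit. Starting from `[]`, the result `[]` means that all clauses hold, provided
  -- that none of them is empty.
  lastFalsified : Assignment n → CNF n → Clause n → Clause n
  lastFalsified y []      D = D
  lastFalsified y (C ∷ F) D = lastFalsified y F (if clauseTrue y C false then D else C)

  setHead : Assignment n → Clause n → Assignment n
  setHead y []            = y
  setHead y ((s , i) ∷ C) = y [ i ]≔ s

  binary : ∀ {m} → ℕ → Vec Bool m → ℕ
  binary v []          = v
  binary v (false ∷ u) = binary (2 * v) u
  binary v (true  ∷ u) = binary (suc (2 * v)) u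

  -- The die picks the slot `binary 0 u % k` of the falsified clause. A slot beyond the end of the
  -- clause leaves the assignment as it is.
  walkStep : ∀ {s} k .⦃ _ : NonZero k ⦄ → CNF n → Vec Bool s → Assignment n → Assignment n
  walkStep k F u y = setHead y (List.drop (binary 0 u % k) (lastFalsified y F []))

  walk : ∀ {s m} k .⦃ _ : NonZero k ⦄ → CNF n → Vec (Vec Bool s) m → Assignment n → Assignment n
  walk k F []       y = y
  walk k F (u ∷ us) y = walk k F us (walkStep k F u y)

  allTrue : ∀ {m} → Vec Bool m → Bool
  allTrue []      = true
  allTrue (b ∷ u) = b ∧ allTrue u

  -- Each of the `e` dice fixes the variable if it shows all ones. So the probability ν of being
  -- free is `(μ / M) ^ e` with `M = 2 ^ s` and `μ = M - 1`.
  stillFree : ∀ {s e} → Bool → Vec (Vec Bool s) e → Bool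
  stillFree q []       = q
  stillFree q (u ∷ us) = stillFree (q ∧ not (allTrue u)) us

  sampleBit : ∀ {s e} → Bool → Vec (Vec Bool s) e × Bool → Bool
  sampleBit z (us , b) = if stillFree true us then b else z

  sampleAll : ∀ {s e} → Vec Bool n → Vec (Vec (Vec Bool s) e × Bool) n → Vec Bool n
  sampleAll = Vec.zipWith sampleBit

  -- The best satisfying assignment so far, and its distance plus one (zero if there is none).
  Best : ℕ → Set
  Best n = Assignment n × ℕ

  -- `m` is already one too large, so `suc (dH z y) ∸ m` is positive exactly if `y` is farther than
  -- the recorded assignment, or nothing is recorded.
  update : Assignment n → Assignment n → Best n → Best n
  update z y (w , m) = improve (suc (dH z y) ∸ m)
    where
    improve : ℕ → Best _
    improve zero    = w , m
    improve (suc _) = y , suc (dH z y)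

  check : CNF n → Assignment n → Assignment n → Best n → Best n
  check F z y best = accept (lastFalsified y F [])
    where
    accept : Clause _ → Best _
    accept []      = update z y best
    accept (_ ∷ _) = best

  dieCode : ℕ → Code
  dieCode s = bit ^^ s

  sampleCode : ℕ → ℕ → ℕ → Code
  sampleCode s e n = (dieCode s ^^ e ⊗ bit) ^^ n

  attemptCode : ℕ → ℕ → ℕ → ℕ → Code
  attemptCode s n T e = sampleCode s e n ⊗ dieCode s ^^ T

  -- One attempt for each of the exponents `e`, `e + 1`, ..., `e + c - 1`.
  roundCode : ℕ → ℕ → ℕ → ℕ → ℕ → Code
  roundCode s n T e zero    = unit
  roundCode s n T e (suc c) = attemptCode s n T e ⊗ roundCode s n T (suc e) c

  module _ (k s : ℕ) .⦃ _ : NonZero k ⦄ (F : CNF n) (z : Assignment n) (T : ℕ) where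

    candidate : ∀ e → El (attemptCode s n T e) → Assignment n
    candidate e (us , vs) = walk k F vs (sampleAll z us)

    attempt : ∀ e → El (attemptCode s n T e) → Best n → Best n
    attempt e x = check F z (candidate e x)

    round : ∀ e c → El (roundCode s n T e c) → Best n → Best n
    round e zero    x       best = best
    round e (suc c) (x , r) best = round (suc e) c r (attempt e x best)

    rounds : ∀ e c {m} → Vec (El (roundCode s n T e c)) m → Best n → Best n
    rounds e c []       best = best
    rounds e c (x ∷ xs) best = rounds e c xs (round e c x best)

-- The main part as a program, with its number of steps

module Programs where
  open Execution
  open Algorithm
  open import Data.Fin using (Fin; zero; suc; toℕ; #_)
  open import Data.Fin.Properties using (toℕ<n)
  open import Data.List.Properties using (ʳ++-ʳ++; ++-identityʳ; drop-[])
  open import Data.Vec.Properties using (length-toList)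
  open import Data.List.Relation.Unary.All using ([]; _∷_)
  open import Data.Nat.DivMod using (_%_; m%n<n)

  pattern #V = 23

  BEST NIL I A S B Q L C P CL Y TAPE F Z E TC TL BD EC EL RC NP : Fin #V
  BEST = # 0
  NIL  = # 1
  I    = # 2
  A    = # 3
  S    = # 4
  B    = # 5
  Q    = # 6
  L    = # 7
  C    = # 8
  P    = # 9
  CL   = # 10
  Y    = # 11
  TAPE = # 12
  F    = # 13
  Z    = # 14
  E    = # 15
  TC   = # 16
  TL   = # 17
  BD   = # 18
  EC   = # 19
  EL   = # 20
  RC   = # 21
  NP   = # 22

  private variable
    n : ℕ
    b₀ : Tree

  -- NIL is never assigned anything but nil.
  skip : Cmd #V
  skip = NIL ≔ nil

  infixr 5 nil⁵∷_ nil⁹∷_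

  -- Stores are spelled out variable by variable so that steps compute; between the subprograms most
  -- working variables are back at `nil`.
  nil⁵∷_ : Vec Tree n → Vec Tree (5 + n)
  nil⁵∷ ρ = nil ∷ nil ∷ nil ∷ nil ∷ nil ∷ ρ

  nil⁹∷_ : Vec Tree n → Vec Tree (9 + n)
  nil⁹∷ ρ = nil⁵∷ nil ∷ nil ∷ nil ∷ nil ∷ ρ

  encodeBits : List Bool → Tree
  encodeBits bs = ⌜ List.map ⌜_⌝ᵇ bs ⌝ˡ

  dropTree : ℕ → Tree → Tree
  dropTree zero    t = t
  dropTree (suc m) t = dropTree m (right t)

  dropTree-lookup : ∀ (y : Assignment n) i → left (dropTree (toℕ i) (encodeAssignment y)) ≡ ⌜ lookup y i ⌝ᵇ
  dropTree-lookup (b ∷ y) zero    = refl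
  dropTree-lookup (b ∷ y) (suc i) = dropTree-lookup y i

  lookupLoop : Cmd #V
  lookupLoop = while I (A ≔ tl A ⨾ I ≔ tl I)

  exec-lookupLoop : ∀ m {t} {ρ : Vec Tree 19} →
    Exec lookupLoop (b₀ ∷ nil ∷ ⌜ m ⌝ⁿ ∷ t ∷ ρ) (loopTime 3 m) (b₀ ∷ nil ∷ nil ∷ dropTree m t ∷ ρ)
  exec-lookupLoop zero    = while-nil refl
  exec-lookupLoop (suc m) = while-node refl (straight 3 (λ _ _ → refl)) (exec-lookupLoop m)

  compareCmd : Cmd #V
  compareCmd = cond S (cond B (Q ≔ cons NIL NIL) skip) (cond B skip (Q ≔ cons NIL NIL))

  exec-compare : ∀ s b q {ρ : Vec Tree 16} →
    Exec compareCmd (b₀ ∷ nil ∷ nil ∷ nil ∷ ⌜ s ⌝ᵇ ∷ ⌜ b ⌝ᵇ ∷ ⌜ q ⌝ᵇ ∷ ρ) 3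
                    (b₀ ∷ nil ∷ nil ∷ nil ∷ ⌜ s ⌝ᵇ ∷ ⌜ b ⌝ᵇ ∷ ⌜ q ∨ not (s xor b) ⌝ᵇ ∷ ρ)
  exec-compare false false false = straight 3 (λ _ _ → refl)
  exec-compare false false true  = straight 3 (λ _ _ → refl)
  exec-compare false true  false = straight 3 (λ _ _ → refl)
  exec-compare false true  true  = straight 3 (λ _ _ → refl)
  exec-compare true  false false = straight 3 (λ _ _ → refl)
  exec-compare true  false true  = straight 3 (λ _ _ → refl)
  exec-compare true  true  false = straight 3 (λ _ _ → refl)
  exec-compare true  true  true  = straight 3 (λ _ _ → refl)

  literalFetch literalClean literalCmd : Cmd #V
  literalFetch = S ≔ hd L ⨾ L ≔ tl L ⨾ I ≔ tl S ⨾ S ≔ hd S ⨾ A ≔ var Y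
  literalClean = B ≔ nil ⨾ S ≔ nil
  literalCmd   = literalFetch ⨾ lookupLoop ⨾ B ≔ hd A ⨾ A ≔ nil ⨾ compareCmd ⨾ literalClean

  literalTime : ℕ → ℕ
  literalTime n = suc (9 + suc (loopTime 3 n + 11))

  exec-literal : ∀ (y : Assignment n) l C q {c p cl} {ρ : Vec Tree 11} →
    Exec literalCmd (b₀ ∷ nil⁵∷ ⌜ q ⌝ᵇ ∷ encodeClause (l ∷ C) ∷ c ∷ p ∷ cl ∷ encodeAssignment y ∷ ρ)
      (literalTime n)
      (b₀ ∷ nil⁵∷ ⌜ q ∨ literalTrue y l ⌝ᵇ ∷ encodeClause C ∷ c ∷ p ∷ cl ∷ encodeAssignment y ∷ ρ)
  exec-literal {b₀ = b₀} y (s , i) C q {c} {p} {cl} {ρ} =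
      straight 9 (λ _ _ → refl)
    ▸ weaken (loopTime-mono (≤-refl {3}) (<⇒≤ (toℕ<n i))) (exec-lookupLoop (toℕ i))
    ▸ straight 1 (λ K _ → cong (λ u → K , b₀ ∷ nil ∷ nil ∷ dropTree (toℕ i) (encodeAssignment y) ∷ ⌜ s ⌝ᵇ ∷ u ∷ ⌜ q ⌝ᵇ ∷ encodeClause C ∷ c ∷ p ∷ cl ∷ encodeAssignment y ∷ ρ) (dropTree-lookup y i))
    ▸ straight 1 (λ _ _ → refl)
    ▸ exec-compare s (lookup y i) q
    ▸ straight 3 (λ _ _ → refl)

  exec-literals : ∀ (y : Assignment n) D q {c p cl} {ρ : Vec Tree 11} →
    Exec (while L literalCmd) (b₀ ∷ nil⁵∷ ⌜ q ⌝ᵇ ∷ encodeClause D ∷ c ∷ p ∷ cl ∷ encodeAssignment y ∷ ρ)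
      (loopTime (literalTime n) (length D))
      (b₀ ∷ nil⁵∷ ⌜ clauseTrue y D q ⌝ᵇ ∷ nil ∷ c ∷ p ∷ cl ∷ encodeAssignment y ∷ ρ)
  exec-literals y []      q = while-nil refl
  exec-literals y (l ∷ D) q = while-node refl (exec-literal y l D q) (exec-literals y D (q ∨ literalTrue y l))

  falsifiedBody findCmd : Cmd #V
  falsifiedBody = (C ≔ hd P ⨾ P ≔ tl P ⨾ L ≔ var C) ⨾ while L literalCmd ⨾ cond Q skip (CL ≔ var C) ⨾ Q ≔ nil ⨾ C ≔ nil
  findCmd = (CL ≔ nil ⨾ P ≔ var F) ⨾ while P falsifiedBody

  falsifiedTime findTime : ℕ → ℕ → ℕ
  falsifiedTime k n = suc (5 + suc (loopTime (literalTime n) k + 6))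
  findTime t f = suc (3 + loopTime t f)

  exec-select : ∀ q (D D′ : Clause n) {p} {ρ : Vec Tree 12} →
    Exec (cond Q skip (CL ≔ var C)) (b₀ ∷ nil⁵∷ ⌜ q ⌝ᵇ ∷ nil ∷ encodeClause D ∷ p ∷ encodeClause D′ ∷ ρ) 2
      (b₀ ∷ nil⁵∷ ⌜ q ⌝ᵇ ∷ nil ∷ encodeClause D ∷ p ∷ encodeClause (if q then D′ else D) ∷ ρ)
  exec-select false D D′ = straight 2 (λ _ _ → refl)
  exec-select true  D D′ = straight 2 (λ _ _ → refl)

  exec-falsified : ∀ k (y : Assignment n) G D → Is k -CNF G → ∀ {ρ : Vec Tree 11} →
    Exec (while P falsifiedBody)
      (b₀ ∷ nil⁵∷ nil ∷ nil ∷ nil ∷ encodeCNF G ∷ encodeClause D ∷ encodeAssignment y ∷ ρ)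
      (loopTime (falsifiedTime k n) (length G))
      (b₀ ∷ nil⁹∷ encodeClause (lastFalsified y G D) ∷ encodeAssignment y ∷ ρ)
  exec-falsified k y []       D []           = while-nil refl
  exec-falsified k y (D′ ∷ G) D (|D′| ∷ |G|) = while-node refl
    ( straight 5 (λ _ _ → refl)
    ▸ weaken (loopTime-mono ≤-refl |D′|) (exec-literals y D′ false)
    ▸ exec-select (clauseTrue y D′ false) D′ D
    ▸ straight 3 (λ _ _ → refl))
    (exec-falsified k y G (if clauseTrue y D′ false then D else D′) |G|)

  exec-find : ∀ k (y : Assignment n) G → Is k -CNF G → ∀ {tape} {ρ : Vec Tree 9} →
    Exec findCmd
      (b₀ ∷ nil⁹∷ nil ∷ encodeAssignment y ∷ tape ∷ encodeCNF G ∷ ρ)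
      (findTime (falsifiedTime k n) (length G))
      (b₀ ∷ nil⁹∷ encodeClause (lastFalsified y G []) ∷ encodeAssignment y ∷ tape ∷ encodeCNF G ∷ ρ)
  exec-find k y G |G| = straight 3 (λ _ _ → refl) ▸ exec-falsified k y G [] |G|

  dropCmd : ℕ → Cmd #V
  dropCmd zero    = skip
  dropCmd (suc j) = L ≔ tl L ⨾ dropCmd j

  exec-drop : ∀ j (D : Clause n) {b q} {ρ : Vec Tree 15} →
    Exec (dropCmd j) (b₀ ∷ nil ∷ nil ∷ nil ∷ nil ∷ b ∷ q ∷ encodeClause D ∷ ρ) (suc (j * 2))
      (b₀ ∷ nil ∷ nil ∷ nil ∷ nil ∷ b ∷ q ∷ encodeClause (List.drop j D) ∷ ρ)
  exec-drop zero    D       = straight 1 (λ _ _ → refl)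
  exec-drop {n = n} {b₀ = b₀} (suc j) [] {b} {q} {ρ} =
    retarget (cong (λ D → b₀ ∷ nil ∷ nil ∷ nil ∷ nil ∷ b ∷ q ∷ encodeClause D ∷ ρ) (drop-[] {A = Literal n} j))
      (straight 1 (λ _ _ → refl) ▸ exec-drop {n = n} j [])
  exec-drop (suc j) (_ ∷ D) = straight 1 (λ _ _ → refl) ▸ exec-drop j D

  -- A decision tree over the bits of the die. At each leaf the value `v` is a constant, so the
  -- remainder modulo `k` is taken when the program is built.
  pickCmd : ∀ k .⦃ _ : NonZero k ⦄ → ℕ → ℕ → Cmd #V
  pickCmd k zero    v = B ≔ nil ⨾ dropCmd (v % k)
  pickCmd k (suc s) v = B ≔ hd TAPE ⨾ TAPE ≔ tl TAPE ⨾ cond B (pickCmd k s (suc (2 * v))) (pickCmd k s (2 * v))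

  pickTime : ℕ → ℕ → ℕ
  pickTime k zero    = suc (1 + suc (k * 2))
  pickTime k (suc s) = suc (1 + suc (1 + suc (pickTime k s)))

  exec-pick : ∀ k .⦃ _ : NonZero k ⦄ {s} (u : Vec Bool s) v (D : Clause n) w {b c p cl y} {ρ : Vec Tree 10} →
    Exec (pickCmd k s v)
      (b₀ ∷ nil ∷ nil ∷ nil ∷ nil ∷ b ∷ nil ∷ encodeClause D ∷ c ∷ p ∷ cl ∷ y ∷ encodeBits (writeBits (dieCode s) u w) ∷ ρ)
      (pickTime k s)
      (b₀ ∷ nil⁵∷ nil ∷ encodeClause (List.drop (binary v u % k) D) ∷ c ∷ p ∷ cl ∷ y ∷ encodeBits w ∷ ρ)
  exec-pick k []          v D w = straight 1 (λ _ _ → refl) ▸ weaken (s≤s (*-monoˡ-≤ 2 (<⇒≤ (m%n<n v k)))) (exec-drop (v % k) D)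
  exec-pick k (false ∷ u) v D w = straight 1 (λ _ _ → refl) ▸ straight 1 (λ _ _ → refl) ▸ cond-nil refl (exec-pick k u (2 * v) D w)
  exec-pick k (true ∷ u)  v D w = straight 1 (λ _ _ → refl) ▸ straight 1 (λ _ _ → refl) ▸ cond-node refl (exec-pick k u (suc (2 * v)) D w)

  -- Only the head of a list is accessible. The entries in front of the variable are moved to `A`,
  -- which reverses them, and are moved back after the change.
  moveLoop backLoop setBit : Cmd #V
  moveLoop = while I (B ≔ hd Y ⨾ A ≔ cons B A ⨾ Y ≔ tl Y ⨾ I ≔ tl I ⨾ B ≔ nil)
  backLoop = while A (B ≔ hd A ⨾ Y ≔ cons B Y ⨾ A ≔ tl A ⨾ B ≔ nil)
  setBit   = (S ≔ hd L ⨾ L ≔ nil ⨾ I ≔ tl S ⨾ S ≔ hd S) ⨾ moveLoop ⨾ (Y ≔ tl Y ⨾ Y ≔ cons S Y ⨾ S ≔ nil) ⨾ backLoop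

  exec-moveLoop : ∀ xs zs acc {s q l c p cl} {ρ : Vec Tree 11} →
    Exec moveLoop
      (b₀ ∷ nil ∷ ⌜ length xs ⌝ⁿ ∷ encodeBits acc ∷ s ∷ nil ∷ q ∷ l ∷ c ∷ p ∷ cl ∷ encodeBits (xs ++ zs) ∷ ρ)
      (loopTime 9 (length xs))
      (b₀ ∷ nil ∷ nil ∷ encodeBits (xs ʳ++ acc) ∷ s ∷ nil ∷ q ∷ l ∷ c ∷ p ∷ cl ∷ encodeBits zs ∷ ρ)
  exec-moveLoop []       zs acc = while-nil refl
  exec-moveLoop (x ∷ xs) zs acc = while-node refl (straight 9 (λ _ _ → refl)) (exec-moveLoop xs zs (x ∷ acc))

  exec-backLoop : ∀ acc ys {s q l c p cl} {ρ : Vec Tree 11} →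
    Exec backLoop
      (b₀ ∷ nil ∷ nil ∷ encodeBits acc ∷ s ∷ nil ∷ q ∷ l ∷ c ∷ p ∷ cl ∷ encodeBits ys ∷ ρ)
      (loopTime 7 (length acc))
      (b₀ ∷ nil ∷ nil ∷ nil ∷ s ∷ nil ∷ q ∷ l ∷ c ∷ p ∷ cl ∷ encodeBits (acc ʳ++ ys) ∷ ρ)
  exec-backLoop []        ys = while-nil refl
  exec-backLoop (x ∷ acc) ys = while-node refl (straight 7 (λ _ _ → refl)) (exec-backLoop acc (x ∷ ys))

  ʳ++-involutive : ∀ (xs ys : List Bool) → (xs ʳ++ []) ʳ++ ys ≡ xs ++ ys
  ʳ++-involutive xs ys = ʳ++-ʳ++ xs

  length-ʳ++-[] : ∀ (xs ys : List Bool) → length (xs ʳ++ ys) ≡ length xs + length ys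
  length-ʳ++-[] []       ys = refl
  length-ʳ++-[] (x ∷ xs) ys = trans (length-ʳ++-[] xs (x ∷ ys)) (+-suc (length xs) (length ys))

  splitAt-index : ∀ (y : Assignment n) i s → ∃[ xs ] ∃[ b ] ∃[ zs ]
    (toList y ≡ xs ++ b ∷ zs × length xs ≡ toℕ i × toList (y [ i ]≔ s) ≡ xs ++ s ∷ zs)
  splitAt-index (b ∷ y) zero    s = [] , b , toList y , refl , refl , refl
  splitAt-index (b ∷ y) (suc i) s =
    let xs , c , zs , p , q , r = splitAt-index y i s
    in b ∷ xs , c , zs , cong (b ∷_) p , cong suc q , cong (b ∷_) r

  setTime : ℕ → ℕ
  setTime n = suc (7 + suc (loopTime 9 n + suc (5 + loopTime 7 n)))

  exec-setBit : ∀ (y : Assignment n) s i (D : Clause n) {c p cl} {ρ : Vec Tree 11} →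
    Exec setBit
      (b₀ ∷ nil⁵∷ nil ∷ encodeClause ((s , i) ∷ D) ∷ c ∷ p ∷ cl ∷ encodeAssignment y ∷ ρ)
      (setTime n)
      (b₀ ∷ nil⁵∷ nil ∷ nil ∷ c ∷ p ∷ cl ∷ encodeAssignment (y [ i ]≔ s) ∷ ρ)
  exec-setBit {n} {b₀} y s i D {c} {p} {cl} {ρ} with splitAt-index y i s
  ... | xs , b , zs , eq , len , eq′ rewrite eq | eq′ | sym len =
      straight 7 (λ _ _ → refl)
    ▸ weaken (loopTime-mono ≤-refl |xs|≤n) (exec-moveLoop xs (b ∷ zs) [])
    ▸ straight 5 (λ _ _ → refl)
    ▸ weaken (loopTime-mono ≤-refl (≤-trans (≤-reflexive (trans (length-ʳ++-[] xs []) (+-identityʳ (length xs)))) |xs|≤n))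
        (retarget (cong (λ ys → b₀ ∷ nil⁵∷ nil ∷ nil ∷ c ∷ p ∷ cl ∷ encodeBits ys ∷ ρ) (ʳ++-involutive xs (s ∷ zs)))
          (exec-backLoop (xs ʳ++ []) (s ∷ zs)))
    where
    |xs|≤n : length xs ≤ n
    |xs|≤n = subst (_≤ n) (sym len) (<⇒≤ (toℕ<n i))

  module _ (k s : ℕ) .⦃ _ : NonZero k ⦄ where

    walkBody walkCmd : Cmd #V
    walkBody = TC ≔ tl TC ⨾ findCmd ⨾ (L ≔ var CL ⨾ CL ≔ nil) ⨾ pickCmd k s 0 ⨾ cond L setBit skip
    walkCmd  = TC ≔ var TL ⨾ while TC walkBody

    walkBodyTime walkTime : ℕ → ℕ → ℕ
    walkBodyTime f n = suc (1 + suc (findTime (falsifiedTime k n) f + suc (3 + suc (pickTime k s + suc (setTime n)))))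
    walkTime t m = suc (1 + loopTime t m)

    exec-setHead : ∀ (y : Assignment n) (D : Clause n) {c p cl} {ρ : Vec Tree 11} →
      Exec (cond L setBit skip)
        (b₀ ∷ nil⁵∷ nil ∷ encodeClause D ∷ c ∷ p ∷ cl ∷ encodeAssignment y ∷ ρ)
        (suc (setTime n))
        (b₀ ∷ nil⁵∷ nil ∷ nil ∷ c ∷ p ∷ cl ∷ encodeAssignment (setHead y D) ∷ ρ)
    exec-setHead y []            = weaken (s≤s (s≤s z≤n)) (straight 2 (λ _ _ → refl))
    exec-setHead y ((s , i) ∷ D) = cond-node refl (exec-setBit y s i D)

    exec-walkLoop : ∀ {m} (us : El (dieCode s ^^ m)) (y : Assignment n) G → Is k -CNF G → ∀ w {z e} {ρ : Vec Tree 6} →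
      Exec (while TC walkBody)
        (b₀ ∷ nil⁹∷ nil ∷ encodeAssignment y ∷
          encodeBits (writeBits (dieCode s ^^ m) us w) ∷ encodeCNF G ∷ z ∷ e ∷ ⌜ m ⌝ⁿ ∷ ρ)
        (loopTime (walkBodyTime (length G) n) m)
        (b₀ ∷ nil⁹∷ nil ∷ encodeAssignment (walk k G us y) ∷
          encodeBits w ∷ encodeCNF G ∷ z ∷ e ∷ nil ∷ ρ)
    exec-walkLoop []       y G |G| w = while-nil refl
    exec-walkLoop {m = suc m} (u ∷ us) y G |G| w = while-node refl
      ( straight 1 (λ _ _ → refl)
      ▸ exec-find k y G |G|
      ▸ straight 3 (λ _ _ → refl)
      ▸ exec-pick k u 0 (lastFalsified y G []) (writeBits (dieCode s ^^ m) us w)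
      ▸ exec-setHead y (List.drop (binary 0 u % k) (lastFalsified y G [])))
      (exec-walkLoop us (walkStep k G u y) G |G| w)

    exec-walk : ∀ {m} (us : El (dieCode s ^^ m)) (y : Assignment n) G → Is k -CNF G → ∀ w {z e} {ρ : Vec Tree 5} →
      Exec walkCmd
        (b₀ ∷ nil⁹∷ nil ∷ encodeAssignment y ∷
          encodeBits (writeBits (dieCode s ^^ m) us w) ∷ encodeCNF G ∷ z ∷ e ∷ nil ∷ ⌜ m ⌝ⁿ ∷ ρ)
        (walkTime (walkBodyTime (length G) n) m)
        (b₀ ∷ nil⁹∷ nil ∷ encodeAssignment (walk k G us y) ∷
          encodeBits w ∷ encodeCNF G ∷ z ∷ e ∷ nil ∷ ⌜ m ⌝ⁿ ∷ ρ)
    exec-walk us y G |G| w = straight 1 (λ _ _ → refl) ▸ exec-walkLoop us y G |G| w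

    -- The first zero decides that the die does not show all ones, but its other bits still have to
    -- be consumed to stay aligned with the code.
    skipBits chunkCmd : ℕ → Cmd #V
    skipBits zero    = B ≔ nil
    skipBits (suc s) = TAPE ≔ tl TAPE ⨾ skipBits s
    chunkCmd zero    = B ≔ nil ⨾ Q ≔ nil
    chunkCmd (suc s) = B ≔ hd TAPE ⨾ TAPE ≔ tl TAPE ⨾ cond B (chunkCmd s) (skipBits s)

    chunkTime : ℕ → ℕ
    chunkTime zero    = 3
    chunkTime (suc s) = suc (1 + suc (1 + suc (chunkTime s)))

    exec-skipBits : ∀ {s} (u : Vec Bool s) w {i a sg b q l c p cl y} {ρ : Vec Tree 10} →
      Exec (skipBits s) (b₀ ∷ nil ∷ i ∷ a ∷ sg ∷ b ∷ q ∷ l ∷ c ∷ p ∷ cl ∷ y ∷ encodeBits (writeBits (dieCode s) u w) ∷ ρ)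
        (chunkTime s)
        (b₀ ∷ nil ∷ i ∷ a ∷ sg ∷ nil ∷ q ∷ l ∷ c ∷ p ∷ cl ∷ y ∷ encodeBits w ∷ ρ)
    exec-skipBits []      w = weaken (s≤s z≤n) (straight 1 (λ _ _ → refl))
    exec-skipBits (b ∷ u) w = weaken (s≤s (s≤s (m≤n+m _ 3))) (straight 1 (λ _ _ → refl) ▸ exec-skipBits u w)

    exec-chunk : ∀ {s} (u : Vec Bool s) t w {i a sg b l c p cl y} {ρ : Vec Tree 10} →
      Exec (chunkCmd s) (b₀ ∷ nil ∷ i ∷ a ∷ sg ∷ b ∷ ⌜ t ⌝ᵇ ∷ l ∷ c ∷ p ∷ cl ∷ y ∷ encodeBits (writeBits (dieCode s) u w) ∷ ρ)
        (chunkTime s)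
        (b₀ ∷ nil ∷ i ∷ a ∷ sg ∷ nil ∷ ⌜ t ∧ not (allTrue u) ⌝ᵇ ∷ l ∷ c ∷ p ∷ cl ∷ y ∷ encodeBits w ∷ ρ)
    exec-chunk []          false w = straight 3 (λ _ _ → refl)
    exec-chunk []          true  w = straight 3 (λ _ _ → refl)
    exec-chunk (false ∷ u) false w = straight 1 (λ _ _ → refl) ▸ straight 1 (λ _ _ → refl) ▸ cond-nil refl (exec-skipBits u w)
    exec-chunk (false ∷ u) true  w = straight 1 (λ _ _ → refl) ▸ straight 1 (λ _ _ → refl) ▸ cond-nil refl (exec-skipBits u w)
    exec-chunk (true ∷ u)  t     w = straight 1 (λ _ _ → refl) ▸ straight 1 (λ _ _ → refl) ▸ cond-node refl (exec-chunk u t w)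

    freeLoop sampleBody sampleCmd : Cmd #V
    freeLoop   = while I (I ≔ tl I ⨾ chunkCmd s)
    sampleBody = (S ≔ hd L ⨾ L ≔ tl L ⨾ I ≔ var E ⨾ Q ≔ cons NIL NIL) ⨾ freeLoop ⨾ (B ≔ hd TAPE ⨾ TAPE ≔ tl TAPE) ⨾
                 cond Q (A ≔ cons B A) (A ≔ cons S A) ⨾ Q ≔ nil ⨾ B ≔ nil ⨾ S ≔ nil
    sampleCmd  = (Y ≔ nil ⨾ L ≔ var Z) ⨾ while L sampleBody ⨾ backLoop

    freeTime sampleTime : ℕ → ℕ
    freeTime   e = loopTime (suc (1 + chunkTime s)) e
    sampleTime e = suc (7 + suc (freeTime e + suc (3 + suc (2 + 5))))

    sampleAllTime : ℕ → ℕ → ℕ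
    sampleAllTime n e = suc (3 + suc (loopTime (sampleTime e) n + loopTime 7 n))

    exec-freeLoop : ∀ {e} (us : El (dieCode s ^^ e)) t w {a sg l c p cl y} {ρ : Vec Tree 10} →
      Exec freeLoop (b₀ ∷ nil ∷ ⌜ e ⌝ⁿ ∷ a ∷ sg ∷ nil ∷ ⌜ t ⌝ᵇ ∷ l ∷ c ∷ p ∷ cl ∷ y ∷ encodeBits (writeBits (dieCode s ^^ e) us w) ∷ ρ)
        (freeTime e)
        (b₀ ∷ nil ∷ nil ∷ a ∷ sg ∷ nil ∷ ⌜ stillFree t us ⌝ᵇ ∷ l ∷ c ∷ p ∷ cl ∷ y ∷ encodeBits w ∷ ρ)
    exec-freeLoop []               t w = while-nil refl
    exec-freeLoop {e = suc e} (u ∷ us) t w = while-node refl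
      (straight 1 (λ _ _ → refl) ▸ exec-chunk u t (writeBits (dieCode s ^^ e) us w))
      (exec-freeLoop us (t ∧ not (allTrue u)) w)

    exec-sampleSelect : ∀ q z b acc {i} {ρ : Vec Tree 16} →
      Exec (cond Q (A ≔ cons B A) (A ≔ cons S A))
        (b₀ ∷ nil ∷ i ∷ encodeBits acc ∷ ⌜ z ⌝ᵇ ∷ ⌜ b ⌝ᵇ ∷ ⌜ q ⌝ᵇ ∷ ρ) 2
        (b₀ ∷ nil ∷ i ∷ encodeBits ((if q then b else z) ∷ acc) ∷ ⌜ z ⌝ᵇ ∷ ⌜ b ⌝ᵇ ∷ ⌜ q ⌝ᵇ ∷ ρ)
    exec-sampleSelect false z b acc = straight 2 (λ _ _ → refl)
    exec-sampleSelect true  z b acc = straight 2 (λ _ _ → refl)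

    exec-sampleLoop : ∀ {n e} (zs : Vec Bool n) (x : El (sampleCode s e n)) acc w {c p cl y f z} {ρ : Vec Tree 7} →
      Exec (while L sampleBody)
        (b₀ ∷ nil ∷ nil ∷ encodeBits acc ∷ nil ∷ nil ∷ nil ∷ encodeBits (toList zs) ∷ c ∷ p ∷ cl ∷ y ∷
          encodeBits (writeBits (sampleCode s e n) x w) ∷ f ∷ z ∷ ⌜ e ⌝ⁿ ∷ ρ)
        (loopTime (sampleTime e) n)
        (b₀ ∷ nil ∷ nil ∷ encodeBits (toList (sampleAll zs x) ʳ++ acc) ∷ nil ∷ nil ∷ nil ∷ nil ∷ c ∷ p ∷ cl ∷ y ∷
          encodeBits w ∷ f ∷ z ∷ ⌜ e ⌝ⁿ ∷ ρ)
    exec-sampleLoop []       []              acc w = while-nil refl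
    exec-sampleLoop {n = suc n} {e} (z ∷ zs) ((us , b) ∷ x) acc w = while-node refl
      ( straight 7 (λ _ _ → refl)
      ▸ exec-freeLoop us true (b ∷ writeBits (sampleCode s e n) x w)
      ▸ straight 3 (λ _ _ → refl)
      ▸ exec-sampleSelect (stillFree true us) z b acc
      ▸ straight 5 (λ _ _ → refl))
      (exec-sampleLoop zs x (sampleBit z (us , b) ∷ acc) w)

    exec-sample : ∀ {n e} (zs : Vec Bool n) (x : El (sampleCode s e n)) w {y f} {ρ : Vec Tree 7} →
      Exec sampleCmd
        (b₀ ∷ nil⁹∷ nil ∷ y ∷
          encodeBits (writeBits (sampleCode s e n) x w) ∷ f ∷ encodeAssignment zs ∷ ⌜ e ⌝ⁿ ∷ ρ)
        (sampleAllTime n e)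
        (b₀ ∷ nil⁹∷ nil ∷ encodeAssignment (sampleAll zs x) ∷
          encodeBits w ∷ f ∷ encodeAssignment zs ∷ ⌜ e ⌝ⁿ ∷ ρ)
    exec-sample {b₀ = b₀} {n = n} {e} zs x w {f = f} {ρ} =
        straight 3 (λ _ _ → refl)
      ▸ exec-sampleLoop zs x [] w
      ▸ retarget (cong (λ ys → b₀ ∷ nil⁹∷ nil ∷ encodeBits ys ∷ encodeBits w ∷ f ∷ encodeAssignment zs ∷ ⌜ e ⌝ⁿ ∷ ρ)
                   (trans (ʳ++-involutive (toList (sampleAll zs x)) []) (++-identityʳ _)))
          (weaken (loopTime-mono ≤-refl (≤-reflexive (trans (length-ʳ++-[] (toList (sampleAll zs x)) []) (trans (+-identityʳ _) (length-toList (sampleAll zs x))))))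
            (exec-backLoop (toList (sampleAll zs x) ʳ++ []) []))

  countLoop subLoop keepCmd updateCmd checkCmd : Cmd #V
  countLoop = while L ((S ≔ hd L ⨾ L ≔ tl L ⨾ B ≔ hd A ⨾ A ≔ tl A) ⨾
                cond S (cond B skip (I ≔ cons NIL I)) (cond B (I ≔ cons NIL I) skip) ⨾ S ≔ nil ⨾ B ≔ nil)
  subLoop   = while A (A ≔ tl A ⨾ I ≔ tl I)
  keepCmd   = cond I (BEST ≔ var Y ⨾ BD ≔ var S) skip
  updateCmd = (I ≔ cons NIL NIL ⨾ A ≔ var Y ⨾ L ≔ var Z) ⨾ countLoop ⨾ (S ≔ var I ⨾ A ≔ var BD) ⨾ subLoop ⨾
              keepCmd ⨾ I ≔ nil ⨾ S ≔ nil
  checkCmd  = findCmd ⨾ cond CL skip updateCmd ⨾ CL ≔ nil ⨾ Y ≔ nil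

  updateTime : ℕ → ℕ
  updateTime n = suc (5 + suc (loopTime (suc (7 + suc (3 + 3))) n + suc (3 + suc (loopTime 3 (suc n) + suc (4 + 3)))))

  checkTime : ℕ → ℕ → ℕ
  checkTime t n = suc (t + suc (suc (updateTime n) + 3))

  exec-count : ∀ (zs ys : Vec Bool n) m {q c p cl y} {ρ : Vec Tree 11} →
    Exec countLoop
      (b₀ ∷ nil ∷ ⌜ m ⌝ⁿ ∷ encodeAssignment ys ∷ nil ∷ nil ∷ q ∷ encodeAssignment zs ∷ c ∷ p ∷ cl ∷ y ∷ ρ)
      (loopTime (suc (7 + suc (3 + 3))) n)
      (b₀ ∷ nil ∷ ⌜ dH zs ys + m ⌝ⁿ ∷ nil ∷ nil ∷ nil ∷ q ∷ nil ∷ c ∷ p ∷ cl ∷ y ∷ ρ)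
  exec-count []           []           m = while-nil refl
  exec-count (false ∷ zs) (false ∷ ys) m = while-node refl (straight 7 (λ _ _ → refl) ▸ straight 3 (λ _ _ → refl) ▸ straight 3 (λ _ _ → refl)) (exec-count zs ys m)
  exec-count (true ∷ zs)  (true ∷ ys)  m = while-node refl (straight 7 (λ _ _ → refl) ▸ straight 3 (λ _ _ → refl) ▸ straight 3 (λ _ _ → refl)) (exec-count zs ys m)
  exec-count {b₀ = b₀} (false ∷ zs) (true ∷ ys) m {q} {c} {p} {cl} {y} {ρ} = while-node refl
    (straight 7 (λ _ _ → refl) ▸ straight 3 (λ _ _ → refl) ▸ straight 3 (λ _ _ → refl))
    (retarget (cong (λ d → b₀ ∷ nil ∷ ⌜ d ⌝ⁿ ∷ nil ∷ nil ∷ nil ∷ q ∷ nil ∷ c ∷ p ∷ cl ∷ y ∷ ρ) (+-suc (dH zs ys) m)) (exec-count zs ys (suc m)))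
  exec-count {b₀ = b₀} (true ∷ zs) (false ∷ ys) m {q} {c} {p} {cl} {y} {ρ} = while-node refl
    (straight 7 (λ _ _ → refl) ▸ straight 3 (λ _ _ → refl) ▸ straight 3 (λ _ _ → refl))
    (retarget (cong (λ d → b₀ ∷ nil ∷ ⌜ d ⌝ⁿ ∷ nil ∷ nil ∷ nil ∷ q ∷ nil ∷ c ∷ p ∷ cl ∷ y ∷ ρ) (+-suc (dH zs ys) m)) (exec-count zs ys (suc m)))

  exec-sub : ∀ m d {ρ : Vec Tree 19} →
    Exec subLoop (b₀ ∷ nil ∷ ⌜ d ⌝ⁿ ∷ ⌜ m ⌝ⁿ ∷ ρ) (loopTime 3 m) (b₀ ∷ nil ∷ ⌜ d ∸ m ⌝ⁿ ∷ nil ∷ ρ)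
  exec-sub zero    d       = while-nil refl
  exec-sub {b₀ = b₀} (suc m) zero {ρ} = while-node refl (straight 3 (λ _ _ → refl))
    (retarget (cong (λ d → b₀ ∷ nil ∷ ⌜ d ⌝ⁿ ∷ nil ∷ ρ) (0∸n≡0 m)) (exec-sub m zero))
  exec-sub (suc m) (suc d) = while-node refl (straight 3 (λ _ _ → refl)) (exec-sub m d)

  dH≤n : ∀ (x y : Vec Bool n) → dH x y ≤ n
  dH≤n []          []          = z≤n
  dH≤n (false ∷ x) (false ∷ y) = m≤n⇒m≤1+n (dH≤n x y)
  dH≤n (true ∷ x)  (true ∷ y)  = m≤n⇒m≤1+n (dH≤n x y)
  dH≤n (false ∷ x) (true ∷ y)  = s≤s (dH≤n x y)
  dH≤n (true ∷ x)  (false ∷ y) = s≤s (dH≤n x y)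

  infix 9 _·_
  -- `BEST` and `BD` are far apart in the store but change together; this fills in both.
  _·_ : Best n → (Tree → Tree → Store #V) → Store #V
  (w , m) · σ = σ (encodeAssignment w) ⌜ m ⌝ⁿ

  -- Bounds the unary number in `BD`, which the subtraction loop counts down.
  update≤ : ∀ (z y : Assignment n) best → proj₂ best ≤ suc n → proj₂ (update z y best) ≤ suc n
  update≤ z y (w , m) le with suc (dH z y) ∸ m
  ... | zero  = le
  ... | suc _ = s≤s (dH≤n z y)

  check≤ : ∀ G (z y : Assignment n) best → proj₂ best ≤ suc n → proj₂ (check G z y best) ≤ suc n
  check≤ G z y best le with lastFalsified y G []
  ... | []    = update≤ z y best le
  ... | _ ∷ _ = le

  exec-keep : ∀ (z y : Assignment n) best {cl tape f e tc tb} {ρ : Vec Tree 4} →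
    Exec (keepCmd ⨾ I ≔ nil ⨾ S ≔ nil)
      (best · λ b₀ bd → b₀ ∷ nil ∷ ⌜ suc (dH z y) ∸ proj₂ best ⌝ⁿ ∷ nil ∷ ⌜ suc (dH z y) ⌝ⁿ ∷ nil⁵∷ cl ∷ encodeAssignment y ∷
        tape ∷ f ∷ encodeAssignment z ∷ e ∷ tc ∷ tb ∷ bd ∷ ρ)
      (suc (4 + 3))
      (update z y best · λ b₀ bd → b₀ ∷ nil⁹∷ cl ∷ encodeAssignment y ∷
        tape ∷ f ∷ encodeAssignment z ∷ e ∷ tc ∷ tb ∷ bd ∷ ρ)
  exec-keep z y (w , m) with suc (dH z y) ∸ m
  ... | zero  = weaken (m≤n+m _ 2) (straight 2 (λ _ _ → refl) ▸ straight 3 (λ _ _ → refl))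
  ... | suc _ = straight 4 (λ _ _ → refl) ▸ straight 3 (λ _ _ → refl)

  exec-update : ∀ (z y : Assignment n) best → proj₂ best ≤ suc n → ∀ {cl tape f e tc tb} {ρ : Vec Tree 4} →
    Exec updateCmd
      (best · λ b₀ bd → b₀ ∷ nil⁹∷ cl ∷ encodeAssignment y ∷
        tape ∷ f ∷ encodeAssignment z ∷ e ∷ tc ∷ tb ∷ bd ∷ ρ)
      (updateTime n)
      (update z y best · λ b₀ bd → b₀ ∷ nil⁹∷ cl ∷ encodeAssignment y ∷
        tape ∷ f ∷ encodeAssignment z ∷ e ∷ tc ∷ tb ∷ bd ∷ ρ)
  exec-update z y best@(w , m) m≤ {cl} {tape} {f} {e} {tc} {tb} {ρ} =
      straight 5 (λ _ _ → refl)
    ▸ retarget (cong (λ d → encodeAssignment w ∷ nil ∷ ⌜ d ⌝ⁿ ∷ nil⁵∷ nil ∷ nil ∷ cl ∷ encodeAssignment y ∷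
        tape ∷ f ∷ encodeAssignment z ∷ e ∷ tc ∷ tb ∷ ⌜ m ⌝ⁿ ∷ ρ) (+-comm (dH z y) 1)) (exec-count z y 1)
    ▸ straight 3 (λ _ _ → refl)
    ▸ weaken (loopTime-mono ≤-refl m≤) (exec-sub m (suc (dH z y)))
    ▸ exec-keep z y best

  exec-checkTail : ∀ G (z y : Assignment n) best → proj₂ best ≤ suc n → ∀ {tape f e tc tb} {ρ : Vec Tree 4} →
    Exec (cond CL skip updateCmd ⨾ CL ≔ nil ⨾ Y ≔ nil)
      (best · λ b₀ bd → b₀ ∷ nil⁹∷ encodeClause (lastFalsified y G []) ∷ encodeAssignment y ∷
        tape ∷ f ∷ encodeAssignment z ∷ e ∷ tc ∷ tb ∷ bd ∷ ρ)
      (suc (suc (updateTime n) + 3))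
      (check G z y best · λ b₀ bd → b₀ ∷ nil⁹∷ nil ∷ nil ∷
        tape ∷ f ∷ encodeAssignment z ∷ e ∷ tc ∷ tb ∷ bd ∷ ρ)
  exec-checkTail {n = n} G z y best m≤ with lastFalsified y G []
  ... | []    = cond-nil refl (exec-update z y best m≤) ▸ straight 3 (λ _ _ → refl)
  ... | _ ∷ _ = weaken (s≤s (+-monoˡ-≤ 3 {2} {suc (updateTime n)} (s≤s (s≤s z≤n)))) (cond-node {a = 1} refl (straight 1 (λ _ _ → refl)) ▸ straight 3 (λ _ _ → refl))

  exec-check : ∀ k G (z y : Assignment n) best → Is k -CNF G → proj₂ best ≤ suc n → ∀ {tape e tc tb} {ρ : Vec Tree 4} →
    Exec checkCmd
      (best · λ b₀ bd → b₀ ∷ nil⁹∷ nil ∷ encodeAssignment y ∷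
        tape ∷ encodeCNF G ∷ encodeAssignment z ∷ e ∷ tc ∷ tb ∷ bd ∷ ρ)
      (checkTime (findTime (falsifiedTime k n) (length G)) n)
      (check G z y best · λ b₀ bd → b₀ ∷ nil⁹∷ nil ∷ nil ∷
        tape ∷ encodeCNF G ∷ encodeAssignment z ∷ e ∷ tc ∷ tb ∷ bd ∷ ρ)
  exec-check k G z y best |G| m≤ = exec-find k y G |G| ▸ exec-checkTail G z y best m≤

  module _ (k s : ℕ) .⦃ _ : NonZero k ⦄ where

    attemptCmd roundBody roundCmd mainCmd : Cmd #V
    attemptCmd = sampleCmd k s ⨾ walkCmd k s ⨾ checkCmd
    roundBody  = attemptCmd ⨾ E ≔ cons NIL E ⨾ EC ≔ tl EC
    roundCmd   = (E ≔ nil ⨾ EC ≔ var EL) ⨾ while EC roundBody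
    mainCmd    = while RC (RC ≔ tl RC ⨾ roundCmd)

    attemptTime roundTime mainTime : (n T e f : ℕ) → ℕ
    attemptTime n T e f = suc (sampleAllTime k s n e + suc (walkTime k s (walkBodyTime k s f n) T + checkTime (findTime (falsifiedTime k n) f) n))
    roundTime   n T c f = suc (3 + loopTime (suc (attemptTime n T c f + 3)) c)
    mainTime    n T c f = suc (1 + roundTime n T c f)

    sampleAllTime-mono : ∀ n {e e′} → e ≤ e′ → sampleAllTime k s n e ≤ sampleAllTime k s n e′
    sampleAllTime-mono n e≤ = s≤s (+-monoʳ-≤ 3 (s≤s (+-monoˡ-≤ (loopTime 7 n) (loopTime-mono {m = n}
      (s≤s (+-monoʳ-≤ 7 (s≤s (+-monoˡ-≤ (suc (3 + suc (2 + 5))) (loopTime-mono {suc (1 + chunkTime k s s)} ≤-refl e≤))))) ≤-refl))))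

    attemptTime-mono : ∀ n T f {e e′} → e ≤ e′ → attemptTime n T e f ≤ attemptTime n T e′ f
    attemptTime-mono n T f e≤ = s≤s (+-monoˡ-≤ _ (sampleAllTime-mono n e≤))

    module _ (G : CNF n) (|G| : Is k -CNF G) (z : Assignment n) (T : ℕ) where

      machine : Tree → Tree → Tree → Tree → Tree → Tree → Tree → Best n → Store #V
      machine tape y e ec eb rc np best = best · λ b₀ bd →
        b₀ ∷ nil⁹∷ nil ∷ y ∷
        tape ∷ encodeCNF G ∷ encodeAssignment z ∷ e ∷ nil ∷ ⌜ T ⌝ⁿ ∷ bd ∷ ec ∷ eb ∷ rc ∷ np ∷ []

      exec-attempt : ∀ e (x : El (attemptCode s n T e)) w best → proj₂ best ≤ suc n → ∀ {y ec eb rc np} →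
        Exec attemptCmd
          (machine (encodeBits (writeBits (attemptCode s n T e) x w)) y ⌜ e ⌝ⁿ ec eb rc np best)
          (attemptTime n T e (length G))
          (machine (encodeBits w) nil ⌜ e ⌝ⁿ ec eb rc np (attempt k s G z T e x best))
      exec-attempt e (us , vs) w best m≤ =
          exec-sample k s z us (writeBits (dieCode s ^^ T) vs w)
        ▸ exec-walk k s vs (sampleAll z us) G |G| w
        ▸ exec-check k G z (walk k G vs (sampleAll z us)) best |G| m≤

      round≤ : ∀ e c x best → proj₂ best ≤ suc n → proj₂ (round k s G z T e c x best) ≤ suc n
      round≤ e zero    x       best m≤ = m≤
      round≤ e (suc c) (x , r) best m≤ = round≤ (suc e) c r _ (check≤ G z (candidate k s G z T e x) best m≤)

      -- Every attempt is charged the time for `bound` dice per variable. The last value of `E` is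
      -- left existential, since the next round resets it.
      exec-roundLoop : ∀ bound e c → e + c ≤ bound → ∀ x w best → proj₂ best ≤ suc n → ∀ {y eb rc np} → y ≡ nil →
        ∃[ e′ ] Exec (while EC roundBody)
          (machine (encodeBits (writeBits (roundCode s n T e c) x w)) y ⌜ e ⌝ⁿ ⌜ c ⌝ⁿ eb rc np best)
          (loopTime (suc (attemptTime n T bound (length G) + 3)) c)
          (machine (encodeBits w) nil e′ nil eb rc np (round k s G z T e c x best))
      exec-roundLoop bound e zero    le x w best m≤ refl = _ , while-nil refl
      exec-roundLoop bound e (suc c) le (x , r) w best m≤ refl =
        let e′ , loop = exec-roundLoop bound (suc e) c (≤-trans (≤-reflexive (sym (+-suc e c))) le) r w
                          (attempt k s G z T e x best) (check≤ G z (candidate k s G z T e x) best m≤) refl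
        in e′ , while-node refl
          ( weaken (attemptTime-mono n T (length G) (≤-trans (m≤m+n e (suc c)) le)) (exec-attempt e x (writeBits (roundCode s n T (suc e) c) r w) best m≤)
          ▸ straight 3 (λ _ _ → refl))
          loop

      exec-round : ∀ c x w best → proj₂ best ≤ suc n → ∀ {e rc np} →
        ∃[ e′ ] Exec roundCmd
          (machine (encodeBits (writeBits (roundCode s n T 0 c) x w)) nil e nil ⌜ c ⌝ⁿ rc np best)
          (roundTime n T c (length G))
          (machine (encodeBits w) nil e′ nil ⌜ c ⌝ⁿ rc np (round k s G z T 0 c x best))
      exec-round c x w best m≤ =
        let e′ , loop = exec-roundLoop c 0 c ≤-refl x w best m≤ refl
        in e′ , (straight 3 (λ _ _ → refl) ▸ loop)

      exec-main : ∀ c {R} (xs : El (roundCode s n T 0 c ^^ R)) w best → proj₂ best ≤ suc n → ∀ {e np} →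
        ∃[ e′ ] Exec mainCmd
          (machine (encodeBits (writeBits (roundCode s n T 0 c ^^ R) xs w)) nil e nil ⌜ c ⌝ⁿ ⌜ R ⌝ⁿ np best)
          (loopTime (mainTime n T c (length G)) R)
          (machine (encodeBits w) nil e′ nil ⌜ c ⌝ⁿ nil np (rounds k s G z T 0 c xs best))
      exec-main c []       w best m≤ = _ , while-nil refl
      exec-main c {suc R} (x ∷ xs) w best m≤ =
        let e₁ , once = exec-round c x (writeBits (roundCode s n T 0 c ^^ R) xs w) best m≤
            e₂ , loop = exec-main c xs w (round k s G z T 0 c x best) (round≤ 0 c x best m≤)
        in e₂ , while-node refl (straight 1 (λ _ _ → refl) ▸ once) loop

-- Arithmetic with unary numbers

module Counters where
  open Execution
  open Algorithm
  open Programs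

  private variable
    n : ℕ
    b₀ : Tree

  -- groups f b x = ⌈x/b⌉ if x ≤ f and b > 0
  groups : ℕ → ℕ → ℕ → ℕ
  groups f       b zero    = 0
  groups zero    b (suc x) = 0
  groups (suc f) b (suc x) = suc (groups f b (suc x ∸ b))

  -- `⌈x / b⌉ * a`, an approximation of `x a / b` from above that takes away `b` and adds `a` in
  -- turn. For `b = 1` it is multiplication by a constant.
  scale : ℕ → ℕ → ℕ → ℕ
  scale a b x = groups x b x * a

  scaleⁿ : ℕ → ℕ → ℕ → ℕ → ℕ
  scaleⁿ a b zero    x = x
  scaleⁿ a b (suc m) x = scaleⁿ a b m (scale a b x)

  opaque
    groups-lower : ∀ f b x → x ≤ f → x ≤ groups f (suc b) x * suc b
    groups-lower f       b zero    x≤f       = z≤n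
    groups-lower (suc f) b (suc x) (s≤s x≤f) = s≤s (≤-trans (m≤n+m∸n x b)
      (+-monoʳ-≤ b (groups-lower f b (x ∸ b) (≤-trans (m∸n≤m x b) x≤f))))

    groups-upper : ∀ f b x → groups f (suc b) x * suc b ≤ x + b
    groups-upper f       b zero    = z≤n
    groups-upper zero    b (suc x) = z≤n
    groups-upper (suc f) b (suc x) with ≤-total b x
    ... | inj₁ b≤x = s≤s (≤-trans (+-monoʳ-≤ b (groups-upper f b (x ∸ b)))
            (≤-reflexive (trans (sym (+-assoc b (x ∸ b) b)) (cong (_+ b) (m+[n∸m]≡n b≤x)))))
    ... | inj₂ x≤b rewrite m≤n⇒m∸n≡0 x≤b = s≤s (≤-trans (≤-reflexive (trans (cong (b +_) (cong (_* suc b) (groups-0 f))) (+-identityʳ b))) (m≤n+m b x))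
      where
      groups-0 : ∀ f → groups f (suc b) 0 ≡ 0
      groups-0 zero    = refl
      groups-0 (suc f) = refl

    scale-lower : ∀ a b x → x * a ≤ scale a (suc b) x * suc b
    scale-lower a b x = ≤-trans (*-monoˡ-≤ a (groups-lower x b x ≤-refl)) (≤-reflexive (swap (groups x (suc b) x) (suc b) a))
      where
      swap : ∀ u v w → u * v * w ≡ u * w * v
      swap u v w = trans (*-assoc u v w) (trans (cong (u *_) (*-comm v w)) (sym (*-assoc u w v)))

    scale-upper : ∀ a b x → scale a (suc b) x * suc b ≤ (x + b) * a
    scale-upper a b x = ≤-trans (≤-reflexive (swap (groups x (suc b) x) a (suc b))) (*-monoˡ-≤ a (groups-upper x b x))
      where
      swap : ∀ u v w → u * v * w ≡ u * w * v
      swap u v w = trans (*-assoc u v w) (trans (cong (u *_) (*-comm v w)) (sym (*-assoc u w v)))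

    scale-inflationary : ∀ a b x → suc b ≤ a → x ≤ scale a (suc b) x
    scale-inflationary a b x b≤a = ≤-trans (groups-lower x b x ≤-refl) (*-monoʳ-≤ (groups x (suc b) x) b≤a)

    scaleⁿ-inflationary : ∀ a b m x → suc b ≤ a → x ≤ scaleⁿ a (suc b) m x
    scaleⁿ-inflationary a b zero    x b≤a = ≤-refl
    scaleⁿ-inflationary a b (suc m) x b≤a = ≤-trans (scale-inflationary a b x b≤a) (scaleⁿ-inflationary a b m _ b≤a)

  popCmd pushCmd : ℕ → Cmd #V
  popCmd zero     = skip
  popCmd (suc b)  = I ≔ tl I ⨾ popCmd b
  pushCmd zero    = skip
  pushCmd (suc a) = A ≔ cons NIL A ⨾ pushCmd a

  scaleLoop scaleCmd : ℕ → ℕ → Cmd #V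
  scaleLoop a b = while I (popCmd b ⨾ pushCmd a)
  scaleCmd  a b = A ≔ nil ⨾ scaleLoop a b ⨾ I ≔ var A ⨾ A ≔ nil

  scaleTime : ℕ → ℕ → ℕ → ℕ
  scaleTime a b x = suc (1 + suc (loopTime (suc (suc (b * 2) + suc (a * 2))) x + 3))

  exec-pop : ∀ b x {a} {ρ : Vec Tree 19} →
    Exec (popCmd b) (b₀ ∷ nil ∷ ⌜ x ⌝ⁿ ∷ a ∷ ρ) (suc (b * 2)) (b₀ ∷ nil ∷ ⌜ x ∸ b ⌝ⁿ ∷ a ∷ ρ)
  exec-pop zero    x       = straight 1 (λ _ _ → refl)
  exec-pop {b₀ = b₀} (suc b) zero {a} {ρ} = straight 1 (λ _ _ → refl) ▸
    retarget (cong (λ x → b₀ ∷ nil ∷ ⌜ x ⌝ⁿ ∷ a ∷ ρ) (0∸n≡0 b)) (exec-pop b zero)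
  exec-pop (suc b) (suc x) = straight 1 (λ _ _ → refl) ▸ exec-pop b x

  exec-push : ∀ a x {i} {ρ : Vec Tree 19} →
    Exec (pushCmd a) (b₀ ∷ nil ∷ i ∷ ⌜ x ⌝ⁿ ∷ ρ) (suc (a * 2)) (b₀ ∷ nil ∷ i ∷ ⌜ a + x ⌝ⁿ ∷ ρ)
  exec-push zero    x = straight 1 (λ _ _ → refl)
  exec-push {b₀ = b₀} (suc a) x {i} {ρ} = straight 1 (λ _ _ → refl) ▸
    retarget (cong (λ x → b₀ ∷ nil ∷ i ∷ ⌜ x ⌝ⁿ ∷ ρ) (+-suc a x)) (exec-push a (suc x))

  exec-scaleLoop : ∀ a b f x acc → x ≤ f → ∀ {ρ : Vec Tree 19} →
    Exec (scaleLoop a (suc b)) (b₀ ∷ nil ∷ ⌜ x ⌝ⁿ ∷ ⌜ acc ⌝ⁿ ∷ ρ)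
      (loopTime (suc (suc (suc b * 2) + suc (a * 2))) f)
      (b₀ ∷ nil ∷ nil ∷ ⌜ groups f (suc b) x * a + acc ⌝ⁿ ∷ ρ)
  exec-scaleLoop a b f       zero    acc x≤f = weaken (loopTime-mono {m = 0} ≤-refl z≤n) (while-nil refl)
  exec-scaleLoop {b₀ = b₀} a b (suc f) (suc x) acc (s≤s x≤f) {ρ} = while-node refl
    (exec-pop (suc b) (suc x) ▸ exec-push a acc)
    (retarget (cong (λ y → b₀ ∷ nil ∷ nil ∷ ⌜ y ⌝ⁿ ∷ ρ) eq) (exec-scaleLoop a b f (x ∸ b) (a + acc) (≤-trans (m∸n≤m x b) x≤f)))
    where
    g = groups f (suc b) (x ∸ b)
    eq : g * a + (a + acc) ≡ a + g * a + acc
    eq = trans (sym (+-assoc (g * a) a acc)) (cong (_+ acc) (+-comm (g * a) a))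

  exec-scale : ∀ a b x {t} {ρ : Vec Tree 19} →
    Exec (scaleCmd a (suc b)) (b₀ ∷ nil ∷ ⌜ x ⌝ⁿ ∷ t ∷ ρ) (scaleTime a (suc b) x) (b₀ ∷ nil ∷ ⌜ scale a (suc b) x ⌝ⁿ ∷ nil ∷ ρ)
  exec-scale {b₀ = b₀} a b x {ρ = ρ} =
      straight 1 (λ _ _ → refl)
    ▸ retarget (cong (λ y → b₀ ∷ nil ∷ nil ∷ ⌜ y ⌝ⁿ ∷ ρ) (+-identityʳ (scale a (suc b) x))) (exec-scaleLoop a b x x 0 ≤-refl)
    ▸ straight 3 (λ _ _ → refl)

  counters : (i a l c tb eb rc np z f : Tree) → Store #V
  counters i a l c tb eb rc np z f =
    z ∷ nil ∷ i ∷ a ∷ nil ∷ nil ∷ nil ∷ l ∷ c ∷ nil ∷ nil ∷ nil ∷ nil ∷ f ∷ z ∷ nil ∷ nil ∷ tb ∷ nil ∷ nil ∷ eb ∷ rc ∷ np ∷ []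

  private variable
    i a l c tb eb rc np z f : Tree

  timesInner timesCmd : Cmd #V
  timesInner = while L (L ≔ tl L ⨾ A ≔ cons NIL A)
  timesCmd   = while I ((I ≔ tl I ⨾ L ≔ var NP) ⨾ timesInner) ⨾ I ≔ var A ⨾ A ≔ nil

  timesTime : ℕ → ℕ → ℕ
  timesTime p x = suc (loopTime (suc (3 + loopTime 3 p)) x + 3)

  exec-timesInner : ∀ p acc → Exec timesInner (counters i ⌜ acc ⌝ⁿ ⌜ p ⌝ⁿ c tb eb rc np z f) (loopTime 3 p)
                                              (counters i ⌜ p + acc ⌝ⁿ nil c tb eb rc np z f)
  exec-timesInner zero    acc = while-nil refl
  exec-timesInner {i = i} {c = c} {tb} {eb} {rc} {np} {z} {f} (suc p) acc = while-node refl (straight 3 (λ _ _ → refl))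
    (retarget (cong (λ y → counters i ⌜ y ⌝ⁿ nil c tb eb rc np z f) (+-suc p acc)) (exec-timesInner p (suc acc)))

  exec-timesOuter : ∀ p x acc →
    Exec (while I ((I ≔ tl I ⨾ L ≔ var NP) ⨾ timesInner)) (counters ⌜ x ⌝ⁿ ⌜ acc ⌝ⁿ nil c tb eb rc ⌜ p ⌝ⁿ z f)
      (loopTime (suc (3 + loopTime 3 p)) x) (counters nil ⌜ x * p + acc ⌝ⁿ nil c tb eb rc ⌜ p ⌝ⁿ z f)
  exec-timesOuter p zero    acc = while-nil refl
  exec-timesOuter {c = c} {tb} {eb} {rc} {z} {f} p (suc x) acc = while-node refl (straight 3 (λ _ _ → refl) ▸ exec-timesInner p acc)
    (retarget (cong (λ y → counters nil ⌜ y ⌝ⁿ nil c tb eb rc ⌜ p ⌝ⁿ z f)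
      (trans (sym (+-assoc (x * p) p acc)) (cong (_+ acc) (+-comm (x * p) p)))) (exec-timesOuter p x (p + acc)))

  exec-times : ∀ p x → Exec timesCmd (counters ⌜ x ⌝ⁿ nil nil c tb eb rc ⌜ p ⌝ⁿ z f) (timesTime p x)
                                     (counters ⌜ x * p ⌝ⁿ nil nil c tb eb rc ⌜ p ⌝ⁿ z f)
  exec-times {c = c} {tb} {eb} {rc} {z} {f} p x =
      retarget (cong (λ y → counters nil ⌜ y ⌝ⁿ nil c tb eb rc ⌜ p ⌝ⁿ z f) (+-identityʳ (x * p))) (exec-timesOuter p x 0)
    ▸ straight 3 (λ _ _ → refl)

  lengthLoop : Cmd #V
  lengthLoop = while L (L ≔ tl L ⨾ I ≔ cons NIL I)

  exec-length : ∀ (zs : Vec Bool n) m →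
    Exec lengthLoop (counters ⌜ m ⌝ⁿ a (encodeAssignment zs) c tb eb rc np z f) (loopTime 3 n)
                    (counters ⌜ n + m ⌝ⁿ a nil c tb eb rc np z f)
  exec-length []       m = while-nil refl
  exec-length {n = suc n} {a} {c} {tb} {eb} {rc} {np} {z} {f} (b ∷ zs) m = while-node refl (straight 3 (λ _ _ → refl))
    (retarget (cong (λ y → counters ⌜ y ⌝ⁿ a nil c tb eb rc np z f) (+-suc n m)) (exec-length zs (suc m)))

  -- The list of bits of `z₀` in `C` serves as a unary numeral for `n`.
  scaleⁿLoop : ℕ → ℕ → Cmd #V
  scaleⁿLoop a b = while C (C ≔ tl C ⨾ scaleCmd a b)

  exec-scaleⁿ : ∀ a b → suc b ≤ a → ∀ (zs : Vec Bool n) x {X} → scaleⁿ a (suc b) n x ≤ X →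
    Exec (scaleⁿLoop a (suc b)) (counters ⌜ x ⌝ⁿ nil l (encodeAssignment zs) tb eb rc np z f)
      (loopTime (suc (1 + scaleTime a (suc b) X)) n)
      (counters ⌜ scaleⁿ a (suc b) n x ⌝ⁿ nil l nil tb eb rc np z f)
  exec-scaleⁿ a b b<a []       x le = while-nil refl
  exec-scaleⁿ {n = suc n} a b b<a (_ ∷ zs) x {X} le = while-node refl
    ( straight 1 (λ _ _ → refl)
    ▸ weaken (s≤s (s≤s (s≤s (+-monoˡ-≤ 3 (loopTime-mono {suc (suc (suc b * 2) + suc (a * 2))} ≤-refl x≤X))))) (exec-scale a b x))
    (exec-scaleⁿ a b b<a zs (scale a (suc b) x) le)
    where
    x≤X : x ≤ X
    x≤X = ≤-trans (scaleⁿ-inflationary a b (suc n) x b<a) le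

  -- M is the number of outcomes of a die, and a/(b+1) the growth rate of the number of attempts.
  module _ (k M a b K : ℕ) where

    -- `8 (n+1)` steps are enough for every tolerated loss of distance, and `M (n+1)` exponents
    -- reach every useful ν. `growth` is at least `k (a/(b+1)) ^ n`, the reciprocal of the success
    -- probability of a well-chosen attempt, and the factor `n + 1` in `roundsOf` is for
    -- amplification.
    stepsOf attemptsOf roundsOf bitsOf growth : ℕ → ℕ
    stepsOf    n = scale 8 1 (suc n)
    attemptsOf n = scale M 1 (suc n)
    growth     n = scaleⁿ a (suc b) n k
    roundsOf   n = growth n * suc n
    bitsOf     n = scale K 1 (roundsOf n) * suc n * suc n * suc n

    preludeCmd : Cmd #V
    preludeCmd =
      (F ≔ hd BEST ⨾ Z ≔ tl BEST ⨾ BEST ≔ var Z ⨾ L ≔ var Z ⨾ I ≔ cons NIL NIL) ⨾ lengthLoop ⨾ NP ≔ var I ⨾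
      scaleCmd 8 1 ⨾ (TL ≔ var I ⨾ I ≔ var NP) ⨾ scaleCmd M 1 ⨾ (EL ≔ var I ⨾ I ≔ nil) ⨾
      pushCmd k ⨾ (I ≔ var A ⨾ A ≔ nil ⨾ C ≔ var Z) ⨾ scaleⁿLoop a (suc b) ⨾ timesCmd ⨾ RC ≔ var I ⨾
      scaleCmd K 1 ⨾ timesCmd ⨾ timesCmd ⨾ timesCmd

    preludeTime : ℕ → ℕ
    preludeTime n =
      suc (9 + suc (loopTime 3 n + suc (1 +
      suc (scaleTime 8 1 (suc n) + suc (3 + suc (scaleTime M 1 (suc n) + suc (3 +
      suc (suc (k * 2) + suc (5 + suc (loopTime (suc (1 + scaleTime a (suc b) (growth n))) n + suc (timesTime (suc n) (growth n) + suc (1 +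
      suc (scaleTime K 1 (roundsOf n) + suc (timesTime (suc n) (scale K 1 (roundsOf n)) + suc (timesTime (suc n) (scale K 1 (roundsOf n) * suc n) +
      timesTime (suc n) (scale K 1 (roundsOf n) * suc n * suc n))))))))))))))))

    exec-prelude : suc b ≤ a → ∀ (G : CNF n) (z : Assignment n) →
      Exec preludeCmd (encodeInput G z ∷ Vec.replicate 22 nil) (preludeTime n)
        (counters ⌜ bitsOf n ⌝ⁿ nil nil nil ⌜ stepsOf n ⌝ⁿ ⌜ attemptsOf n ⌝ⁿ ⌜ roundsOf n ⌝ⁿ ⌜ suc n ⌝ⁿ (encodeAssignment z) (encodeCNF G))
    exec-prelude {n} b<a G z =
        straight 9 (λ _ _ → refl)
      ▸ retarget (cong (λ y → counters ⌜ y ⌝ⁿ nil nil nil nil nil nil nil (encodeAssignment z) (encodeCNF G)) (+-comm n 1)) (exec-length z 1)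
      ▸ straight 1 (λ _ _ → refl)
      ▸ exec-scale 8 0 (suc n)
      ▸ straight 3 (λ _ _ → refl)
      ▸ exec-scale M 0 (suc n)
      ▸ straight 3 (λ _ _ → refl)
      ▸ retarget (cong (λ y → counters nil ⌜ y ⌝ⁿ nil nil ⌜ stepsOf n ⌝ⁿ ⌜ attemptsOf n ⌝ⁿ nil ⌜ suc n ⌝ⁿ (encodeAssignment z) (encodeCNF G)) (+-identityʳ k)) (exec-push k 0)
      ▸ straight 5 (λ _ _ → refl)
      ▸ exec-scaleⁿ a b b<a z k ≤-refl
      ▸ exec-times (suc n) (growth n)
      ▸ straight 1 (λ _ _ → refl)
      ▸ exec-scale K 0 (roundsOf n)
      ▸ exec-times (suc n) (scale K 1 (roundsOf n))
      ▸ exec-times (suc n) (scale K 1 (roundsOf n) * suc n)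
      ▸ exec-times (suc n) (scale K 1 (roundsOf n) * suc n * suc n)

-- Sums over random choices, tapes and coin sequences

module Counting where
  open Execution
  open Algorithm
  open import Data.List.Properties using (filter-++; length-++)
  open import Data.Unit.Base using (tt)
  open import Level using (Level)
  open import Relation.Unary using (Pred; Decidable)

  private variable
    v : ℕ
    ℓ : Level

  sum : ∀ c → (El c → ℕ) → ℕ
  sum unit         f = f tt
  sum bit          f = f false + f true
  sum (c ⊗ d)      f = sum c λ x → sum d λ y → f (x , y)
  sum (c ^^ zero)  f = f []
  sum (c ^^ suc m) f = sum c λ x → sum (c ^^ m) λ xs → f (x ∷ xs)

  opaque
    sum-mono : ∀ c {f g : El c → ℕ} → (∀ x → f x ≤ g x) → sum c f ≤ sum c g
    sum-mono unit         f≤g = f≤g tt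
    sum-mono bit          f≤g = +-mono-≤ (f≤g false) (f≤g true)
    sum-mono (c ⊗ d)      f≤g = sum-mono c λ x → sum-mono d λ y → f≤g (x , y)
    sum-mono (c ^^ zero)  f≤g = f≤g []
    sum-mono (c ^^ suc m) f≤g = sum-mono c λ x → sum-mono (c ^^ m) λ xs → f≤g (x ∷ xs)

  opaque
    sum-cong : ∀ c {f g : El c → ℕ} → (∀ x → f x ≡ g x) → sum c f ≡ sum c g
    sum-cong c f≡g = ≤-antisym (sum-mono c (≤-reflexive ∘ f≡g)) (sum-mono c (≤-reflexive ∘ sym ∘ f≡g))

  opaque
    sum-+ : ∀ c (f g : El c → ℕ) → sum c (λ x → f x + g x) ≡ sum c f + sum c g
    sum-+ unit         f g = refl
    sum-+ bit          f g = lem (f false) (g false) (f true) (g true)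
      where
      lem : ∀ a b c d → (a + b) + (c + d) ≡ (a + c) + (b + d)
      lem = solve-∀
    sum-+ (c ⊗ d)      f g = trans (sum-cong c λ x → sum-+ d (λ y → f (x , y)) (λ y → g (x , y))) (sum-+ c _ _)
    sum-+ (c ^^ zero)  f g = refl
    sum-+ (c ^^ suc m) f g = trans (sum-cong c λ x → sum-+ (c ^^ m) (λ xs → f (x ∷ xs)) (λ xs → g (x ∷ xs))) (sum-+ c _ _)

  opaque
    sum-* : ∀ c a (f : El c → ℕ) → sum c (λ x → a * f x) ≡ a * sum c f
    sum-* unit         a f = refl
    sum-* bit          a f = sym (*-distribˡ-+ a (f false) (f true))
    sum-* (c ⊗ d)      a f = trans (sum-cong c λ x → sum-* d a (λ y → f (x , y))) (sum-* c a _)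
    sum-* (c ^^ zero)  a f = refl
    sum-* (c ^^ suc m) a f = trans (sum-cong c λ x → sum-* (c ^^ m) a (λ xs → f (x ∷ xs))) (sum-* c a _)

  opaque
    sum-*ʳ : ∀ c a (f : El c → ℕ) → sum c (λ x → f x * a) ≡ sum c f * a
    sum-*ʳ c a f = trans (sum-cong c λ x → *-comm (f x) a) (trans (sum-* c a f) (*-comm a _))

  total : Code → ℕ
  total c = 2 ^ size c

  opaque
    sum-const : ∀ c a → sum c (λ _ → a) ≡ total c * a
    sum-const unit         a = sym (+-identityʳ a)
    sum-const bit          a = cong (a +_) (sym (+-identityʳ a))
    sum-const (c ⊗ d)      a = trans (sum-cong c λ _ → sum-const d a) (trans (sum-const c (total d * a))
      (trans (sym (*-assoc (total c) (total d) a)) (cong (_* a) (sym (^-distribˡ-+-* 2 (size c) (size d))))))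
    sum-const (c ^^ zero)  a = sym (+-identityʳ a)
    sum-const (c ^^ suc m) a = trans (sum-cong c λ _ → sum-const (c ^^ m) a) (trans (sum-const c (total (c ^^ m) * a))
      (trans (sym (*-assoc (total c) (total (c ^^ m)) a)) (cong (_* a) (sym (^-distribˡ-+-* 2 (size c) (m * size c))))))

  opaque
    sum-swap : ∀ c d (f : El c → El d → ℕ) → sum c (λ x → sum d (f x)) ≡ sum d (λ y → sum c (λ x → f x y))
    sum-swap unit         d f = refl
    sum-swap bit          d f = sym (sum-+ d (f false) (f true))
    sum-swap (c ⊗ c′)     d f = trans (sum-cong c λ x → sum-swap c′ d (λ x′ → f (x , x′))) (sum-swap c d _)
    sum-swap (c ^^ zero)  d f = refl
    sum-swap (c ^^ suc m) d f = trans (sum-cong c λ x → sum-swap (c ^^ m) d (λ xs → f (x ∷ xs))) (sum-swap c d _)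

  -- The bits drawn last are in front.
  sumTape : ℕ → (List Bool → ℕ) → List Bool → ℕ
  sumTape zero    φ w = φ w
  sumTape (suc m) φ w = sumTape m φ (false ∷ w) + sumTape m φ (true ∷ w)

  sumTape-+ : ∀ a b φ w → sumTape (a + b) φ w ≡ sumTape a (sumTape b φ) w
  sumTape-+ zero    b φ w = refl
  sumTape-+ (suc a) b φ w = cong₂ _+_ (sumTape-+ a b φ (false ∷ w)) (sumTape-+ a b φ (true ∷ w))

  sumTape-cong : ∀ a {φ ψ} → (∀ w → φ w ≡ ψ w) → ∀ w → sumTape a φ w ≡ sumTape a ψ w
  sumTape-cong zero    eq w = eq w
  sumTape-cong (suc a) eq w = cong₂ _+_ (sumTape-cong a eq (false ∷ w)) (sumTape-cong a eq (true ∷ w))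

  sumTape-const : ∀ m a w → sumTape m (λ _ → a) w ≡ 2 ^ m * a
  sumTape-const zero    a w = sym (+-identityʳ a)
  sumTape-const (suc m) a w = trans (cong₂ _+_ (sumTape-const m a (false ∷ w)) (sumTape-const m a (true ∷ w))) (lem (2 ^ m) a)
    where
    lem : ∀ p a → p * a + p * a ≡ 2 * p * a
    lem = solve-∀

  opaque
    -- The tape is a stack: the first component of a pair is read from the bits that were drawn
    -- last. Hence every product exchanges the order of summation.
    sumTape-code : ∀ c φ w → sumTape (size c) φ w ≡ sum c (λ x → φ (writeBits c x w))
    sumTape-code unit         φ w = refl
    sumTape-code bit          φ w = refl
    sumTape-code (c ⊗ d)      φ w =
      trans (cong (λ m → sumTape m φ w) (+-comm (size c) (size d)))
      (trans (sumTape-+ (size d) (size c) φ w)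
      (trans (sumTape-cong (size d) (sumTape-code c φ) w)
      (trans (sumTape-code d _ w) (sum-swap d c _))))
    sumTape-code (c ^^ zero)  φ w = refl
    sumTape-code (c ^^ suc m) φ w =
      trans (cong (λ m → sumTape m φ w) (+-comm (size c) (m * size c)))
      (trans (sumTape-+ (m * size c) (size c) φ w)
      (trans (sumTape-cong (m * size c) (sumTape-code c φ) w)
      (trans (sumTape-code (c ^^ m) _ w) (sum-swap (c ^^ m) c _))))

  module _ (ψ : Config v → ℕ) where

    opaque
      count : ℕ → Config v → ℕ
      count zero    κ = ψ κ
      count (suc t) κ = count t (step false κ) + count t (step true κ)

      count-zero : ∀ κ → count 0 κ ≡ ψ κ
      count-zero κ = refl

      count-suc : ∀ t κ → count (suc t) κ ≡ count t (step false κ) + count t (step true κ)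
      count-suc t κ = refl

    consBit : Bool → (ℕ → Bool) → ℕ → Bool
    consBit b β zero    = b
    consBit b β (suc m) = β m

    double : ∀ p a → p * a + p * a ≡ 2 * p * a
    double = solve-∀

    -- Each step consumes a bit, also where no coin is tossed; such bits contribute the factor
    -- `2 ^ s`.
    count-det : ∀ s t {κ κ′} → (∀ β → runS s β κ ≡ κ′) → count (s + t) κ ≡ 2 ^ s * count t κ′
    count-det zero    t eq = trans (cong (count t) (eq (λ _ → false))) (sym (+-identityʳ _))
    count-det (suc s) t {κ} {κ′} eq = trans (count-suc (s + t) κ) (trans
      (cong₂ _+_ (count-det s t λ β → eq (consBit false β)) (count-det s t λ β → eq (consBit true β)))
      (double (2 ^ s) (count t κ′)))

    count-halted : ∀ t σ → count t ([] , σ) ≡ 2 ^ t * ψ ([] , σ)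
    count-halted zero    σ = trans (count-zero ([] , σ)) (sym (+-identityʳ _))
    count-halted (suc t) σ = trans (count-suc t ([] , σ)) (trans (cong₂ _+_ (count-halted t σ) (count-halted t σ)) (double (2 ^ t) (ψ ([] , σ))))

    count-↠ : ∀ {b t κ σ} → κ ↠[ b ] ([] , σ) → b ≤ t → count t κ ≡ 2 ^ t * ψ ([] , σ)
    count-↠ {b} {t} {κ} {σ} (s , s≤b , eq) b≤t with m≤n⇒∃[o]m+o≡n (≤-trans s≤b b≤t)
    ... | r , refl = trans (count-det s r eq) (trans (cong (2 ^ s *_) (count-halted r σ))
      (trans (sym (*-assoc (2 ^ s) (2 ^ r) _)) (cong (_* ψ ([] , σ)) (sym (^-distribˡ-+-* 2 s r)))))

    module _ (ψ≤1 : ∀ κ → ψ κ ≤ 1) where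

      opaque
        unfolding count

        count≤ : ∀ t κ → count t κ ≤ 2 ^ t
        count≤ zero    κ = ψ≤1 κ
        count≤ (suc t) κ = +-mono-≤ (count≤ t _) (≤-trans (count≤ t _) (≤-reflexive (sym (+-identityʳ _))))

        -- Values of at most 1 whose sum over all coin sequences is `2 ^ t` cannot vanish anywhere.
        -- This turns a count into a statement about every `ω`, as halting requires.
        count-full : ∀ {t κ} → 2 ^ t ≤ count t κ → (ω : Vec Bool t) → 1 ≤ ψ (run ω κ)
        count-full {zero}  {κ} full []      = full
        count-full {suc t} {κ} full (false ∷ ω) = count-full {t} (+-cancelʳ-≤ (2 ^ t) _ _
          (≤-trans (≤-reflexive (cong (2 ^ t +_) (sym (+-identityʳ (2 ^ t))))) (≤-trans full (+-monoʳ-≤ (count t (step false κ)) (count≤ t (step true κ)))))) ω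
        count-full {suc t} {κ} full (true ∷ ω) = count-full {t} (+-cancelˡ-≤ (2 ^ t) _ _
          (≤-trans (≤-reflexive (cong (2 ^ t +_) (sym (+-identityʳ (2 ^ t))))) (≤-trans full (+-monoˡ-≤ (count t (step true κ)) (count≤ t (step false κ)))))) ω

  indicator : ∀ {A : Set ℓ} → Dec A → ℕ
  indicator (yes _) = 1
  indicator (no  _) = 0

  length-filter-map : ∀ {a b} {A : Set a} {B : Set b} {P : Pred B ℓ} (P? : Decidable P) (f : A → B) xs →
                      length (filter P? (List.map f xs)) ≡ length (filter (λ x → P? (f x)) xs)
  length-filter-map P? f []       = refl
  length-filter-map P? f (x ∷ xs) with P? (f x)
  ... | yes _ = cong suc (length-filter-map P? f xs)
  ... | no  _ = length-filter-map P? f xs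

  opaque
    unfolding count

    -- Links the lists of bit strings in `Pr` with a recursion that follows the run.
    filter-count : ∀ t (κ : Config v) {Q : Pred (Config v) ℓ} (Q? : Decidable Q) →
      length (filter (λ ω → Q? (run ω κ)) (bitStrings t)) ≡ count (λ κ → indicator (Q? κ)) t κ
    filter-count zero    κ Q? with Q? κ
    ... | yes _ = refl
    ... | no  _ = refl
    filter-count (suc t) κ {Q} Q? =
      trans (cong length (filter-++ P? (List.map (false ∷_) (bitStrings t)) (List.map (true ∷_) (bitStrings t))))
      (trans (length-++ (filter P? (List.map (false ∷_) (bitStrings t))))
      (cong₂ _+_ (trans (length-filter-map P? (false ∷_) (bitStrings t)) (filter-count t (step false κ) Q?))
                 (trans (length-filter-map P? (true ∷_) (bitStrings t)) (filter-count t (step true κ) Q?))))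
      where
      P? : Decidable {A = Vec Bool (suc t)} (λ ω → Q (run ω κ))
      P? = λ ω → Q? (run ω κ)

-- Tossing all coins in advance

module Tapes where
  open Execution
  open Algorithm
  open Programs
  open Counters
  open Counting
  open import Relation.Binary.PropositionalEquality.Properties using (module ≡-Reasoning)
  open ≡-Reasoning

  drawCmd : Cmd #V
  drawCmd = while I (I ≔ tl I ⨾ B ≔ coin ⨾ TAPE ≔ cons B TAPE ⨾ B ≔ nil)

  -- An exact number and not just a bound, since the coin steps must occupy known positions of the
  -- run.
  drawSteps : ℕ → ℕ
  drawSteps zero    = 1
  drawSteps (suc m) = 4 + suc (3 + drawSteps m)

  drawing : (i tape tb eb rc np z f : Tree) → Store #V
  drawing i tape tb eb rc np z f =
    z ∷ nil ∷ i ∷ nil ∷ nil ∷ nil ∷ nil ∷ nil ∷ nil ∷ nil ∷ nil ∷ nil ∷ tape ∷ f ∷ z ∷ nil ∷ nil ∷ tb ∷ nil ∷ nil ∷ eb ∷ rc ∷ np ∷ []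

  module _ (ψ : Config #V → ℕ) where

    opaque
      count-coin : ∀ a b t {κ κ₁ κ₂ κ₃} → (∀ β → runS a β κ ≡ κ₁) →
        (∀ β → runS b β (step false κ₁) ≡ κ₂) → (∀ β → runS b β (step true κ₁) ≡ κ₃) →
        count ψ (a + suc (b + t)) κ ≡ 2 ^ (a + b) * (count ψ t κ₂ + count ψ t κ₃)
      count-coin a b t {κ} {κ₁} {κ₂} {κ₃} p q r =
        trans (count-det ψ a (suc (b + t)) p)
        (trans (cong (2 ^ a *_) (trans (count-suc ψ (b + t) κ₁) (trans (cong₂ _+_ (count-det ψ b t q) (count-det ψ b t r)) (sym (*-distribˡ-+ (2 ^ b) (count ψ t κ₂) (count ψ t κ₃))))))
        (trans (sym (*-assoc (2 ^ a) (2 ^ b) _)) (cong (_* (count ψ t κ₂ + count ψ t κ₃)) (sym (^-distribˡ-+-* 2 a b)))))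

    opaque
      count-draw-step : ∀ a b m d t x y {κ κ₁ κ₂ κ₃} → (∀ β → runS a β κ ≡ κ₁) →
        (∀ β → runS b β (step false κ₁) ≡ κ₂) → (∀ β → runS b β (step true κ₁) ≡ κ₃) →
        2 ^ m * count ψ (d + t) κ₂ ≡ 2 ^ d * x → 2 ^ m * count ψ (d + t) κ₃ ≡ 2 ^ d * y →
        2 ^ suc m * count ψ (a + suc (b + d) + t) κ ≡ 2 ^ (a + suc (b + d)) * (x + y)
      count-draw-step a b m d t x y {κ} {κ₁} {κ₂} {κ₃} p q r eq₂ eq₃ = begin
        2 * 2 ^ m * count ψ (a + suc (b + d) + t) κ
          ≡⟨ cong (λ u → 2 * 2 ^ m * count ψ u κ) (trans (+-assoc a (suc (b + d)) t) (cong (λ u → a + suc u) (+-assoc b d t))) ⟩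
        2 * 2 ^ m * count ψ (a + suc (b + (d + t))) κ
          ≡⟨ cong (2 * 2 ^ m *_) (count-coin a b (d + t) p q r) ⟩
        2 * 2 ^ m * (2 ^ (a + b) * (count ψ (d + t) κ₂ + count ψ (d + t) κ₃))
          ≡⟨ combine (2 ^ m) (2 ^ (a + b)) _ _ ⟩
        2 * 2 ^ (a + b) * (2 ^ m * count ψ (d + t) κ₂ + 2 ^ m * count ψ (d + t) κ₃)
          ≡⟨ cong₂ (λ u v → 2 * 2 ^ (a + b) * (u + v)) eq₂ eq₃ ⟩
        2 ^ suc (a + b) * (2 ^ d * x + 2 ^ d * y)
          ≡⟨ cong (2 ^ suc (a + b) *_) (sym (*-distribˡ-+ (2 ^ d) x y)) ⟩
        2 ^ suc (a + b) * (2 ^ d * (x + y))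
          ≡⟨ *-assoc (2 ^ suc (a + b)) (2 ^ d) (x + y) ⟨
        2 ^ suc (a + b) * 2 ^ d * (x + y)
          ≡⟨ cong (_* (x + y)) (^-distribˡ-+-* 2 (suc (a + b)) d) ⟨
        2 ^ (suc (a + b) + d) * (x + y)
          ≡⟨ cong (λ u → 2 ^ u * (x + y)) (trans (cong suc (+-assoc a b d)) (sym (+-suc a (b + d)))) ⟩
        2 ^ (a + suc (b + d)) * (x + y) ∎
        where
        combine : ∀ p q a b → 2 * p * (q * (a + b)) ≡ 2 * q * (p * a + p * b)
        combine = solve-∀

    opaque
      count-draw : ∀ m t w {K tb eb rc np z f} →
        2 ^ m * count ψ (drawSteps m + t) (drawCmd ∷ K , drawing ⌜ m ⌝ⁿ (encodeBits w) tb eb rc np z f) ≡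
        2 ^ drawSteps m * sumTape m (λ w → count ψ t (K , drawing nil (encodeBits w) tb eb rc np z f)) w
      count-draw zero    t w = trans (+-identityʳ _) (count-det ψ 1 t (λ _ → refl))
      count-draw (suc m) t w {K} {tb} {eb} {rc} {np} {z} {f} =
        count-draw-step 4 3 m (drawSteps m) t _ _ (λ _ → refl) (λ _ → refl) (λ _ → refl) (count-draw m t (false ∷ w)) (count-draw m t (true ∷ w))

    -- Every tape of the required length is drawn equally often.
    opaque
      count-program : ∀ {pre main : Cmd #V} {b₀ b₂ σ tb eb rc np z f} N r c {fin : El c → List Bool → Store #V} → N ≡ r + size c →
        Exec pre σ b₀ (drawing ⌜ N ⌝ⁿ nil tb eb rc np z f) →
        (∀ x w → Exec main (drawing nil (encodeBits (writeBits c x w)) tb eb rc np z f) b₂ (fin x w)) →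
        let t = suc (b₀ + suc (drawSteps N + b₂)) in
        2 ^ N * count ψ t ((pre ⨾ drawCmd ⨾ main) ∷ [] , σ) ≡
        2 ^ t * sumTape r (λ w → sum c λ x → ψ ([] , fin x w)) []
      count-program {pre} {main} {b₀} {b₂} {σ} {tb} {eb} {rc} {np} {z} {f} N r c {fin} N≡ prelude rest with reach prelude ((drawCmd ⨾ main) ∷ [])
      ... | s , s≤b₀ , eq with m≤n⇒∃[o]m+o≡n s≤b₀
      -- The `o` steps that the prelude leaves of its bound are passed on to the end of the run,
      -- where the machine has halted.
      ...   | o , refl = begin
        2 ^ N * count ψ (suc (s + o + suc (drawSteps N + b₂))) ((pre ⨾ drawCmd ⨾ main) ∷ [] , σ)
          ≡⟨ cong (λ u → 2 ^ N * count ψ (suc u) ((pre ⨾ drawCmd ⨾ main) ∷ [] , σ)) (shuffle s o (drawSteps N) b₂) ⟩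
        2 ^ N * count ψ (1 + (s + (1 + (drawSteps N + t′)))) ((pre ⨾ drawCmd ⨾ main) ∷ [] , σ)
          ≡⟨ cong (2 ^ N *_) (trans (count-det ψ 1 (s + (1 + (drawSteps N + t′))) (λ _ → refl)) (cong (2 *_) (trans (count-det ψ s (1 + (drawSteps N + t′)) eq) (cong (2 ^ s *_) (count-det ψ 1 (drawSteps N + t′) (λ _ → refl)))))) ⟩
        2 ^ N * (2 * (2 ^ s * (2 * X)))
          ≡⟨ lem₁ (2 ^ N) (2 ^ s) X ⟩
        2 * (2 ^ s * (2 * (2 ^ N * X)))
          ≡⟨ cong (λ u → 2 * (2 ^ s * (2 * u))) (count-draw N t′ []) ⟩
        2 * (2 ^ s * (2 * (2 ^ drawSteps N * sumTape N leaf [])))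
          ≡⟨ cong (λ u → 2 * (2 ^ s * (2 * (2 ^ drawSteps N * u)))) leaves ⟩
        2 * (2 ^ s * (2 * (2 ^ drawSteps N * (2 ^ t′ * Σψ))))
          ≡⟨ lem₂ (2 ^ s) (2 ^ drawSteps N) (2 ^ t′) Σψ ⟩
        2 * (2 ^ s * (2 * (2 ^ drawSteps N * 2 ^ t′))) * Σψ
          ≡⟨ cong (_* Σψ) (trans (cong (λ u → 2 * (2 ^ s * (2 * u))) (sym (^-distribˡ-+-* 2 (drawSteps N) t′)))
               (cong (2 *_) (sym (^-distribˡ-+-* 2 s (suc (drawSteps N + t′)))))) ⟩
        2 ^ suc (s + suc (drawSteps N + t′)) * Σψ
          ≡⟨ cong (λ u → 2 ^ suc u * Σψ) (shuffle s o (drawSteps N) b₂) ⟨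
        2 ^ suc (s + o + suc (drawSteps N + b₂)) * Σψ ∎
        where
        t′ X Σψ : ℕ
        t′ = b₂ + o
        leaf : List Bool → ℕ
        leaf w = count ψ t′ (main ∷ [] , drawing nil (encodeBits w) tb eb rc np z f)
        X = count ψ (drawSteps N + t′) (drawCmd ∷ main ∷ [] , drawing ⌜ N ⌝ⁿ nil tb eb rc np z f)
        Σψ = sumTape r (λ w → sum c λ x → ψ ([] , fin x w)) []
        shuffle : ∀ s o d b → s + o + suc (d + b) ≡ s + suc (d + (b + o))
        shuffle = solve-∀
        lem₁ : ∀ p q x → p * (2 * (q * (2 * x))) ≡ 2 * (q * (2 * (p * x)))
        lem₁ = solve-∀
        lem₂ : ∀ p q u x → 2 * (p * (2 * (q * (u * x)))) ≡ 2 * (p * (2 * (q * u))) * x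
        lem₂ = solve-∀
        sumTape-* : ∀ m a φ w → sumTape m (λ w → a * φ w) w ≡ a * sumTape m φ w
        sumTape-* zero    a φ w = refl
        sumTape-* (suc m) a φ w = trans (cong₂ _+_ (sumTape-* m a φ (false ∷ w)) (sumTape-* m a φ (true ∷ w)))
          (sym (*-distribˡ-+ a (sumTape m φ (false ∷ w)) (sumTape m φ (true ∷ w))))
        leaves : sumTape N leaf [] ≡ 2 ^ t′ * Σψ
        leaves = trans (cong (λ m → sumTape m leaf []) N≡) (trans (sumTape-+ r (size c) leaf [])
          (trans (sumTape-cong r (λ w → trans (sumTape-code c leaf w)
            (trans (sum-cong c λ x → count-↠ ψ (reach (rest x w) []) (m≤m+n b₂ o)) (sum-* c (2 ^ t′) (λ x → ψ ([] , fin x w))))) [])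
          (sumTape-* r (2 ^ t′) (λ w → sum c λ x → ψ ([] , fin x w)) [])))

-- Schöning's walk compared with a walk on ℕ

module RandomWalks where
  open Algorithm
  open Counting
  import Data.Bool.Properties as Bool
  open import Data.Fin.Base using (zero; suc)
  open import Data.List.Properties using (drop-[])
  open import Data.List.Membership.Propositional using (_∈_)
  open import Data.List.Relation.Unary.All as All using (All; []; _∷_)
  open import Data.List.Relation.Unary.Any using (Any; here; there)
  open import Data.Nat.DivMod using (_%_; [m+kn]%n≡m%n; m<n⇒m%n≡m)

  private variable
    n : ℕ

  dH-set : ∀ (x y : Vec Bool n) i s → dH x y ≤ suc (dH x (y [ i ]≔ s))
  dH-set (a ∷ x) (b ∷ y) zero    s = +-mono-≤ (bit≤1 (a xor b)) (m≤n+m (dH x y) (if a xor s then 1 else 0))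
    where
    bit≤1 : ∀ b → (if b then 1 else 0) ≤ 1
    bit≤1 false = z≤n
    bit≤1 true  = ≤-refl
  dH-set (a ∷ x) (b ∷ y) (suc i) s = ≤-trans (+-monoʳ-≤ (if a xor b then 1 else 0) (dH-set x y i s)) (≤-reflexive (+-suc _ _))

  dH-set′ : ∀ (y x : Vec Bool n) i s → dH (y [ i ]≔ s) x ≤ suc (dH y x)
  dH-set′ (b ∷ y) (a ∷ x) zero    s = +-mono-≤ (bit≤1 (s xor a)) (m≤n+m (dH y x) (if b xor a then 1 else 0))
    where
    bit≤1 : ∀ b → (if b then 1 else 0) ≤ 1
    bit≤1 false = z≤n
    bit≤1 true  = ≤-refl
  dH-set′ (b ∷ y) (a ∷ x) (suc i) s = ≤-trans (+-monoʳ-≤ (if b xor a then 1 else 0) (dH-set′ y x i s)) (≤-reflexive (+-suc _ _))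

  dH-toward : ∀ (y x : Vec Bool n) i → lookup y i ≢ lookup x i → dH y x ≡ suc (dH (y [ i ]≔ lookup x i) x)
  dH-toward (false ∷ y) (false ∷ x) zero ne = contradiction refl ne
  dH-toward (false ∷ y) (true ∷ x)  zero ne = refl
  dH-toward (true ∷ y)  (false ∷ x) zero ne = refl
  dH-toward (true ∷ y)  (true ∷ x)  zero ne = contradiction refl ne
  dH-toward (b ∷ y) (a ∷ x) (suc i) ne = trans (cong ((if b xor a then 1 else 0) +_) (dH-toward y x i ne)) (+-suc _ _)

  dH≡0 : ∀ (y x : Vec Bool n) → dH y x ≡ 0 → y ≡ x
  dH≡0 []          []          eq = refl
  dH≡0 (false ∷ y) (false ∷ x) eq = cong (false ∷_) (dH≡0 y x eq)
  dH≡0 (true ∷ y)  (true ∷ x)  eq = cong (true ∷_) (dH≡0 y x eq)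

  dH-triangle : ∀ (x y z : Vec Bool n) → dH x z ≤ dH x y + dH y z
  dH-triangle []      []      []      = z≤n
  dH-triangle (a ∷ x) (b ∷ y) (c ∷ z) = ≤-trans (+-mono-≤ (bits a b c) (dH-triangle x y z))
    (≤-reflexive (lem (if a xor b then 1 else 0) (if b xor c then 1 else 0) (dH x y) (dH y z)))
    where
    bits : ∀ a b c → (if a xor c then 1 else 0) ≤ (if a xor b then 1 else 0) + (if b xor c then 1 else 0)
    bits false false false = ≤-refl
    bits false false true  = ≤-refl
    bits false true  false = z≤n
    bits false true  true  = ≤-refl
    bits true  false false = ≤-refl
    bits true  false true  = z≤n
    bits true  true  false = ≤-refl
    bits true  true  true  = ≤-refl
    lem : ∀ a b c d → (a + b) + (c + d) ≡ (a + c) + (b + d)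
    lem = solve-∀

  literalTrue⇒ : ∀ (y : Assignment n) l → literalTrue y l ≡ true → LitTrue y l
  literalTrue⇒ y (s , i) eq with s | lookup y i
  ... | false | false = refl
  ... | true  | true  = refl

  ⇒literalTrue : ∀ (y : Assignment n) l → LitTrue y l → literalTrue y l ≡ true
  ⇒literalTrue y (s , i) eq with s | lookup y i
  ⇒literalTrue y (s , i) refl | false | .false = refl
  ⇒literalTrue y (s , i) refl | true  | .true  = refl

  clauseTrue-true : ∀ (y : Assignment n) C → clauseTrue y C true ≡ true
  clauseTrue-true y []      = refl
  clauseTrue-true y (l ∷ C) = clauseTrue-true y C

  clauseTrue⇒ : ∀ (y : Assignment n) C → clauseTrue y C false ≡ true → Any (LitTrue y) C
  clauseTrue⇒ y (l ∷ C) eq with literalTrue y l in eqₗ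
  ... | true  = here (literalTrue⇒ y l eqₗ)
  ... | false = there (clauseTrue⇒ y C eq)

  ⇒clauseTrue : ∀ (y : Assignment n) {C} → Any (LitTrue y) C → clauseTrue y C false ≡ true
  ⇒clauseTrue y {l ∷ C} (here p) = trans (cong (clauseTrue y C) (⇒literalTrue y l p)) (clauseTrue-true y C)
  ⇒clauseTrue y {l ∷ C} (there p) with literalTrue y l
  ... | true  = clauseTrue-true y C
  ... | false = ⇒clauseTrue y p

  satisfied⇒lastFalsified : ∀ (y : Assignment n) {F} D → Satisfies F y → lastFalsified y F D ≡ D
  satisfied⇒lastFalsified y D []       = refl
  satisfied⇒lastFalsified y D (p ∷ ps) rewrite ⇒clauseTrue y p = satisfied⇒lastFalsified y D ps

  lastFalsified-∈ : ∀ (y : Assignment n) F D →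
    (lastFalsified y F D ≡ D) ⊎ (lastFalsified y F D ∈ F × clauseTrue y (lastFalsified y F D) false ≡ false)
  lastFalsified-∈ y []      D = inj₁ refl
  lastFalsified-∈ y (C ∷ F) D with clauseTrue y C false in eq
  ... | true with lastFalsified-∈ y F D
  ...   | inj₁ p       = inj₁ p
  ...   | inj₂ (p , q) = inj₂ (there p , q)
  lastFalsified-∈ y (C ∷ F) D | false with lastFalsified-∈ y F C
  ...   | inj₁ p       = inj₂ (here p , trans (cong (λ C → clauseTrue y C false) p) eq)
  ...   | inj₂ (p , q) = inj₂ (there p , q)

  lastFalsified⇒satisfied : ∀ (y : Assignment n) F D → All (_≢ []) F → lastFalsified y F D ≡ [] → D ≡ [] × Satisfies F y
  lastFalsified⇒satisfied y []      D ne         eq = eq , []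
  lastFalsified⇒satisfied y (C ∷ F) D (C≢[] ∷ ne) eq with clauseTrue y C false in eqC
  ... | true  = let p , q = lastFalsified⇒satisfied y F D ne eq in p , clauseTrue⇒ y C eqC ∷ q
  ... | false = contradiction (proj₁ (lastFalsified⇒satisfied y F C ne eq)) C≢[]

  satisfiable⇒nonEmpty : ∀ {x : Assignment n} {F} → Satisfies F x → All (_≢ []) F
  satisfiable⇒nonEmpty = All.map λ { (here _) () ; (there _) () }

  -- A literal of `C` that `x` satisfies is falsified by `y`, so both differ at its variable. Its
  -- slot `j` is the one that brings the walk closer to `x`.
  repairing : ∀ (y x : Assignment n) C → clauseTrue y C false ≡ false → Any (LitTrue x) C →
    ∃[ j ] ∃[ i ] ∃[ C′ ] (j < length C × List.drop j C ≡ (lookup x i , i) ∷ C′ × lookup y i ≢ lookup x i)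
  repairing y x ((s , i) ∷ C) false≡ (here refl) = 0 , i , C , s≤s z≤n , refl ,
    λ eq → contradiction (trans (sym (⇒clauseTrue y (here {xs = C} eq))) false≡) λ ()
  repairing y x (l ∷ C) false≡ (there p) with literalTrue y l
  ... | true  = contradiction (trans (sym (clauseTrue-true y C)) false≡) λ ()
  ... | false = let j , i , C′ , j< , eq , ne = repairing y x C false≡ p in suc j , i , C′ , s≤s j< , eq , ne

  rangeSum : ℕ → (ℕ → ℕ) → ℕ
  rangeSum zero    f = 0
  rangeSum (suc m) f = rangeSum m f + f m

  rangeSum-cong : ∀ m {f f′ : ℕ → ℕ} → (∀ i → f i ≡ f′ i) → rangeSum m f ≡ rangeSum m f′
  rangeSum-cong zero    eq = refl
  rangeSum-cong (suc m) eq = cong₂ _+_ (rangeSum-cong m eq) (eq m)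

  rangeSum-+ : ∀ a b f → rangeSum (b + a) f ≡ rangeSum a f + rangeSum b (λ i → f (i + a))
  rangeSum-+ a zero    f = sym (+-identityʳ _)
  rangeSum-+ a (suc b) f = trans (cong (_+ f (b + a)) (rangeSum-+ a b f)) (+-assoc (rangeSum a f) _ _)

  rangeSum-term : ∀ m f {i} → i < m → f i ≤ rangeSum m f
  rangeSum-term (suc m) f {i} (s≤s i≤m) with m≤n⇒m<n∨m≡n i≤m
  ... | inj₁ i<m  = ≤-trans (rangeSum-term m f i<m) (m≤m+n _ (f m))
  ... | inj₂ refl = m≤n+m (f m) (rangeSum m f)

  opaque
    sum-binary : ∀ s v (f : ℕ → ℕ) → sum (dieCode s) (λ u → f (binary v u)) ≡ rangeSum (2 ^ s) (λ i → f (i + v * 2 ^ s))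
    sum-binary zero    v f = cong f (sym (*-identityʳ v))
    sum-binary (suc s) v f = trans (cong₂ _+_ (sum-binary s (2 * v) f) (sum-binary s (suc (2 * v)) f))
      (trans (cong₂ _+_ (rangeSum-cong (2 ^ s) λ i → cong f (lem₁ i v (2 ^ s))) (rangeSum-cong (2 ^ s) λ i → cong f (lem₂ i v (2 ^ s))))
      (trans (sym (rangeSum-+ (2 ^ s) (2 ^ s) _)) (cong (λ m → rangeSum m (λ i → f (i + v * (2 * 2 ^ s)))) (lem₃ (2 ^ s)))))
      where
      lem₁ : ∀ i v p → i + 2 * v * p ≡ i + v * (2 * p)
      lem₁ = solve-∀
      lem₂ : ∀ i v p → i + suc (2 * v) * p ≡ i + p + v * (2 * p)
      lem₂ = solve-∀
      lem₃ : ∀ p → p + p ≡ 2 * p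
      lem₃ = solve-∀

  module _ (k : ℕ) .⦃ _ : NonZero k ⦄ where

    hits : ℕ → ℕ → ℕ
    hits j v = if v % k ≡ᵇ j then 1 else 0

    opaque
      hits-self : ∀ j v → v % k ≡ j → hits j v ≡ 1
      hits-self j v refl with v % k ≡ᵇ v % k | ≡⇒≡ᵇ (v % k) (v % k) refl
      ... | true | _ = refl

    opaque
      -- Each of the `g` full blocks of `k` consecutive numbers contains the residue `j`; the
      -- remaining `r` numbers are not counted.
      g≤hits : ∀ j g r → j < k → g ≤ rangeSum (r + g * k) (hits j)
      g≤hits j g r j<k = ≤-trans (blocks g) (≤-trans (m≤m+n _ _) (≤-reflexive (sym (rangeSum-+ (g * k) r (hits j)))))
        where
        blocks : ∀ g → g ≤ rangeSum (g * k) (hits j)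
        blocks zero    = z≤n
        blocks (suc g) = ≤-trans (≤-trans (≤-reflexive (+-comm 1 g)) (+-mono-≤ (blocks g)
          (≤-trans (≤-reflexive (sym (hits-self j (j + g * k) (trans ([m+kn]%n≡m%n j g k) (m<n⇒m%n≡m j<k)))))
            (rangeSum-term k (λ i → hits j (i + g * k)) j<k))))
          (≤-reflexive (sym (rangeSum-+ (g * k) k (hits j))))

    opaque
      -- At least `g` sides pick slot `j`. If there are more, treating them as misses only lowers
      -- the sum, because `Y ≤ X`.
      die-bound : ∀ s g h j {X Y} (f : Vec Bool s → ℕ) → 2 ^ s ≡ g + h → g * k ≤ 2 ^ s → j < k → Y ≤ X →
        (∀ u → binary 0 u % k ≡ j → X ≤ f u) → (∀ u → Y ≤ f u) → g * X + h * Y ≤ sum (dieCode s) f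
      die-bound s g h j {X} {Y} f M≡ gk≤M j<k Y≤X hit miss with m≤n⇒∃[o]m+o≡n Y≤X | m≤n⇒∃[o]m+o≡n gk≤M
      ... | δ , refl | r , r≡ = ≤-trans (≤-reflexive (lem g h Y δ)) (≤-trans
        (+-monoʳ-≤ ((g + h) * Y) (*-monoˡ-≤ δ enough))
        (≤-trans (≤-reflexive (sym (trans (sum-+ (dieCode s) (λ _ → Y) (λ u → hits j (binary 0 u) * δ))
          (cong₂ _+_ (trans (sum-const (dieCode s) Y) (cong (_* Y) (trans (cong (2 ^_) (*-identityʳ s)) M≡)))
            (sum-*ʳ (dieCode s) δ (λ u → hits j (binary 0 u))))))) (sum-mono (dieCode s) pointwise)))
        where
        lem : ∀ g h Y δ → g * (Y + δ) + h * Y ≡ (g + h) * Y + g * δ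
        lem = solve-∀
        enough : g ≤ sum (dieCode s) (λ u → hits j (binary 0 u))
        enough = ≤-trans (g≤hits j g r j<k) (≤-reflexive (trans (cong (λ m → rangeSum m (hits j)) (trans (+-comm r (g * k)) r≡))
          (trans (rangeSum-cong (2 ^ s) λ i → cong (hits j) (sym (+-identityʳ i))) (sym (sum-binary s 0 (hits j))))))
        pointwise : ∀ u → Y + hits j (binary 0 u) * δ ≤ f u
        pointwise u with binary 0 u % k ≡ᵇ j in eq
        ... | true  = ≤-trans (≤-reflexive (cong (Y +_) (+-identityʳ δ))) (hit u (≡ᵇ⇒≡ (binary 0 u % k) j (subst (λ b → Data.Bool.Base.T b) (sym eq) _)))
        ... | false = ≤-trans (≤-reflexive (+-identityʳ Y)) (miss u)

  -- A random walk on ℕ that moves down with weight g and up with weight h; hitting g h T l j / (g + h) ^ T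
  -- is the probability that it goes from j to 0 in at most min l T steps.
  hitting : ℕ → ℕ → ℕ → ℕ → ℕ → ℕ
  hitting g h T       l       zero    = (g + h) ^ T
  hitting g h T       zero    (suc j) = 0
  hitting g h zero    (suc l) (suc j) = 0
  hitting g h (suc T) (suc l) (suc j) = g * hitting g h T l j + h * hitting g h T l (suc (suc j))

  opaque
    mutual
      -- Justifies the worst case for a miss: it may also keep or lower the number of errors, but
      -- counting one more error is the least favourable.
      hitting-antitone : ∀ g h T l j → hitting g h T l (suc j) ≤ hitting g h T l j
      hitting-antitone g h T       zero    j       = z≤n
      hitting-antitone g h zero    (suc l) j       = z≤n
      hitting-antitone g h (suc T) (suc l) zero    = ≤-trans
        (+-monoʳ-≤ (g * (g + h) ^ T) (*-monoʳ-≤ h (hitting-bound g h T l 2)))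
        (≤-reflexive (sym (*-distribʳ-+ ((g + h) ^ T) g h)))
      hitting-antitone g h (suc T) (suc l) (suc j) =
        +-mono-≤ (*-monoʳ-≤ g (hitting-antitone g h T l j)) (*-monoʳ-≤ h (hitting-antitone g h T l (suc (suc j))))

      hitting-bound : ∀ g h T l j → hitting g h T l j ≤ (g + h) ^ T
      hitting-bound g h T l zero    = ≤-refl
      hitting-bound g h T l (suc j) = ≤-trans (hitting-antitone g h T l j) (hitting-bound g h T l j)

  opaque
    hitting-mono : ∀ g h T l {i j} → i ≤ j → hitting g h T l j ≤ hitting g h T l i
    hitting-mono g h T l {zero}  {j}     z≤n       = hitting-bound g h T l j
    hitting-mono g h T l {suc i} {suc j} (s≤s i≤j) with m≤n⇒m<n∨m≡n i≤j
    ... | inj₂ refl = ≤-refl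
    ... | inj₁ i<j  = ≤-trans (hitting-antitone g h T l j) (hitting-mono g h T l i<j)

  module Walks (k s g h : ℕ) .⦃ _ : NonZero k ⦄ (M≡ : 2 ^ s ≡ g + h) (gk≤M : g * k ≤ 2 ^ s)
    {n : ℕ} (F : CNF n) (|F| : Is k -CNF F) (z₀ x : Assignment n) (F[x] : Satisfies F x) (D Λ : ℕ) where

    Good : Assignment n → Set
    Good w = Satisfies F w × D ≤ dH z₀ w + Λ

    good? : ∀ w → Dec (Good w)
    good? w = satisfies? F w ×-dec (D ≤? dH z₀ w + Λ)

    good : Assignment n → ℕ
    good w = indicator (good? w)

    good≡1 : ∀ w → Good w → 1 ≤ good w
    good≡1 w p with good? w
    ... | yes _ = ≤-refl
    ... | no ¬p = contradiction p ¬p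

    walk-satisfied : ∀ {T} (vs : Vec (Vec Bool s) T) w → Satisfies F w → walk k F vs w ≡ w
    walk-satisfied []       w p = refl
    walk-satisfied (v ∷ vs) w p rewrite satisfied⇒lastFalsified w [] p | drop-[] {A = Literal n} (binary 0 v % k) = walk-satisfied vs w p

    setHead-far : ∀ w C → dH z₀ w ≤ suc (dH z₀ (setHead w C))
    setHead-far w []            = n≤1+n _
    setHead-far w ((s , i) ∷ C) = dH-set z₀ w i s

    setHead-near : ∀ w C → dH (setHead w C) x ≤ suc (dH w x)
    setHead-near w []            = n≤1+n _
    setHead-near w ((s , i) ∷ C) = dH-set′ w x i s

    opaque
      -- A step changes one variable and so costs at most one unit of distance from `z₀`. Of the
      -- tolerated loss `Λ`, `b` is spent and `l` steps are left. If the walk meets a satisfying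
      -- assignment other than `x`, that one is good too: `far` is maintained all along, and the
      -- walk stays there.
      walk-good : ∀ T l b w → b + l ≤ Λ → D ≤ dH z₀ w + b →
        hitting g h T l (dH w x) ≤ sum (dieCode s ^^ T) (λ vs → good (walk k F vs w))
      walk-good T l b w b+l≤Λ far with satisfies? F w
      ... | yes p = ≤-trans (hitting-bound g h T l (dH w x)) (≤-trans
        (≤-reflexive (trans (cong (_^ T) (sym M≡)) (trans (^-*-assoc 2 s T) (trans (cong (2 ^_) (trans (*-comm s T) (cong (T *_) (sym (*-identityʳ s)))))
          (sym (*-identityʳ _))))))
        (≤-trans (≤-reflexive (sym (sum-const (dieCode s ^^ T) 1)))
          (sum-mono (dieCode s ^^ T) λ vs → ≤-trans (good≡1 w (p , ≤-trans far (+-monoʳ-≤ (dH z₀ w) (m+n≤o⇒m≤o b b+l≤Λ))))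
            (≤-reflexive (cong good (sym (walk-satisfied vs w p)))))))
      ... | no ¬p with dH w x in eqd
      ...   | zero = contradiction (subst (Satisfies F) (sym (dH≡0 w x eqd)) F[x]) ¬p
      walk-good T       zero    b w b+l≤Λ far | no ¬p | suc d = z≤n
      walk-good zero    (suc l) b w b+l≤Λ far | no ¬p | suc d = z≤n
      walk-good (suc T) (suc l) b w b+l≤Λ far | no ¬p | suc d with lastFalsified-∈ w F []
      ... | inj₁ eq = contradiction (proj₂ (lastFalsified⇒satisfied w F [] (satisfiable⇒nonEmpty {x = x} F[x]) eq)) ¬p
      ... | inj₂ (C∈F , false≡) with repairing w x (lastFalsified w F []) false≡ (All.lookup F[x] C∈F)
      ...   | j , i , C′ , j< , drop≡ , ne =
        die-bound k s g h j (λ v → sum (dieCode s ^^ T) λ vs → good (walk k F vs (walkStep k F v w))) M≡ gk≤M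
          (≤-trans j< (All.lookup |F| C∈F)) (hitting-mono g h T l (m≤n+m d 2))
          (λ v v%k≡j → ≤-trans (≤-reflexive (cong (hitting g h T l) (sym (closer v v%k≡j)))) (next v))
          (λ v → ≤-trans (hitting-mono g h T l (≤-trans (setHead-near w (List.drop (binary {s} 0 v % k) (lastFalsified w F []))) (≤-reflexive (cong suc eqd)))) (next v))
        where
        next : ∀ (v : Vec Bool s) → hitting g h T l (dH (walkStep k F v w) x) ≤ sum (dieCode s ^^ T) (λ vs → good (walk k F vs (walkStep k F v w)))
        next v = walk-good T l (suc b) (walkStep k F v w) (≤-trans (≤-reflexive (sym (+-suc b l))) b+l≤Λ)
          (≤-trans far (≤-trans (+-monoˡ-≤ b (setHead-far w (List.drop (binary {s} 0 v % k) (lastFalsified w F [])))) (≤-reflexive (sym (+-suc _ b)))))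
        closer : ∀ (v : Vec Bool s) → binary {s} 0 v % k ≡ j → dH (walkStep k F v w) x ≡ d
        closer v v%k≡j = suc-injective (trans (cong (λ C → suc (dH (setHead w C) x)) (trans (cong (λ j → List.drop j (lastFalsified w F [])) v%k≡j) drop≡))
          (trans (sym (dH-toward w x i ne)) eqd))

-- Averages under the tilted measure

module Starts where
  open Algorithm
  open Counting
  open RandomWalks
  open PowerInequalities

  open ≤-Reasoning

  private variable
    n : ℕ

  -- Under the tilted measure with weights h down and g up, the walk takes j (g + h) / r steps on average;
  -- this is Markov's inequality for that time, with both sides moved so that no subtraction occurs.
  opaque
    hitting-lower : ∀ g r m₀ T l j → l ≤ T → suc l ≤ m₀ → let h = g + r; M = g + h in
      r * suc l * (g ^ j * M ^ T) ≤ r * m₀ * (hitting g h T l j * h ^ j) + j * M * (g ^ j * M ^ T)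
    hitting-lower g r m₀ T l zero l≤T l< = base₀ r (suc l) m₀ ((g + (g + r)) ^ T) l<
      where
      lem : ∀ r l p → r * l * (1 * p) ≡ r * l * (p * 1) + 0 * p
      lem = solve-∀
      base₀ : ∀ r l m p → l ≤ m → r * l * (1 * p) ≤ r * m * (p * 1) + 0
      base₀ r l m p l≤m = ≤-trans (≤-reflexive (lem r l p)) (+-monoˡ-≤ 0 (*-monoˡ-≤ (p * 1) (*-monoʳ-≤ r l≤m)))
    hitting-lower g r m₀ T zero (suc j) l≤T l< = base₁ r g j (g ^ suc j * (g + (g + r)) ^ T) (r * m₀ * 0)
      where
      lem : ∀ r g j x → r * 1 * x + (2 * g + j * (g + (g + r))) * x ≡ suc j * (g + (g + r)) * x
      lem = solve-∀
      base₁ : ∀ r g j x y → r * 1 * x ≤ y + suc j * (g + (g + r)) * x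
      base₁ r g j x y = ≤-trans (m≤m+n _ _) (≤-trans (≤-reflexive (lem r g j x)) (m≤n+m _ y))
    hitting-lower g r m₀ (suc T) (suc l) (suc j) (s≤s l≤T) l< =
      induct (suc l) j m₀ (g ^ j) ((g + r) ^ j) ((g + (g + r)) ^ T) (hitting g (g + r) T l j) (hitting g (g + r) T l (suc (suc j)))
        (hitting-lower g r m₀ T l j l≤T (<⇒≤ l<)) (hitting-lower g r m₀ T l (suc (suc j)) l≤T (<⇒≤ l<))
      where
      induct : ∀ l j m₀ G H m p q → let h = g + r; M = g + h in
        r * l * (G * m) ≤ r * m₀ * (p * H) + j * M * (G * m) →
        r * l * (g * (g * G) * m) ≤ r * m₀ * (q * (h * (h * H))) + suc (suc j) * M * (g * (g * G) * m) →
        r * suc l * (g * G * (M * m)) ≤ r * m₀ * ((g * p + h * q) * (h * H)) + suc j * M * (g * G * (M * m))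
      induct l j m₀ G H m p q hyp₁ hyp₂ = begin
        r * suc l * (g * G * (M * m))
          ≡⟨ lem₁ g r l G m ⟩
        g * h * (r * l * (G * m)) + r * l * (g * (g * G) * m) + r * (g * G * (M * m))
          ≤⟨ +-monoˡ-≤ (r * (g * G * (M * m))) (+-mono-≤ (*-monoʳ-≤ (g * h) hyp₁) hyp₂) ⟩
        g * h * (r * m₀ * (p * H) + j * M * (G * m)) + (r * m₀ * (q * (h * (h * H))) + suc (suc j) * M * (g * (g * G) * m)) + r * (g * G * (M * m))
          ≡⟨ lem₂ g r m₀ j G H m p q ⟩
        r * m₀ * ((g * p + h * q) * (h * H)) + suc j * M * (g * G * (M * m)) ∎
        where
        h M : ℕ
        h = g + r
        M = g + h
        lem₁ : ∀ g r l G m → r * suc l * (g * G * ((g + (g + r)) * m)) ≡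
          g * (g + r) * (r * l * (G * m)) + r * l * (g * (g * G) * m) + r * (g * G * ((g + (g + r)) * m))
        lem₁ = solve-∀
        lem₂ : ∀ g r m₀ j G H m p q →
          g * (g + r) * (r * m₀ * (p * H) + j * (g + (g + r)) * (G * m)) + (r * m₀ * (q * ((g + r) * ((g + r) * H))) + suc (suc j) * (g + (g + r)) * (g * (g * G) * m)) + r * (g * G * ((g + (g + r)) * m))
          ≡ r * m₀ * ((g * p + (g + r) * q) * ((g + r) * H)) + suc j * (g + (g + r)) * (g * G * ((g + (g + r)) * m))
        lem₂ = solve-∀

  opaque
    -- Markov's inequality for errors plus steps: `j` errors leave `Λ - j` steps, and the tilted
    -- mean is `j + j M / r = 2 h j / r`, as `M + r = 2 h`. If `Λ < j`, the last term alone exceeds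
    -- the left side.
    start-lower : ∀ g r T Λ j → Λ ≤ T → let h = g + r; M = g + h in
      r * suc Λ * (g ^ j * M ^ T) ≤ r * suc Λ * (hitting g h T (Λ ∸ j) j * h ^ j) + 2 * h * j * (g ^ j * M ^ T)
    start-lower g r T Λ j Λ≤T with ≤-total j Λ
    ... | inj₁ j≤Λ = begin
      r * suc Λ * X                                ≡⟨ cong (λ u → r * suc u * X) (m∸n+n≡m j≤Λ) ⟨
      r * suc (Λ ∸ j + j) * X                      ≡⟨ lem₁ r (Λ ∸ j) j X ⟩
      r * suc (Λ ∸ j) * X + j * r * X              ≤⟨ +-monoˡ-≤ (j * r * X) (hitting-lower g r (suc Λ) T (Λ ∸ j) j (≤-trans (m∸n≤m Λ j) Λ≤T) (s≤s (m∸n≤m Λ j))) ⟩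
      Y + j * (g + (g + r)) * X + j * r * X        ≡⟨ lem₂ g r j X Y ⟩
      Y + 2 * (g + r) * j * X                      ∎
      where
      X Y : ℕ
      X = g ^ j * (g + (g + r)) ^ T
      Y = r * suc Λ * (hitting g (g + r) T (Λ ∸ j) j * (g + r) ^ j)
      lem₁ : ∀ r l j X → r * suc (l + j) * X ≡ r * suc l * X + j * r * X
      lem₁ = solve-∀
      lem₂ : ∀ g r j X Y → Y + j * (g + (g + r)) * X + j * r * X ≡ Y + 2 * (g + r) * j * X
      lem₂ = solve-∀
    ... | inj₂ Λ≤j with m≤n⇒m<n∨m≡n Λ≤j
    ...   | inj₂ refl = subst (λ u → r * suc Λ * X ≤ u) refl (begin
      r * suc Λ * X                    ≡⟨ lem₁ r Λ X ⟩
      r * 1 * X + Λ * r * X            ≤⟨ +-monoˡ-≤ (Λ * r * X) (≤-trans (hitting-lower g r (suc Λ) T 0 Λ z≤n (s≤s z≤n)) (≤-reflexive (cong (λ l → r * suc Λ * (hitting g (g + r) T l Λ * (g + r) ^ Λ) + Λ * (g + (g + r)) * X) (sym (n∸n≡0 Λ))))) ⟩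
      Y + Λ * (g + (g + r)) * X + Λ * r * X ≡⟨ lem₂ g r Λ X Y ⟩
      Y + 2 * (g + r) * Λ * X          ∎)
      where
      X Y : ℕ
      X = g ^ Λ * (g + (g + r)) ^ T
      Y = r * suc Λ * (hitting g (g + r) T (Λ ∸ Λ) Λ * (g + r) ^ Λ)
      lem₁ : ∀ r l X → r * suc l * X ≡ r * 1 * X + l * r * X
      lem₁ = solve-∀
      lem₂ : ∀ g r j X Y → Y + j * (g + (g + r)) * X + j * r * X ≡ Y + 2 * (g + r) * j * X
      lem₂ = solve-∀
    ...   | inj₁ Λ<j = ≤-trans (*-monoˡ-≤ X (≤-trans (*-monoʳ-≤ r Λ<j) (*-monoˡ-≤ j (≤-trans (m≤n+m r (g + (g + r))) (≤-reflexive (lem g r)))))) (m≤n+m _ _)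
      where
      X : ℕ
      X = g ^ j * (g + (g + r)) ^ T
      lem : ∀ g r → g + (g + r) + r ≡ 2 * (g + r)
      lem = solve-∀

  -- One of the `2 ^ s` sides is all ones. Adding `φ false` to both sides avoids the subtraction in
  -- `2 ^ s - 1`.
  sum-allTrue : ∀ s (φ : Bool → ℕ) → sum (dieCode s) (λ u → φ (allTrue u)) + φ false ≡ φ true + 2 ^ s * φ false
  sum-allTrue zero    φ = cong (φ true +_) (sym (+-identityʳ (φ false)))
  sum-allTrue (suc s) φ = trans (cong (λ u → u + sum (dieCode s) (λ u → φ (allTrue u)) + φ false)
      (trans (sum-const (dieCode s) (φ false)) (cong (λ m → 2 ^ m * φ false) (*-identityʳ s))))
    (trans (+-assoc (2 ^ s * φ false) _ (φ false)) (trans (cong (2 ^ s * φ false +_) (sum-allTrue s φ)) (lem (2 ^ s) (φ false) (φ true))))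
    where
    lem : ∀ p a b → p * a + (b + p * a) ≡ b + 2 * p * a
    lem = solve-∀

  -- The number of rolls of `e` dice in which at least one shows all ones, for dice with `μ + 1`
  -- sides: either the first die does not and a later one does, or the first does.
  fixedCount : ℕ → ℕ → ℕ
  fixedCount μ zero    = 0
  fixedCount μ (suc e) = μ * fixedCount μ e + suc μ ^ e

  fixed+free : ∀ μ e → fixedCount μ e + μ ^ e ≡ suc μ ^ e
  fixed+free μ zero    = refl
  fixed+free μ (suc e) = trans (lem μ (fixedCount μ e) (suc μ ^ e) (μ ^ e)) (trans (cong (λ u → suc μ ^ e + μ * u) (fixed+free μ e)) refl)
    where
    lem : ∀ μ c p f → μ * c + p + μ * f ≡ p + μ * (c + f)
    lem = solve-∀

  module Sampling (s μ : ℕ) (M≡ : 2 ^ s ≡ suc μ) where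

    total-dice : ∀ e → total (dieCode s ^^ e) ≡ suc μ ^ e
    total-dice e = trans (cong (2 ^_) (trans (cong (e *_) (*-identityʳ s)) (*-comm e s)))
      (trans (sym (^-*-assoc 2 s e)) (cong (_^ e) M≡))

    stillFree-false : ∀ {e} (us : Vec (Vec Bool s) e) → stillFree false us ≡ false
    stillFree-false []       = refl
    stillFree-false (u ∷ us) = stillFree-false us

    opaque
      sum-stillFree : ∀ e (φ : Bool → ℕ) →
        sum (dieCode s ^^ e) (λ us → φ (stillFree true us)) ≡ μ ^ e * φ true + fixedCount μ e * φ false
      sum-stillFree zero    φ = trans (sym (+-identityʳ (φ true))) (sym (+-identityʳ (φ true + 0)))
      sum-stillFree (suc e) φ = +-cancelʳ-≡ K _ _ (trans (sum-allTrue s λ b → sum (dieCode s ^^ e) λ us → φ (stillFree (not b) us))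
        (trans (cong₂ _+_ (trans (sum-cong (dieCode s ^^ e) λ us → cong φ (stillFree-false us)) (trans (sum-const (dieCode s ^^ e) (φ false)) (cong (_* φ false) (total-dice e))))
          (trans (cong (_* K) M≡) refl))
        (trans (cong (λ u → suc μ ^ e * φ false + (u + μ * u)) (sum-stillFree e φ)) (trans (lem (suc μ ^ e) μ (μ ^ e) (fixedCount μ e) (φ true) (φ false))
          (cong (λ u → μ * μ ^ e * φ true + (μ * fixedCount μ e + suc μ ^ e) * φ false + u) (sym (sum-stillFree e φ)))))))
        where
        K : ℕ
        K = sum (dieCode s ^^ e) (λ us → φ (stillFree true us))
        lem : ∀ p μ f c x y → p * y + ((f * x + c * y) + μ * (f * x + c * y)) ≡ μ * f * x + (μ * c + p) * y + (f * x + c * y)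
        lem = solve-∀

    module _ (e : ℕ) where

      f c : ℕ
      f = μ ^ e
      c = fixedCount μ e

      bitCode : Code
      bitCode = dieCode s ^^ e ⊗ bit

      differ : Bool → Bool → ℕ
      differ y x = if y xor x then 1 else 0

      opaque
        sum-sampleBit : ∀ z (φ : Bool → ℕ) →
          sum bitCode (λ v → φ (sampleBit z v)) ≡ f * (φ false + φ true) + c * (φ z + φ z)
        sum-sampleBit z φ = sum-stillFree e (λ q → φ (if q then false else z) + φ (if q then true else z))

      opaque
        -- Where `z₀` and `x` agree, a fixed variable is right for both values of its random bit,
        -- hence `2 * c`; a free one is right for one of the two.
        sum-agree : ∀ x (φ : ℕ → ℕ) → (2 * c + f) * φ 0 + f * φ 1 ≤ sum bitCode (λ v → φ (differ (sampleBit x v) x))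
        sum-agree x φ = ≤-reflexive (trans (lem x) (sym (sum-sampleBit x (λ b → φ (differ b x)))))
          where
          lem₁ : ∀ f c a b → (2 * c + f) * a + f * b ≡ f * (a + b) + c * (a + a)
          lem₁ = solve-∀
          lem₂ : ∀ f c a b → (2 * c + f) * a + f * b ≡ f * (b + a) + c * (a + a)
          lem₂ = solve-∀
          lem : ∀ x → (2 * c + f) * φ 0 + f * φ 1 ≡ f * (φ (differ false x) + φ (differ true x)) + c * (φ (differ x x) + φ (differ x x))
          lem false = lem₁ f c (φ 0) (φ 1)
          lem true  = lem₂ f c (φ 0) (φ 1)

      opaque
        -- Only the outcomes in which the variable is free are kept. A variable fixed to the wrong
        -- value would be a fixed error.
        sum-disagree : ∀ z x (φ : ℕ → ℕ) → f * φ 0 + f * φ 1 ≤ sum bitCode (λ v → φ (differ (sampleBit z v) x))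
        sum-disagree z x φ = ≤-trans (≤-reflexive (lem x)) (≤-trans (m≤m+n _ (c * (φ (differ z x) + φ (differ z x))))
          (≤-reflexive (sym (sum-sampleBit z (λ b → φ (differ b x))))))
          where
          lem : ∀ x → f * φ 0 + f * φ 1 ≡ f * (φ (differ false x) + φ (differ true x))
          lem false = sym (*-distribˡ-+ f (φ 0) (φ 1))
          lem true  = trans (+-comm (f * φ 0) (f * φ 1)) (sym (*-distribˡ-+ f (φ 1) (φ 0)))

      module _ (g h : ℕ) where

        weightA weightB : ℕ
        weightA = (2 * c + f) * h + f * g
        weightB = f * h + f * g

        -- The generating function ∑ g^j h^(n-j) of the number j of errors at the start, and its derivative ∑ j g^j h^(n-j).
        mass loss : Vec Bool n → Vec Bool n → ℕ
        mass []      []      = 1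
        mass (a ∷ z) (b ∷ x) = (if a xor b then weightB else weightA) * mass z x
        loss []      []      = 0
        loss (a ∷ z) (b ∷ x) = (if a xor b then weightB else weightA) * loss z x + f * g * mass z x

        module _ (P : ℕ → ℕ) (α β m : ℕ) (hyp : ∀ j → α * (g ^ j * m) ≤ α * (P j * h ^ j) + β * j * (g ^ j * m)) where

          starts : ℕ → Vec Bool n → Vec Bool n → ℕ
          starts {n} j z x = sum (sampleCode s e n) (λ v → P (j + dH (sampleAll z v) x))

          opaque
            combine : ∀ w j G H Z Y S₀ S₁ S → w * S₀ + f * S₁ ≤ S →
              α * (G * m) * Z ≤ α * (H * S₀) + β * (G * m) * (j * Z + Y) →
              α * (g * G * m) * Z ≤ α * (h * H * S₁) + β * (g * G * m) * (suc j * Z + Y) →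
              α * (G * m) * ((w * h + f * g) * Z) ≤ α * (h * H * S) + β * (G * m) * (j * ((w * h + f * g) * Z) + ((w * h + f * g) * Y + f * g * Z))
            combine w j G H Z Y S₀ S₁ S S≥ hyp₀ hyp₁ = begin
              α * (G * m) * ((w * h + f * g) * Z)
                ≡⟨ lem₁ α G m w h f g Z ⟩
              w * h * (α * (G * m) * Z) + f * (α * (g * G * m) * Z)
                ≤⟨ +-mono-≤ (*-monoʳ-≤ (w * h) hyp₀) (*-monoʳ-≤ f hyp₁) ⟩
              w * h * (α * (H * S₀) + β * (G * m) * (j * Z + Y)) + f * (α * (h * H * S₁) + β * (g * G * m) * (suc j * Z + Y))
                ≡⟨ lem₂ α β G H m w h f g Z Y j S₀ S₁ ⟩
              α * (h * H * (w * S₀ + f * S₁)) + β * (G * m) * (j * ((w * h + f * g) * Z) + ((w * h + f * g) * Y + f * g * Z))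
                ≤⟨ +-monoˡ-≤ _ (*-monoʳ-≤ α (*-monoʳ-≤ (h * H) S≥)) ⟩
              α * (h * H * S) + β * (G * m) * (j * ((w * h + f * g) * Z) + ((w * h + f * g) * Y + f * g * Z)) ∎
              where
              lem₁ : ∀ α G m w h f g Z → α * (G * m) * ((w * h + f * g) * Z) ≡ w * h * (α * (G * m) * Z) + f * (α * (g * G * m) * Z)
              lem₁ = solve-∀
              lem₂ : ∀ α β G H m w h f g Z Y j S₀ S₁ →
                w * h * (α * (H * S₀) + β * (G * m) * (j * Z + Y)) + f * (α * (h * H * S₁) + β * (g * G * m) * (suc j * Z + Y)) ≡
                α * (h * H * (w * S₀ + f * S₁)) + β * (G * m) * (j * ((w * h + f * g) * Z) + ((w * h + f * g) * Y + f * g * Z))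
              lem₂ = solve-∀

          opaque
            -- Sums `hyp` over all starts, one variable at a time; `j` counts the errors among the
            -- variables treated before. `mass` is the total tilted weight, and `loss` accumulates
            -- the numbers of errors that the mean needs.
            starts-lower : ∀ j (z x : Vec Bool n) →
              α * (g ^ j * m) * mass z x ≤ α * (h ^ (n + j) * starts j z x) + β * (g ^ j * m) * (j * mass z x + loss z x)
            starts-lower j [] [] = ≤-trans (≤-reflexive (*-identityʳ _)) (≤-trans (hyp j) (≤-reflexive (trans
              (cong (λ u → α * (P u * h ^ j) + β * j * (g ^ j * m)) (sym (+-identityʳ j))) (lem α β (P (j + 0)) (h ^ j) (g ^ j * m) j))))
              where
              lem : ∀ α β p q x j → α * (p * q) + β * j * x ≡ α * (q * p) + β * x * (j * 1 + 0)
              lem = solve-∀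
            starts-lower {n = suc n} j (a ∷ z) (b ∷ x) = go a b
              where
              S₁≡ : h ^ (n + suc j) ≡ h * h ^ (n + j)
              S₁≡ = cong (h ^_) (+-suc n j)
              ih₁ : α * (g * g ^ j * m) * mass z x ≤ α * (h * h ^ (n + j) * starts (suc j) z x) + β * (g * g ^ j * m) * (suc j * mass z x + loss z x)
              ih₁ = subst (λ u → α * (g * g ^ j * m) * mass z x ≤ α * (u * starts (suc j) z x) + β * (g * g ^ j * m) * (suc j * mass z x + loss z x)) S₁≡ (starts-lower (suc j) z x)
              φ : ℕ → ℕ
              φ d = sum (sampleCode s e n) (λ v → P (j + (d + dH (sampleAll z v) x)))
              φ1 : φ 1 ≡ starts (suc j) z x
              φ1 = sum-cong (sampleCode s e n) λ v → cong P (+-suc j _)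
              agree : ∀ a → (2 * c + f) * starts j z x + f * starts (suc j) z x ≤ starts j (a ∷ z) (a ∷ x)
              agree a = ≤-trans (≤-reflexive (cong (λ u → (2 * c + f) * starts j z x + f * u) (sym φ1))) (sum-agree a φ)
              disagree : ∀ a b → f * starts j z x + f * starts (suc j) z x ≤ starts j (a ∷ z) (b ∷ x)
              disagree a b = ≤-trans (≤-reflexive (cong (λ u → f * starts j z x + f * u) (sym φ1))) (sum-disagree a b φ)
              go : ∀ a b → α * (g ^ j * m) * mass (a ∷ z) (b ∷ x) ≤ α * (h ^ suc (n + j) * starts j (a ∷ z) (b ∷ x)) + β * (g ^ j * m) * (j * mass (a ∷ z) (b ∷ x) + loss (a ∷ z) (b ∷ x))
              go false false = combine (2 * c + f) j (g ^ j) (h ^ (n + j)) (mass z x) (loss z x) _ _ _ (agree false) (starts-lower j z x) ih₁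
              go true  true  = combine (2 * c + f) j (g ^ j) (h ^ (n + j)) (mass z x) (loss z x) _ _ _ (agree true) (starts-lower j z x) ih₁
              go false true  = combine f j (g ^ j) (h ^ (n + j)) (mass z x) (loss z x) _ _ _ (disagree false true) (starts-lower j z x) ih₁
              go true  false = combine f j (g ^ j) (h ^ (n + j)) (mass z x) (loss z x) _ _ _ (disagree true false) (starts-lower j z x) ih₁

-- The mean of errors plus steps, and the total mass

module Rates where
  open Algorithm
  open Counting
  open RandomWalks
  open Starts
  open PowerInequalities

  open ≤-Reasoning

  private variable
    n : ℕ

  agreements : Vec Bool n → Vec Bool n → ℕ
  agreements []      []      = 0
  agreements (a ∷ z) (b ∷ x) = (if a xor b then 0 else 1) + agreements z x

  agreements+dH : ∀ (z x : Vec Bool n) → agreements z x + dH z x ≡ n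
  agreements+dH []          []          = refl
  agreements+dH (false ∷ z) (false ∷ x) = cong suc (agreements+dH z x)
  agreements+dH (true ∷ z)  (true ∷ x)  = cong suc (agreements+dH z x)
  agreements+dH (false ∷ z) (true ∷ x)  = trans (+-suc _ _) (cong suc (agreements+dH z x))
  agreements+dH (true ∷ z)  (false ∷ x) = trans (+-suc _ _) (cong suc (agreements+dH z x))

  module _ (s μ : ℕ) (M≡ : 2 ^ s ≡ suc μ) (e g h : ℕ) where
    open Sampling s μ M≡

    private
      A B : ℕ
      A = weightA e g h
      B = weightB e g h

    mass-form : ∀ (z x : Vec Bool n) → mass e g h z x ≡ A ^ agreements z x * B ^ dH z x
    mass-form []      []      = refl
    mass-form (a ∷ z) (b ∷ x) with a xor b
    ... | false = trans (cong (A *_) (mass-form z x)) (sym (*-assoc A (A ^ agreements z x) (B ^ dH z x)))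
    ... | true  = trans (cong (B *_) (mass-form z x)) (lem B (A ^ agreements z x) (B ^ dH z x))
      where
      lem : ∀ b p q → b * (p * q) ≡ p * (b * q)
      lem = solve-∀

    opaque
      -- `loss / mass` is the logarithmic derivative of `A ^ a * B ^ D`, which is
      -- `f g (a / A + D / B)`; the denominators are cleared.
      loss-form : ∀ (z x : Vec Bool n) →
        loss e g h z x * (A * B) ≡ f e * g * (agreements z x * B + dH z x * A) * mass e g h z x
      loss-form []      []      = sym (trans (*-identityʳ (f e * g * 0)) (*-zeroʳ (f e * g)))
      loss-form (a ∷ z) (b ∷ x) with a xor b
      ... | false = stepA A B (f e * g) (agreements z x) (dH z x) (mass e g h z x) (loss e g h z x) (loss-form z x)
        where
        lem₁ : ∀ A B q Z Y → (A * Y + q * Z) * (A * B) ≡ A * (Y * (A * B)) + q * Z * (A * B)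
        lem₁ = solve-∀
        lem₂ : ∀ A B q a d Z → A * (q * (a * B + d * A) * Z) + q * Z * (A * B) ≡ q * (suc a * B + d * A) * (A * Z)
        lem₂ = solve-∀
        stepA : ∀ A B q a d Z Y → Y * (A * B) ≡ q * (a * B + d * A) * Z → (A * Y + q * Z) * (A * B) ≡ q * (suc a * B + d * A) * (A * Z)
        stepA A B q a d Z Y eq = trans (lem₁ A B q Z Y) (trans (cong (λ v → A * v + q * Z * (A * B)) eq) (lem₂ A B q a d Z))
      ... | true  = stepB A B (f e * g) (agreements z x) (dH z x) (mass e g h z x) (loss e g h z x) (loss-form z x)
        where
        lem₁ : ∀ A B q Z Y → (B * Y + q * Z) * (A * B) ≡ B * (Y * (A * B)) + q * Z * (A * B)
        lem₁ = solve-∀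
        lem₂ : ∀ A B q a d Z → B * (q * (a * B + d * A) * Z) + q * Z * (A * B) ≡ q * (a * B + suc d * A) * (B * Z)
        lem₂ = solve-∀
        stepB : ∀ A B q a d Z Y → Y * (A * B) ≡ q * (a * B + d * A) * Z → (B * Y + q * Z) * (A * B) ≡ q * (a * B + suc d * A) * (B * Z)
        stepB A B q a d Z Y eq = trans (lem₁ A B q Z Y) (trans (cong (λ v → B * v + q * Z * (A * B)) eq) (lem₂ A B q a d Z))

  -- The average of (errors at the start) + (steps of the walk) under the tilted measure, compared with the bound Λ + 1.
  module _ (u g r : ℕ) .⦃ _ : NonZero u ⦄ .⦃ _ : NonZero g ⦄ (kg≤M : suc (suc u) * g ≤ g + (g + r)) where

    private
      h M k : ℕ
      h = g + r
      M = g + h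
      k = suc (suc u)

    opaque
      ug≤r : u * g ≤ r
      ug≤r = +-cancelˡ-≤ g _ _ (+-cancelˡ-≤ g _ _ kg≤M)

    opaque
      -- In fractions `h / r ≤ (k-1) / (k-2)`, with equality for `k g = M`. Rounding `g` down makes
      -- the ratio smaller.
      hu≤ : h * u ≤ r * suc u
      hu≤ = ≤-trans (≤-reflexive (lem₁ g r u)) (≤-trans (+-monoˡ-≤ (r * u) ug≤r) (≤-reflexive (sym (*-suc r u))))
        where
        lem₁ : ∀ g r u → (g + r) * u ≡ u * g + r * u
        lem₁ = solve-∀

    opaque
      r≢0 : NonZero r
      r≢0 = >-nonZero (≤-trans (>-nonZero⁻¹ (u * g) ⦃ m*n≢0 u g ⦄) ug≤r)

    opaque
      -- Here the constant of the theorem arises: `4 (h/r)² (g/M) D` is at most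
      -- `4 (k-1)²/(k-2)² · D / k`, and one factor `k - 1` joins the `1 / k` to form `1 - 1/k`.
      far-bound : ∀ D Λ₀ → 4 * suc u * D ≤ Λ₀ * (u * u) → 4 * (h * h) * (g * k) * D ≤ suc u * (r * r) * M * Λ₀
      far-bound D Λ₀ hyp = *-cancel-≤ (u * u) ⦃ m*n≢0 u u ⦄ (begin
        4 * (h * h) * (g * k) * D * (u * u)                  ≡⟨ lem₁ h g k D u ⟩
        4 * (h * u * (h * u)) * (k * g) * D                  ≤⟨ *-monoˡ-≤ D (*-mono-≤ (*-monoʳ-≤ 4 (*-mono-≤ hu≤ hu≤)) kg≤M) ⟩
        4 * (r * suc u * (r * suc u)) * M * D                ≡⟨ lem₂ r (suc u) M D ⟩
        suc u * (r * r) * M * (4 * suc u * D)                ≤⟨ *-monoʳ-≤ (suc u * (r * r) * M) hyp ⟩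
        suc u * (r * r) * M * (Λ₀ * (u * u))                 ≡⟨ *-assoc (suc u * (r * r) * M) Λ₀ (u * u) ⟨
        suc u * (r * r) * M * Λ₀ * (u * u)                   ∎)
        where
        lem₁ : ∀ h g k D u → 4 * (h * h) * (g * k) * D * (u * u) ≡ 4 * (h * u * (h * u)) * (k * g) * D
        lem₁ = solve-∀
        lem₂ : ∀ r v M D → 4 * (r * v * (r * v)) * M * D ≡ v * (r * r) * M * (4 * v * D)
        lem₂ = solve-∀

    opaque
      -- The tilted mean of errors plus steps is `(2 h / r) · loss / mass`; with `B = f M`, the
      -- conclusion bounds it by `(1 - 1/k) Λ₀`. The second hypothesis limits the share of the
      -- agreeing variables, `a f / A`, to `D / r`, so ν must not be too large.
      mean-bound : ∀ a D f A Λ₀ → 4 * suc u * D ≤ Λ₀ * (u * u) → a * f * r ≤ A * D →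
        2 * h * k * g * (a * (f * M) + D * A) ≤ suc u * (r * Λ₀) * (A * M)
      mean-bound a D f A Λ₀ hyp afr≤AD = *-cancel-≤ r ⦃ r≢0 ⦄ (begin
        2 * h * k * g * (a * (f * M) + D * A) * r            ≡⟨ lem₁ h k g a f M D A r ⟩
        2 * h * k * g * (a * f * r * M + D * A * r)          ≤⟨ *-monoʳ-≤ (2 * h * k * g) (+-monoˡ-≤ (D * A * r) (*-monoˡ-≤ M afr≤AD)) ⟩
        2 * h * k * g * (A * D * M + D * A * r)              ≡⟨ lem₂ g r k A D ⟩
        A * (4 * (h * h) * (g * k) * D)                      ≤⟨ *-monoʳ-≤ A (far-bound D Λ₀ hyp) ⟩
        A * (suc u * (r * r) * M * Λ₀)                       ≡⟨ lem₃ A (suc u) r M Λ₀ ⟩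
        suc u * (r * Λ₀) * (A * M) * r                       ∎)
        where
        lem₁ : ∀ h k g a f M D A r → 2 * h * k * g * (a * (f * M) + D * A) * r ≡ 2 * h * k * g * (a * f * r * M + D * A * r)
        lem₁ = solve-∀
        lem₂ : ∀ g r k A D → 2 * (g + r) * k * g * (A * D * (g + (g + r)) + D * A * r) ≡ A * (4 * ((g + r) * (g + r)) * (g * k) * D)
        lem₂ = solve-∀
        lem₃ : ∀ A v r M Λ₀ → A * (v * (r * r) * M * Λ₀) ≡ v * (r * Λ₀) * (A * M) * r
        lem₃ = solve-∀

    opaque
      -- If x = z₀, there is no constraint on the walk, and it may be long.
      mean-bound₀ : ∀ a Λ₀ → 4 * a ≤ Λ₀ → 2 * h * k * g * (a * (1 * M) + 0 * M) ≤ suc u * (r * Λ₀) * (M * M)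
      mean-bound₀ a Λ₀ hyp = begin
        2 * h * k * g * (a * (1 * M) + 0 * M)    ≡⟨ lem₁ h k g a M ⟩
        2 * h * (k * g) * (a * M)                ≤⟨ *-monoˡ-≤ (a * M) (*-mono-≤ (*-monoʳ-≤ 2 h≤2r) kg≤M) ⟩
        2 * (2 * r) * M * (a * M)                ≡⟨ lem₂ r M a ⟩
        1 * (r * (4 * a)) * (M * M)              ≤⟨ *-monoˡ-≤ (M * M) (*-mono-≤ (s≤s (z≤n {u})) (*-monoʳ-≤ r hyp)) ⟩
        suc u * (r * Λ₀) * (M * M)               ∎
        where
        h≤2r : h ≤ 2 * r
        h≤2r = *-cancel-≤ u (≤-trans hu≤ (≤-trans (*-monoʳ-≤ r (≤-trans (+-monoˡ-≤ u (>-nonZero⁻¹ u)) (≤-reflexive (lem u)))) (≤-reflexive (lem′ r u))))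
          where
          lem : ∀ u → u + u ≡ 2 * u
          lem = solve-∀
          lem′ : ∀ r u → r * (2 * u) ≡ 2 * r * u
          lem′ = solve-∀
        lem₁ : ∀ h k g a M → 2 * h * k * g * (a * (1 * M) + 0 * M) ≡ 2 * h * (k * g) * (a * M)
        lem₁ = solve-∀
        lem₂ : ∀ r M a → 2 * (2 * r) * M * (a * M) ≡ 1 * (r * (4 * a)) * (M * M)
        lem₂ = solve-∀

  opaque
    -- As the mean is at most `1 - 1/k` of the threshold, with `k = suc v`, at most this fraction of
    -- the mass is lost and the fraction `1/k` remains.
    markov : ∀ α v h g f M a D A B m Z Y S .⦃ _ : NonZero α ⦄ .⦃ _ : NonZero A ⦄ .⦃ _ : NonZero B ⦄ → B ≡ f * M →
      Y * (A * B) ≡ f * g * (a * B + D * A) * Z → 2 * h * suc v * g * (a * (f * M) + D * A) ≤ v * α * (A * M) →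
      α * m * Z ≤ α * S + 2 * h * m * Y → m * Z ≤ suc v * S
    markov α v h g f M a D A B m Z Y S B≡ Y≡ mean hyp = *-cancel-≤ α (+-cancelʳ-≤ (v * (α * m * Z)) _ _ (begin
      m * Z * α + v * (α * m * Z)               ≡⟨ lem₁ m Z α v ⟩
      suc v * (α * m * Z)                       ≤⟨ *-monoʳ-≤ (suc v) hyp ⟩
      suc v * (α * S + 2 * h * m * Y)           ≡⟨ lem₂ v α S h m Y ⟩
      suc v * S * α + m * (2 * h * suc v * Y)   ≤⟨ +-monoʳ-≤ (suc v * S * α) (*-monoʳ-≤ m small) ⟩
      suc v * S * α + m * (v * α * Z)           ≡⟨ cong (suc v * S * α +_) (lem₃ m v α Z) ⟩
      suc v * S * α + v * (α * m * Z)           ∎))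
      where
      lem₁ : ∀ m Z α v → m * Z * α + v * (α * m * Z) ≡ suc v * (α * m * Z)
      lem₁ = solve-∀
      lem₂ : ∀ v α S h m Y → suc v * (α * S + 2 * h * m * Y) ≡ suc v * S * α + m * (2 * h * suc v * Y)
      lem₂ = solve-∀
      lem₃ : ∀ m v α Z → m * (v * α * Z) ≡ v * (α * m * Z)
      lem₃ = solve-∀
      lem₄ : ∀ h v Y X → 2 * h * suc v * Y * X ≡ 2 * h * suc v * (Y * X)
      lem₄ = solve-∀
      lem₅ : ∀ h v f g M a D A Z → 2 * h * suc v * (f * g * (a * (f * M) + D * A) * Z) ≡ f * Z * (2 * h * suc v * g * (a * (f * M) + D * A))
      lem₅ = solve-∀
      lem₆ : ∀ f Z v α A M → f * Z * (v * α * (A * M)) ≡ v * α * Z * (A * (f * M))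
      lem₆ = solve-∀
      small : 2 * h * suc v * Y ≤ v * α * Z
      small = *-cancel-≤ (A * B) ⦃ m*n≢0 A B ⦄ (begin
        2 * h * suc v * Y * (A * B)             ≡⟨ lem₄ h v Y (A * B) ⟩
        2 * h * suc v * (Y * (A * B))           ≡⟨ cong (2 * h * suc v *_) (trans Y≡ (cong (λ B → f * g * (a * B + D * A) * Z) B≡)) ⟩
        2 * h * suc v * (f * g * (a * (f * M) + D * A) * Z) ≡⟨ lem₅ h v f g M a D A Z ⟩
        f * Z * (2 * h * suc v * g * (a * (f * M) + D * A)) ≤⟨ *-monoʳ-≤ (f * Z) mean ⟩
        f * Z * (v * α * (A * M))               ≡⟨ lem₆ f Z v α A M ⟩
        v * α * Z * (A * (f * M))               ≡⟨ cong (λ B → v * α * Z * (A * B)) B≡ ⟨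
        v * α * Z * (A * B)                     ∎)

  -- The case where the expected number of flipped variables is a fraction of n, namely when D/n < r/2h.
  opaque
    rate : ∀ a D g r μ p A B .⦃ _ : NonZero (a + D) ⦄ .⦃ _ : NonZero r ⦄ → let h = g + r in suc μ ≡ g + h →
      2 * p * h * a ≤ A * (a + D) → μ * (2 * h * D * p) ≤ B * (r * (a + D)) →
      (p * μ) ^ (a + D) ≤ A ^ a * B ^ D
    rate a D g r μ p A B M≡ hypA hypB = *-cancel-≤ (ν ^ ν * r ^ D) ⦃ m*n≢0 (ν ^ ν) (r ^ D) ⦃ m^n≢0 ν ν ⦄ ⦃ m^n≢0 r D ⦄ ⦄ (begin
      (p * μ) ^ ν * (ν ^ ν * r ^ D)
        ≡⟨ cong (_* (ν ^ ν * r ^ D)) (trans (^-distribʳ-* ν p μ) (cong (p ^ ν *_) (^-distribˡ-+-* μ a D))) ⟩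
      p ^ ν * (μ ^ a * μ ^ D) * (ν ^ ν * r ^ D)
        ≤⟨ *-monoˡ-≤ (ν ^ ν * r ^ D) (*-monoʳ-≤ (p ^ ν) (*-monoˡ-≤ (μ ^ D) (^-monoˡ-≤ a μ≤M))) ⟩
      p ^ ν * (M ^ a * μ ^ D) * (ν ^ ν * r ^ D)
        ≡⟨ lem₁ (p ^ ν) (M ^ a) (μ ^ D) (ν ^ ν) (r ^ D) ⟩
      p ^ ν * μ ^ D * (r ^ D * M ^ a * ν ^ ν)
        ≡⟨ cong (λ m → p ^ ν * μ ^ D * (r ^ D * M ^ a * m ^ m)) (+-comm a D) ⟩
      p ^ ν * μ ^ D * (r ^ D * M ^ a * (D + a) ^ (D + a))
        -- Gibbs' inequality for the ratio `r : M`. Since `r + M = 2 h`, the same base results for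
        -- every `D`.
        ≤⟨ *-monoʳ-≤ (p ^ ν * μ ^ D) (gibbs r M D a) ⟩
      p ^ ν * μ ^ D * ((r + M) ^ (D + a) * (D ^ D * a ^ a))
        ≡⟨ cong₂ (λ x m → p ^ ν * μ ^ D * (x ^ m * (D ^ D * a ^ a))) (lem₂ g r) (+-comm D a) ⟩
      p ^ ν * μ ^ D * ((2 * h) ^ ν * (D ^ D * a ^ a))
        ≡⟨ cong₂ (λ x y → x * μ ^ D * (y * (D ^ D * a ^ a))) (^-distribˡ-+-* p a D) (^-distribˡ-+-* (2 * h) a D) ⟩
      p ^ a * p ^ D * μ ^ D * ((2 * h) ^ a * (2 * h) ^ D * (D ^ D * a ^ a))
        ≡⟨ lem₃ (p ^ a) (p ^ D) (μ ^ D) ((2 * h) ^ a) ((2 * h) ^ D) (D ^ D) (a ^ a) ⟩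
      p ^ a * (2 * h) ^ a * a ^ a * (μ ^ D * ((2 * h) ^ D * D ^ D * p ^ D))
        ≡⟨ cong₂ _*_ (trans (^-distribʳ-* a (p * (2 * h)) a) (cong (_* a ^ a) (^-distribʳ-* a p (2 * h))))
             (trans (^-distribʳ-* D μ (2 * h * D * p)) (cong (μ ^ D *_) (trans (^-distribʳ-* D (2 * h * D) p) (cong (_* p ^ D) (^-distribʳ-* D (2 * h) D))))) ⟨
      (p * (2 * h) * a) ^ a * (μ * (2 * h * D * p)) ^ D
        ≤⟨ *-mono-≤ (^-monoˡ-≤ a (≤-trans (≤-reflexive (lem₄ p h a)) hypA)) (^-monoˡ-≤ D hypB) ⟩
      (A * ν) ^ a * (B * (r * ν)) ^ D
        ≡⟨ cong₂ _*_ (^-distribʳ-* a A ν) (trans (^-distribʳ-* D B (r * ν)) (cong (B ^ D *_) (^-distribʳ-* D r ν))) ⟩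
      A ^ a * ν ^ a * (B ^ D * (r ^ D * ν ^ D))
        ≡⟨ lem₅ (A ^ a) (ν ^ a) (B ^ D) (r ^ D) (ν ^ D) ⟩
      A ^ a * B ^ D * (ν ^ a * ν ^ D * r ^ D)
        ≡⟨ cong (λ x → A ^ a * B ^ D * (x * r ^ D)) (^-distribˡ-+-* ν a D) ⟨
      A ^ a * B ^ D * (ν ^ ν * r ^ D) ∎)
      where
      ν h M : ℕ
      ν = a + D
      h = g + r
      M = g + h
      μ≤M : μ ≤ M
      μ≤M = ≤-trans (n≤1+n μ) (≤-reflexive M≡)
      lem₁ : ∀ p x y n r → p * (x * y) * (n * r) ≡ p * y * (r * x * n)
      lem₁ = solve-∀
      lem₂ : ∀ g r → r + (g + (g + r)) ≡ 2 * (g + r)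
      lem₂ = solve-∀
      lem₃ : ∀ pa pd m ha hd d a → pa * pd * m * (ha * hd * (d * a)) ≡ pa * ha * a * (m * (hd * d * pd))
      lem₃ = solve-∀
      lem₄ : ∀ p h a → p * (2 * h) * a ≡ 2 * p * h * a
      lem₄ = solve-∀
      lem₅ : ∀ A na B r nd → A * na * (B * (r * nd)) ≡ A * B * (na * nd * r)
      lem₅ = solve-∀

  least : ∀ {Q : ℕ → Set} → (∀ e → Dec (Q e)) → ∀ E → Q E →
          ∃[ e ] (e ≤ E × Q e × (e ≡ 0 ⊎ ∃[ e′ ] (e ≡ suc e′ × ¬ Q e′)))
  least Q? zero    q = 0 , z≤n , q , inj₁ refl
  least Q? (suc E) q with Q? E
  ... | yes p = let e , e≤E , rest = least Q? E p in e , m≤n⇒m≤1+n e≤E , rest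
  ... | no ¬p = suc E , ≤-refl , q , inj₂ (E , refl , ¬p)

  opaque
    -- `(1 + 1/μ) ^ (E+1) ≥ 1 + (E+1)/μ > n`. So exponents up to `M n` suffice for the powers of
    -- `μ / M` to get down to `1 / n`.
    dominate : ∀ μ n E → suc (μ * n) ≤ suc E → n * μ ^ suc E ≤ suc μ ^ suc E
    dominate μ n E le = begin
      n * (μ * μ ^ E)                      ≡⟨ lem n μ (μ ^ E) ⟩
      μ * n * (1 * μ ^ E)                  ≤⟨ *-monoˡ-≤ (1 * μ ^ E) (≤-trans (n≤1+n (μ * n)) le) ⟩
      suc E * (1 * μ ^ E)                  ≤⟨ m≤n+m _ (μ ^ suc E) ⟩
      μ ^ suc E + suc E * (1 * μ ^ E)      ≤⟨ bernoulli μ 1 E ⟩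
      (μ + 1) ^ suc E                      ≡⟨ cong (_^ suc E) (+-comm μ 1) ⟩
      suc μ ^ suc E                        ∎
      where
      lem : ∀ n μ p → n * (μ * p) ≡ μ * n * (1 * p)
      lem = solve-∀

-- The success probability of a single attempt

module Attempts where
  open Algorithm
  open Counting
  open RandomWalks
  open Starts
  open Rates
  open PowerInequalities
  open import Data.Nat.DivMod using (_/_; _%_; m/n*n≤m; m≡m%n+[m/n]*n; m%n<n)

  open ≤-Reasoning

  module _ (u g r s μ : ℕ) .⦃ _ : NonZero u ⦄ .⦃ _ : NonZero g ⦄ .⦃ _ : NonZero μ ⦄
    (2^s≡ : 2 ^ s ≡ suc μ) (M≡ : suc μ ≡ g + (g + r)) (kg≤M : suc (suc u) * g ≤ g + (g + r))
    {n : ℕ} (F : CNF n) (|F| : Is suc (suc u) -CNF F) (z₀ x : Assignment n) (F[x] : Satisfies F x) (T : ℕ) (8n≤T : 8 * n ≤ T) where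

    private
      k h M D a : ℕ
      k = suc (suc u)
      h = g + r
      M = g + h
      D = dH z₀ x
      a = agreements z₀ x

    open Sampling s μ 2^s≡

    gk≤2^s : g * k ≤ 2 ^ s
    gk≤2^s = ≤-trans (≤-reflexive (*-comm g k)) (≤-trans kg≤M (≤-reflexive (sym (trans 2^s≡ M≡))))

    module W Λ = Walks k s g h (trans 2^s≡ M≡) gk≤2^s F |F| z₀ x F[x] D Λ

    successes : ℕ → ℕ → ℕ
    successes e Λ = sum (attemptCode s n T e) (λ v → W.good Λ (candidate k s F z₀ T e v))

    total-sample : ∀ e m → total (sampleCode s e m) ≡ (suc μ ^ e * 2) ^ m
    total-sample e m = trans (cong (2 ^_) (*-comm m _)) (trans (sym (^-*-assoc 2 (size (dieCode s ^^ e) + 1) m))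
      (cong (_^ m) (trans (^-distribˡ-+-* 2 (size (dieCode s ^^ e)) 1) (cong (_* 2) (total-dice e)))))

    opaque
      -- By the triangle inequality the start is at distance at least `D - j` from `z₀`, so `j` of
      -- the tolerated loss is spent at the outset.
      walk-from : ∀ Λ y j → dH y x ≡ j →
        hitting g h T (Λ ∸ j) j ≤ sum (dieCode s ^^ T) (λ vs → W.good Λ (walk k F vs y))
      walk-from Λ y j refl with ≤-total (dH y x) Λ
      ... | inj₁ j≤Λ = W.walk-good Λ T (Λ ∸ dH y x) (dH y x) y (≤-reflexive (m+[n∸m]≡n j≤Λ)) (dH-triangle z₀ y x)
      ... | inj₂ Λ≤j with m≤n⇒m<n∨m≡n Λ≤j
      ...   | inj₂ Λ≡j = W.walk-good Λ T (Λ ∸ dH y x) (dH y x) y (≤-reflexive (m+[n∸m]≡n (≤-reflexive (sym Λ≡j)))) (dH-triangle z₀ y x)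
      ...   | inj₁ Λ<j = ≤-trans (≤-reflexive (too-far (dH y x) Λ<j)) z≤n
        where
        too-far : ∀ j → Λ < j → hitting g h T (Λ ∸ j) j ≡ 0
        too-far (suc j) (s≤s Λ≤j) rewrite m≤n⇒m∸n≡0 (m≤n⇒m≤1+n Λ≤j) = refl

    opaque
      -- The hypothesis `mean` is for Markov's inequality and `rate` bounds the mass from below.
      -- Read as fractions, the success probability is at least `(μ / 2h) ^ n / k`.
      successes-lower : ∀ e Λ → Λ ≤ T →
        2 * h * k * g * (a * (μ ^ e * M) + D * weightA e g h) ≤ suc u * (r * suc Λ) * (weightA e g h * M) →
        (suc μ ^ e * μ) ^ n ≤ weightA e g h ^ a * weightB e g h ^ D →
        total (attemptCode s n T e) * μ ^ n ≤ k * (2 * h) ^ n * successes e Λ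
      successes-lower e Λ Λ≤T mean rate = begin
        total (attemptCode s n T e) * μ ^ n
          ≡⟨ cong (_* μ ^ n) (trans (^-distribˡ-+-* 2 (size (sampleCode s e n)) (size (dieCode s ^^ T)))
               (cong₂ _*_ (trans (total-sample e n) (^-distribʳ-* n (suc μ ^ e) 2)) (trans (total-dice T) (cong (_^ T) M≡)))) ⟩
        (suc μ ^ e) ^ n * 2 ^ n * M ^ T * μ ^ n
          ≡⟨ lem₁ ((suc μ ^ e) ^ n) (2 ^ n) (M ^ T) (μ ^ n) ⟩
        2 ^ n * (M ^ T * ((suc μ ^ e) ^ n * μ ^ n))
          ≡⟨ cong (λ v → 2 ^ n * (M ^ T * v)) (^-distribʳ-* n (suc μ ^ e) μ) ⟨
        2 ^ n * (M ^ T * (suc μ ^ e * μ) ^ n)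
          ≤⟨ *-monoʳ-≤ (2 ^ n) (*-monoʳ-≤ (M ^ T) (≤-trans rate (≤-reflexive (sym (mass-form s μ 2^s≡ e g h z₀ x))))) ⟩
        2 ^ n * (M ^ T * mass e g h z₀ x)
          ≤⟨ *-monoʳ-≤ (2 ^ n) (markov (r * suc Λ) (suc u) h g (μ ^ e) M a D (weightA e g h) (weightB e g h) (M ^ T) (mass e g h z₀ x) (loss e g h z₀ x) (h ^ n * St)
               ⦃ m*n≢0 r (suc Λ) ⦃ r≢0 u g r kg≤M ⦄ ⦄ ⦃ A≢0 ⦄ ⦃ B≢0 ⦄ B≡ (loss-form s μ 2^s≡ e g h z₀ x) mean bound) ⟩
        2 ^ n * (k * (h ^ n * St))
          ≤⟨ *-monoʳ-≤ (2 ^ n) (*-monoʳ-≤ k (*-monoʳ-≤ (h ^ n) (sum-mono (sampleCode s e n) (λ v → walk-from Λ (sampleAll z₀ v) _ refl)))) ⟩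
        2 ^ n * (k * (h ^ n * successes e Λ))
          ≡⟨ lem₂ (2 ^ n) k (h ^ n) (successes e Λ) ⟩
        k * (2 ^ n * h ^ n) * successes e Λ
          ≡⟨ cong (λ v → k * v * successes e Λ) (^-distribʳ-* n 2 h) ⟨
        k * (2 * h) ^ n * successes e Λ ∎
        where
        P : ℕ → ℕ
        P j = hitting g h T (Λ ∸ j) j
        hyp : ∀ j → r * suc Λ * (g ^ j * M ^ T) ≤ r * suc Λ * (P j * h ^ j) + 2 * h * j * (g ^ j * M ^ T)
        hyp j = start-lower g r T Λ j Λ≤T
        St : ℕ
        St = starts e g h P (r * suc Λ) (2 * h) (M ^ T) hyp 0 z₀ x
        lem₁ : ∀ p t m q → p * t * m * q ≡ t * (m * (p * q))
        lem₁ = solve-∀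
        lem₂ : ∀ t k h i → t * (k * (h * i)) ≡ k * (t * h) * i
        lem₂ = solve-∀
        lem₃ : ∀ f g h → f * h + f * g ≡ f * (g + h)
        lem₃ = solve-∀
        B≡ : weightB e g h ≡ μ ^ e * M
        B≡ = lem₃ (μ ^ e) g h
        fg≢0 : NonZero (μ ^ e * g)
        fg≢0 = m*n≢0 (μ ^ e) g ⦃ m^n≢0 μ e ⦄
        A≢0 : NonZero (weightA e g h)
        A≢0 = >-nonZero (≤-trans (>-nonZero⁻¹ (μ ^ e * g) ⦃ fg≢0 ⦄) (m≤n+m (μ ^ e * g) _))
        B≢0 : NonZero (weightB e g h)
        B≢0 = >-nonZero (≤-trans (>-nonZero⁻¹ (μ ^ e * g) ⦃ fg≢0 ⦄) (m≤n+m (μ ^ e * g) _))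
        bound : r * suc Λ * M ^ T * mass e g h z₀ x ≤ r * suc Λ * (h ^ n * St) + 2 * h * M ^ T * loss e g h z₀ x
        bound = subst₂ _≤_ (cong (λ v → r * suc Λ * v * mass e g h z₀ x) (*-identityˡ (M ^ T)))
          (cong₂ (λ m v → r * suc Λ * (h ^ m * St) + 2 * h * v * loss e g h z₀ x) (+-identityʳ n) (*-identityˡ (M ^ T)))
          (starts-lower e g h P (r * suc Λ) (2 * h) (M ^ T) hyp 0 z₀ x)

    Success : Set
    Success = ∃[ e ] ∃[ Λ ] (e ≤ suc μ * n × (D ≡ 0 ⊎ Λ * (u * u) ≤ 4 * suc u * D) ×
      total (attemptCode s n T e) * μ ^ n ≤ k * (2 * h) ^ n * successes e Λ)

    private
      n≡ : n ≡ a + D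
      n≡ = sym (agreements+dH z₀ x)

    A₀≡ : weightA 0 g h ≡ M
    A₀≡ = lem g h
      where
      lem : ∀ g h → (2 * 0 + 1) * h + 1 * g ≡ g + h
      lem = solve-∀

    B₀≡ : weightB 0 g h ≡ M
    B₀≡ = lem g h
      where
      lem : ∀ g h → 1 * h + 1 * g ≡ g + h
      lem = solve-∀

    opaque
      rate₀ : (1 * μ) ^ n ≤ weightA 0 g h ^ a * weightB 0 g h ^ D
      rate₀ = subst₂ (λ A B → (1 * μ) ^ n ≤ A ^ a * B ^ D) (sym A₀≡) (sym B₀≡) (≤-trans
        (^-monoˡ-≤ n (≤-trans (≤-reflexive (*-identityˡ μ)) (≤-trans (n≤1+n μ) (≤-reflexive M≡))))
        (≤-reflexive (trans (cong (M ^_) n≡) (^-distribˡ-+-* M a D))))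

    opaque
      -- Every satisfying assignment is far enough now, so the whole walk may be used: `Λ = T`, with
      -- all variables free.
      success-at-0 : D ≡ 0 → Success
      success-at-0 D≡0 = 0 , T , z≤n , inj₁ D≡0 , successes-lower 0 T ≤-refl
        (subst₂ (λ A d → 2 * h * k * g * (a * (1 * M) + d * A) ≤ suc u * (r * suc T) * (A * M)) (sym A₀≡) (sym D≡0)
          (mean-bound₀ u g r kg≤M a (suc T) (≤-trans (*-monoʳ-≤ 4 (≤-trans (m≤m+n a D) (≤-reflexive (sym n≡))))
            (≤-trans (*-monoˡ-≤ n (s≤s (s≤s (s≤s (s≤s (z≤n {4})))))) (≤-trans 8n≤T (n≤1+n T)))))) rate₀

    private
      -- The loss that the approximation ratio allows, rounded down. The threshold in Markov's
      -- inequality is `Λ + 1`, which is not below the exact value.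
      Λ : ℕ
      Λ = _/_ (4 * suc u * D) (u * u) ⦃ m*n≢0 u u ⦄

    opaque
      Λ-upper : Λ * (u * u) ≤ 4 * suc u * D
      Λ-upper = m/n*n≤m (4 * suc u * D) (u * u) ⦃ m*n≢0 u u ⦄

    opaque
      Λ-lower : 4 * suc u * D ≤ suc Λ * (u * u)
      Λ-lower = ≤-trans (≤-reflexive (m≡m%n+[m/n]*n (4 * suc u * D) (u * u) ⦃ m*n≢0 u u ⦄))
        (+-monoˡ-≤ (Λ * (u * u)) (<⇒≤ (m%n<n (4 * suc u * D) (u * u) ⦃ m*n≢0 u u ⦄)))

    opaque
      -- `4 (u+1) / u² ≤ 8` for `u ≥ 1`; this is where the `8 n` steps of the walk come from.
      Λ≤T : Λ ≤ T
      Λ≤T = *-cancel-≤ (u * u) ⦃ m*n≢0 u u ⦄ (begin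
        Λ * (u * u)           ≤⟨ Λ-upper ⟩
        4 * suc u * D         ≤⟨ *-monoˡ-≤ D (*-monoʳ-≤ 4 (+-monoˡ-≤ u (>-nonZero⁻¹ u))) ⟩
        4 * (u + u) * D       ≡⟨ lem u D ⟩
        8 * D * (1 * u)       ≤⟨ *-monoʳ-≤ (8 * D) (*-monoˡ-≤ u (>-nonZero⁻¹ u)) ⟩
        8 * D * (u * u)       ≤⟨ *-monoˡ-≤ (u * u) (≤-trans (*-monoʳ-≤ 8 (≤-trans (m≤n+m D a) (≤-reflexive (sym n≡)))) 8n≤T) ⟩
        T * (u * u)           ∎)
        where
        lem : ∀ u D → 4 * (u + u) * D ≡ 8 * D * (1 * u)
        lem = solve-∀

    opaque
      -- The ideal ν = `2 h D / (r n)` is at least 1, so all variables are free. Then `A = M`, and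
      -- the balance `a r ≤ M D` is another form of the hypothesis.
      success-dense : r * n ≤ 2 * h * D → Success
      success-dense dense = 0 , Λ , z≤n , inj₂ Λ-upper , successes-lower 0 Λ Λ≤T
        (mean-bound u g r kg≤M a D 1 (weightA 0 g h) (suc Λ) Λ-lower (subst (λ A → a * 1 * r ≤ A * D) (sym A₀≡)
          (+-cancelʳ-≤ (r * D) _ _ (≤-trans (≤-reflexive (lem₁ a r D)) (≤-trans (≤-reflexive (cong (r *_) (sym n≡))) (≤-trans dense (≤-reflexive (lem₂ g r D)))))))) rate₀
        where
        lem₁ : ∀ a r D → a * 1 * r + r * D ≡ r * (a + D)
        lem₁ = solve-∀
        lem₂ : ∀ g r D → 2 * (g + r) * D ≡ (g + (g + r)) * D + r * D
        lem₂ = solve-∀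

    opaque
      -- `e` is the least exponent with `(μ / M) ^ e ≤ 2 h D / (r n)`. This upper bound on ν yields
      -- `agree` and `few`; minimality yields the lower bound `disagree` up to a factor `μ / M`, the
      -- reason why the base contains `μ` and not `M`.
      success-sparse : .⦃ _ : NonZero D ⦄ → 2 * h * D ≤ r * n → Success
      success-sparse sparse = e , Λ , e≤ , inj₂ Λ-upper , successes-lower e Λ Λ≤T
        (mean-bound u g r kg≤M a D (μ ^ e) (weightA e g h) (suc Λ) Λ-lower few)
        (subst (λ m → (suc μ ^ e * μ) ^ m ≤ weightA e g h ^ a * weightB e g h ^ D) (sym n≡)
          (rate a D g r μ (suc μ ^ e) (weightA e g h) (weightB e g h) ⦃ subst NonZero n≡ n≢0 ⦄ ⦃ r≢0 u g r kg≤M ⦄ M≡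
            (subst (λ m → 2 * suc μ ^ e * h * a ≤ weightA e g h * m) n≡ agree)
            (subst (λ m → μ * (2 * h * D * suc μ ^ e) ≤ weightB e g h * (r * m)) n≡ disagree)))
        where
        Q : ℕ → Set
        Q e = μ ^ e * (r * n) ≤ 2 * h * D * suc μ ^ e
        n≢0 : NonZero n
        n≢0 = >-nonZero (≤-trans (>-nonZero⁻¹ D) (≤-trans (m≤n+m D a) (≤-reflexive (sym n≡))))
        E : ℕ
        E = suc μ * n
        Q[E] : Q E
        Q[E] = subst Q (suc-pred E ⦃ E≢0 ⦄) (begin
          μ ^ suc E′ * (r * n)          ≡⟨ lem₁ (μ ^ suc E′) r n ⟩
          r * (n * μ ^ suc E′)          ≤⟨ *-mono-≤ r≤ (dominate μ n E′ (≤-trans (+-monoˡ-≤ (μ * n) (>-nonZero⁻¹ n ⦃ n≢0 ⦄)) (≤-reflexive (sym (suc-pred E ⦃ E≢0 ⦄))))) ⟩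
          2 * h * D * suc μ ^ suc E′    ∎)
          where
          E≢0 : NonZero E
          E≢0 = m*n≢0 (suc μ) n ⦃ _ ⦄ ⦃ n≢0 ⦄
          E′ : ℕ
          E′ = pred E
          lem₁ : ∀ p r n → p * (r * n) ≡ r * (n * p)
          lem₁ = solve-∀
          lem₂ : ∀ g r → 2 * (g + r) * 1 ≡ r + (g + (g + r))
          lem₂ = solve-∀
          r≤ : r ≤ 2 * h * D
          r≤ = ≤-trans (m≤m+n r M) (≤-trans (≤-reflexive (sym (lem₂ g r))) (*-monoʳ-≤ (2 * h) (>-nonZero⁻¹ D)))
        search : ∃[ e ] (e ≤ E × Q e × (e ≡ 0 ⊎ ∃[ e′ ] (e ≡ suc e′ × ¬ Q e′)))
        search = least (λ e → μ ^ e * (r * n) ≤? 2 * h * D * suc μ ^ e) E Q[E]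
        e : ℕ
        e = proj₁ search
        e≤ : e ≤ E
        e≤ = proj₁ (proj₂ search)
        q : Q e
        q = proj₁ (proj₂ (proj₂ search))
        agree : 2 * suc μ ^ e * h * a ≤ weightA e g h * n
        agree = +-cancelʳ-≤ (2 * h * D * suc μ ^ e) _ _ (begin
          2 * suc μ ^ e * h * a + 2 * h * D * suc μ ^ e       ≡⟨ lem₁ (suc μ ^ e) h a D ⟩
          2 * suc μ ^ e * h * (a + D)                         ≡⟨ cong₂ (λ p m → 2 * p * h * m) (sym (fixed+free μ e)) (sym n≡) ⟩
          2 * (c e + μ ^ e) * h * n                           ≡⟨ lem₂ (c e) (μ ^ e) g r n ⟩
          weightA e g h * n + μ ^ e * (r * n)                 ≤⟨ +-monoʳ-≤ (weightA e g h * n) q ⟩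
          weightA e g h * n + 2 * h * D * suc μ ^ e           ∎)
          where
          lem₁ : ∀ p h a D → 2 * p * h * a + 2 * h * D * p ≡ 2 * p * h * (a + D)
          lem₁ = solve-∀
          lem₂ : ∀ c f g r n → 2 * (c + f) * (g + r) * n ≡ ((2 * c + f) * (g + r) + f * g) * n + f * (r * n)
          lem₂ = solve-∀
        disagree : μ * (2 * h * D * suc μ ^ e) ≤ weightB e g h * (r * n)
        disagree with proj₂ (proj₂ (proj₂ search))
        ... | inj₁ e≡0 = subst (λ e → μ * (2 * h * D * suc μ ^ e) ≤ weightB e g h * (r * n)) (sym e≡0) (begin
          μ * (2 * h * D * 1)                ≡⟨ cong (μ *_) (*-identityʳ (2 * h * D)) ⟩
          μ * (2 * h * D)                    ≤⟨ *-mono-≤ (≤-trans (n≤1+n μ) (≤-reflexive M≡)) sparse ⟩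
          M * (r * n)                        ≡⟨ cong (_* (r * n)) B₀≡ ⟨
          weightB 0 g h * (r * n)            ∎)
        ... | inj₂ (e′ , e≡ , ¬q) = subst (λ e → μ * (2 * h * D * suc μ ^ e) ≤ weightB e g h * (r * n)) (sym e≡) (begin
          μ * (2 * h * D * (suc μ * suc μ ^ e′))  ≡⟨ lem₁ μ (suc μ) (2 * h * D) (suc μ ^ e′) ⟩
          μ * suc μ * (2 * h * D * suc μ ^ e′)    ≤⟨ *-monoʳ-≤ (μ * suc μ) (<⇒≤ (≰⇒> ¬q)) ⟩
          μ * suc μ * (μ ^ e′ * (r * n))          ≡⟨ cong (λ M → μ * M * (μ ^ e′ * (r * n))) M≡ ⟩
          μ * M * (μ ^ e′ * (r * n))              ≡⟨ lem₂ μ g h (μ ^ e′) (r * n) ⟩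
          weightB (suc e′) g h * (r * n)          ∎)
          where
          lem₁ : ∀ μ M x p → μ * (x * (M * p)) ≡ μ * M * (x * p)
          lem₁ = solve-∀
          lem₂ : ∀ μ g h p x → μ * (g + h) * (p * x) ≡ (μ * p * h + μ * p * g) * x
          lem₂ = solve-∀
        few : a * μ ^ e * r ≤ weightA e g h * D
        few = *-cancel-≤ n ⦃ n≢0 ⦄ (begin
          a * μ ^ e * r * n                       ≡⟨ lem₁ a (μ ^ e) r n ⟩
          a * (μ ^ e * (r * n))                   ≤⟨ *-monoʳ-≤ a q ⟩
          a * (2 * h * D * suc μ ^ e)             ≡⟨ lem₂ a h D (suc μ ^ e) ⟩
          2 * suc μ ^ e * h * a * D               ≤⟨ *-monoˡ-≤ D agree ⟩
          weightA e g h * n * D                   ≡⟨ lem₃ (weightA e g h) n D ⟩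
          weightA e g h * D * n                   ∎)
          where
          lem₁ : ∀ a f r n → a * f * r * n ≡ a * (f * (r * n))
          lem₁ = solve-∀
          lem₂ : ∀ a h D p → a * (2 * h * D * p) ≡ 2 * p * h * a * D
          lem₂ = solve-∀
          lem₃ : ∀ A n D → A * n * D ≡ A * D * n
          lem₃ = solve-∀

    -- The expected fraction μ^e / M^e of unfixed variables should be min(1, (2h/r)(D/n)).
    opaque
      success : Success
      success = choose (D ≟ 0) (≤-total (r * n) (2 * h * D))
        where
        choose : Dec (D ≡ 0) → (r * n ≤ 2 * h * D) ⊎ (2 * h * D ≤ r * n) → Success
        choose (yes D≡0) _             = success-at-0 D≡0
        choose (no D≢0)  (inj₁ dense)  = success-dense dense
        choose (no D≢0)  (inj₂ sparse) = success-sparse ⦃ ≢-nonZero D≢0 ⦄ sparse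

-- Keeping the best candidate and repeating rounds

module Amplification where
  open Algorithm
  open Counting
  open RandomWalks
  open PowerInequalities
  open import Data.List.Relation.Unary.All using (All)

  open ≤-Reasoning

  module Keeping (k s : ℕ) .⦃ _ : NonZero k ⦄ {n : ℕ} (F : CNF n) (z : Assignment n) (T : ℕ) (nonEmpty : All (_≢ []) F)
    (Good : Assignment n → Set) (good? : ∀ w → Dec (Good w)) (good⇒sat : ∀ {w} → Good w → Satisfies F w)
    (farther : ∀ {w w′} → Good w → Satisfies F w′ → dH z w ≤ dH z w′ → Good w′) where

    Consistent GoodBest : Best n → Set
    Consistent (w , m) = m ≡ 0 ⊎ (Satisfies F w × m ≡ suc (dH z w))
    GoodBest   (w , m) = Good w × m ≡ suc (dH z w)

    update-consistent : ∀ y best → Satisfies F y → Consistent best → Consistent (update z y best)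
    update-consistent y (w , m) sat con with suc (dH z y) ∸ m
    ... | zero  = con
    ... | suc _ = inj₂ (sat , refl)

    update-keeps : ∀ y best → Satisfies F y → GoodBest best → GoodBest (update z y best)
    update-keeps y (w , m) sat (good , refl) with dH z y ∸ dH z w in eq
    ... | zero  = good , refl
    ... | suc _ = farther good sat (<⇒≤ (m∸n≢0⇒n<m λ eq′ → contradiction (trans (sym eq) eq′) λ ())) , refl

    update-gains : ∀ y best → Good y → Consistent best → GoodBest (update z y best)
    update-gains y (w , m) good con with suc (dH z y) ∸ m in eq
    ... | suc _ = good , refl
    ... | zero with con
    ...   | inj₁ refl         = contradiction eq λ ()
    ...   | inj₂ (sat , refl) = farther good sat (m∸n≡0⇒m≤n eq) , refl

    check-consistent : ∀ y best → Consistent best → Consistent (check F z y best)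
    check-consistent y best con with lastFalsified y F [] in eq
    ... | []    = update-consistent y best (proj₂ (lastFalsified⇒satisfied y F [] nonEmpty eq)) con
    ... | _ ∷ _ = con

    check-keeps : ∀ y best → GoodBest best → GoodBest (check F z y best)
    check-keeps y best good with lastFalsified y F [] in eq
    ... | []    = update-keeps y best (proj₂ (lastFalsified⇒satisfied y F [] nonEmpty eq)) good
    ... | _ ∷ _ = good

    check-gains : ∀ y best → Good y → Consistent best → GoodBest (check F z y best)
    check-gains y best good con with lastFalsified y F [] in eq
    ... | []    = update-gains y best good con
    ... | _ ∷ _ = contradiction (trans (sym eq) (satisfied⇒lastFalsified y [] (good⇒sat good))) λ ()

    good : Assignment n → ℕ
    good w = indicator (good? w)

    anyGood : ∀ e c → El (roundCode s n T e c) → ℕ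
    anyGood e zero    x       = 0
    anyGood e (suc c) (x , r) = good (candidate k s F z T e x) ⊔ anyGood (suc e) c r

    good≤1 : ∀ w → good w ≤ 1
    good≤1 w with good? w
    ... | yes _ = ≤-refl
    ... | no  _ = z≤n

    anyGood≤1 : ∀ e c x → anyGood e c x ≤ 1
    anyGood≤1 e zero    x       = z≤n
    anyGood≤1 e (suc c) (x , r) = ⊔-lub (good≤1 (candidate k s F z T e x)) (anyGood≤1 (suc e) c r)

    round-keeps : ∀ e c x best → GoodBest best → GoodBest (round k s F z T e c x best)
    round-keeps e zero    x       best good = good
    round-keeps e (suc c) (x , r) best good = round-keeps (suc e) c r _ (check-keeps (candidate k s F z T e x) best good)

    round-consistent : ∀ e c x best → Consistent best → Consistent (round k s F z T e c x best)
    round-consistent e zero    x       best con = con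
    round-consistent e (suc c) (x , r) best con = round-consistent (suc e) c r _ (check-consistent (candidate k s F z T e x) best con)

    -- Failure is expressed by the candidates alone, so it can be counted independently of `best`.
    -- Once a good candidate is recorded, it is replaced only by better ones.
    round-gains : ∀ e c x best → Consistent best → anyGood e c x ≡ 0 ⊎ GoodBest (round k s F z T e c x best)
    round-gains e zero    x       best con = inj₁ refl
    round-gains e (suc c) (x , r) best con with good? (candidate k s F z T e x)
    ... | yes p = inj₂ (round-keeps (suc e) c r _ (check-gains (candidate k s F z T e x) best p con))
    ... | no _  = round-gains (suc e) c r _ (check-consistent (candidate k s F z T e x) best con)

    module _ (e c : ℕ) where

      allBad : ∀ {R} → Vec (El (roundCode s n T e c)) R → ℕ
      allBad []       = 1
      allBad (x ∷ xs) = (1 ∸ anyGood e c x) * allBad xs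

      rounds-keeps : ∀ {R} (xs : Vec (El (roundCode s n T e c)) R) best → GoodBest best → GoodBest (rounds k s F z T e c xs best)
      rounds-keeps []       best good = good
      rounds-keeps (x ∷ xs) best good = rounds-keeps xs _ (round-keeps e c x best good)

      rounds-gains : ∀ {R} (xs : Vec (El (roundCode s n T e c)) R) best → Consistent best →
                     allBad xs ≡ 1 ⊎ GoodBest (rounds k s F z T e c xs best)
      rounds-gains []       best con = inj₁ refl
      rounds-gains (x ∷ xs) best con with round-gains e c x best con
      ... | inj₂ good = inj₂ (rounds-keeps xs _ good)
      ... | inj₁ bad with rounds-gains xs _ (round-consistent e c x best con)
      ...   | inj₂ good = inj₂ good
      ...   | inj₁ bads = inj₁ (cong₂ (λ u v → (1 ∸ u) * v) bad bads)

      badCount goodCount : ℕ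
      badCount  = sum (roundCode s n T e c) (λ x → 1 ∸ anyGood e c x)
      goodCount = sum (roundCode s n T e c) (anyGood e c)

      opaque
        bad+good : badCount + goodCount ≡ total (roundCode s n T e c)
        bad+good = trans (sym (sum-+ (roundCode s n T e c) (λ x → 1 ∸ anyGood e c x) (anyGood e c)))
          (trans (sum-cong (roundCode s n T e c) λ x → m∸n+n≡m (anyGood≤1 e c x)) (trans (sum-const (roundCode s n T e c) 1) (*-identityʳ _)))

      opaque
        sum-allBad : ∀ R → sum (roundCode s n T e c ^^ R) allBad ≡ badCount ^ R
        sum-allBad zero    = refl
        sum-allBad (suc R) = trans (sum-cong (roundCode s n T e c) λ x → sum-* (roundCode s n T e c ^^ R) (1 ∸ anyGood e c x) allBad)
          (trans (sum-*ʳ (roundCode s n T e c) (sum (roundCode s n T e c ^^ R) allBad) (λ x → 1 ∸ anyGood e c x))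
            (cong (badCount *_) (sum-allBad R)))

    opaque
      -- The attempt with the right exponent `e*` occurs in every round and alone gives the round
      -- its success probability of at least `1 / R`; all other random choices are independent of
      -- it.
      goodCount-lower : ∀ e* R e c → e ≤ e* → e* < e + c →
        total (attemptCode s n T e*) ≤ sum (attemptCode s n T e*) (λ v → good (candidate k s F z T e* v)) * R →
        total (roundCode s n T e c) ≤ goodCount e c * R
      goodCount-lower e* R e zero    e≤ e*< hyp = contradiction (≤-trans e*< (≤-reflexive (+-identityʳ e))) (≤⇒≯ e≤)
      goodCount-lower e* R e (suc c) e≤ e*< hyp with m≤n⇒m<n∨m≡n e≤
      ... | inj₂ refl = begin
        total (attemptCode s n T e ⊗ rest)             ≡⟨ ^-distribˡ-+-* 2 (size (attemptCode s n T e)) (size rest) ⟩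
        total (attemptCode s n T e) * total rest       ≤⟨ *-monoˡ-≤ (total rest) hyp ⟩
        G * R * total rest                             ≡⟨ lem G R (total rest) ⟩
        G * total rest * R                             ≡⟨ cong (_* R) (sym (trans (sum-cong (attemptCode s n T e) λ v → trans (sum-const rest (gd v)) (*-comm (total rest) (gd v)))
                                                            (sum-*ʳ (attemptCode s n T e) (total rest) gd))) ⟩
        sum (attemptCode s n T e) (λ v → sum rest λ _ → gd v) * R
          ≤⟨ *-monoˡ-≤ R (sum-mono (attemptCode s n T e) λ v → sum-mono rest λ r → m≤m⊔n (gd v) (anyGood (suc e) c r)) ⟩
        goodCount e (suc c) * R                        ∎
        where
        rest : Code
        rest = roundCode s n T (suc e) c
        gd : El (attemptCode s n T e) → ℕ
        gd v = good (candidate k s F z T e v)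
        G : ℕ
        G = sum (attemptCode s n T e) gd
        lem : ∀ a b c → a * b * c ≡ a * c * b
        lem = solve-∀
      ... | inj₁ e< = begin
        total (attemptCode s n T e ⊗ rest)             ≡⟨ ^-distribˡ-+-* 2 (size (attemptCode s n T e)) (size rest) ⟩
        total (attemptCode s n T e) * total rest       ≤⟨ *-monoʳ-≤ (total (attemptCode s n T e)) (goodCount-lower e* R (suc e) c e< (≤-trans e*< (≤-reflexive (+-suc e c))) hyp) ⟩
        total (attemptCode s n T e) * (goodCount (suc e) c * R) ≡⟨ *-assoc (total (attemptCode s n T e)) (goodCount (suc e) c) R ⟨
        total (attemptCode s n T e) * goodCount (suc e) c * R   ≡⟨ cong (_* R) (sum-const (attemptCode s n T e) (goodCount (suc e) c)) ⟨
        sum (attemptCode s n T e) (λ _ → goodCount (suc e) c) * R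
          ≤⟨ *-monoˡ-≤ R (sum-mono (attemptCode s n T e) λ v → sum-mono rest λ r → m≤n⊔m (good (candidate k s F z T e v)) (anyGood (suc e) c r)) ⟩
        goodCount e (suc c) * R                        ∎
        where
        rest : Code
        rest = roundCode s n T (suc e) c

  opaque
    -- `(1 + w/b) ^ R ≥ 1 + R w / b ≥ 2`: with a success probability of at least `1 / R`, all of `R`
    -- rounds fail with probability at most 1/2.
    halving : ∀ b w R → NonZero (b + w) → b + w ≤ w * R → b ^ R * 2 ≤ (b + w) ^ R
    halving b w zero    nz le = contradiction (≤-trans (>-nonZero⁻¹ (b + w) ⦃ nz ⦄) (≤-trans le (≤-reflexive (*-zeroʳ w)))) λ ()
    halving b w (suc R) nz le = ≤-trans (≤-reflexive (lem (b ^ suc R))) (≤-trans (+-monoʳ-≤ (b ^ suc R) (begin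
      b * b ^ R               ≤⟨ *-monoˡ-≤ (b ^ R) (≤-trans (m≤m+n b w) le) ⟩
      w * suc R * b ^ R       ≡⟨ lem₂ w (suc R) (b ^ R) ⟩
      suc R * (w * b ^ R)     ∎)) (bernoulli b w R))
      where
      lem : ∀ x → x * 2 ≡ x + x
      lem = solve-∀
      lem₂ : ∀ w r p → w * r * p ≡ r * (w * p)
      lem₂ = solve-∀

  opaque
    -- `n + 1` batches of `R` rounds fail with probability at most `2 ^ -(n+1)`; `S` counts the
    -- favourable outcomes among `N`.
    amplification : ∀ b w R n S → NonZero (b + w) → b + w ≤ w * R → let N = (b + w) ^ (R * suc n) in
      N ≤ S + b ^ (R * suc n) → 2 ^ n * N ≤ 2 ^ n * S + N
    amplification b w R n S nz le hyp = begin
      2 ^ n * N                                  ≤⟨ *-monoʳ-≤ (2 ^ n) hyp ⟩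
      2 ^ n * (S + b ^ (R * suc n))              ≡⟨ *-distribˡ-+ (2 ^ n) S (b ^ (R * suc n)) ⟩
      2 ^ n * S + 2 ^ n * b ^ (R * suc n)        ≤⟨ +-monoʳ-≤ (2 ^ n * S) rare ⟩
      2 ^ n * S + N                              ∎
      where
      N : ℕ
      N = (b + w) ^ (R * suc n)
      rare : 2 ^ n * b ^ (R * suc n) ≤ N
      rare = begin
        2 ^ n * b ^ (R * suc n)                  ≤⟨ *-monoˡ-≤ (b ^ (R * suc n)) (m≤m+n (2 ^ n) (2 ^ n + 0)) ⟩
        2 ^ suc n * b ^ (R * suc n)              ≡⟨ cong (2 ^ suc n *_) (^-*-assoc b R (suc n)) ⟨
        2 ^ suc n * (b ^ R) ^ suc n              ≡⟨ *-comm (2 ^ suc n) _ ⟩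
        (b ^ R) ^ suc n * 2 ^ suc n              ≡⟨ ^-distribʳ-* (suc n) (b ^ R) 2 ⟨
        (b ^ R * 2) ^ suc n                      ≤⟨ ^-monoˡ-≤ (suc n) (halving b w R nz le) ⟩
        ((b + w) ^ R) ^ suc n                    ≡⟨ ^-*-assoc (b + w) R (suc n) ⟩
        (b + w) ^ (R * suc n)                    ∎

  opaque
    -- Transfers the bound between two uniform spaces in which the event has the same probability,
    -- `X / t = s / z`.
    rescale : ∀ z t p s X → z * X ≡ t * s → p * z ≤ p * s + z → .⦃ _ : NonZero z ⦄ → p * t ≤ p * X + t
    rescale z t p s X eq le = *-cancel-≤ z (begin
      p * t * z                ≡⟨ lem₁ p t z ⟩
      t * (p * z)              ≤⟨ *-monoʳ-≤ t le ⟩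
      t * (p * s + z)          ≡⟨ lem₂ t p s z ⟩
      p * (t * s) + t * z      ≡⟨ cong (λ v → p * v + t * z) eq ⟨
      p * (z * X) + t * z      ≡⟨ lem₃ p z X t ⟩
      (p * X + t) * z          ∎)
      where
      lem₁ : ∀ p t z → p * t * z ≡ t * (p * z)
      lem₁ = solve-∀
      lem₂ : ∀ t p s z → t * (p * s + z) ≡ p * (t * s) + t * z
      lem₂ = solve-∀
      lem₃ : ∀ p z X t → p * (z * X) + t * z ≡ (p * X + t) * z
      lem₃ = solve-∀

  opaque
    -- The case `D ≡ 0` stands apart, because `Λ` is then not limited by `D`.
    far-enough : ∀ D d Λ u → D ≤ d + Λ → D ≡ 0 ⊎ Λ * (u * u) ≤ 4 * suc u * D → D * u ^ 2 ≤ d * u ^ 2 + 4 * suc u * D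
    far-enough D d Λ u le (inj₁ refl) = z≤n
    far-enough D d Λ u le (inj₂ Λ≤) = begin
      D * u ^ 2                    ≤⟨ *-monoˡ-≤ (u ^ 2) le ⟩
      (d + Λ) * u ^ 2              ≡⟨ lem d Λ u ⟩
      d * u ^ 2 + Λ * (u * u)      ≤⟨ +-monoʳ-≤ (d * u ^ 2) Λ≤ ⟩
      d * u ^ 2 + 4 * suc u * D    ∎
      where
      lem : ∀ d l u → (d + l) * (u * (u * 1)) ≡ d * (u * (u * 1)) + l * (u * u)
      lem = solve-∀

-- The dice and the base of the exponential

module Parameterization where
  open PowerInequalities
  open LogTwoPowers
  open LogTwo
  open Counters
  open import Data.Integer.Base using (+_)
  open import Data.Nat.DivMod using (_/_; _%_; m/n*n≤m; m≡m%n+[m/n]*n; m%n<n)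
  open import Data.Rational.Base as ℚ using (ℚ)

  open ≤-Reasoning

  opaque
    n<2^n : ∀ n → n < 2 ^ n
    n<2^n zero    = s≤s z≤n
    n<2^n (suc n) = ≤-trans (+-mono-≤ (m^n>0 2 n) (n<2^n n)) (≤-reflexive (cong (λ m → 2 ^ n + m) (sym (+-identityʳ (2 ^ n)))))

  -- A die has M = 2 ^ s sides, and each of k slots gets g = ⌊M / k⌋ of them; M ≥ 8 k² makes this precise enough.
  record Parameters (u : ℕ) : Set where
    field
      s g r μ : ℕ
      ⦃ g≢0 ⦄ : NonZero g
      ⦃ μ≢0 ⦄ : NonZero μ
      2^s≡    : 2 ^ s ≡ suc μ
      M≡      : suc μ ≡ g + (g + r)
      kg≤M    : suc (suc u) * g ≤ g + (g + r)
      -- In fractions `h / μ ≤ (1 - 1/2k)²`, written with `2k - 1` and `2k`.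
      precise : (g + r) * (suc (suc (2 * suc u)) ^ 2) ≤ suc (2 * suc u) ^ 2 * μ

  opaque
    -- `(1 - 1/2k)²` exceeds `1 - 1/k` by `1/4k²`, which gains `M / 4k² ≥ 2` sides. Rounding `g`
    -- down costs at most one side, and replacing `M` by `μ` costs at most another.
    precision : ∀ k κ g h μ → suc κ ≡ 2 * k → suc μ ≡ g + h → suc μ ≤ g * k + k → 8 * (k * k) ≤ suc μ →
      h * suc κ ^ 2 ≤ κ ^ 2 * μ
    precision k κ g h μ K≡ M≡ M≤ 8kk≤M = ≤-cancel (K * K * g + κ * κ) (trans (lem₁ h K g κ) (cong (λ M → K * K * M + κ * κ) (sym M≡)))
      (lem₂ κ μ (K * K * g))
      (≤-trans (≤-reflexive (lem₃ κ (suc μ))) (+-monoʳ-≤ (κ * κ * suc μ) (+-cancelʳ-≤ (K * K) _ _ (begin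
        (2 * κ + 1) * suc μ + κ * κ + K * K        ≡⟨ +-assoc ((2 * κ + 1) * suc μ) (κ * κ) (K * K) ⟩
        (2 * κ + 1) * suc μ + (κ * κ + K * K)      ≤⟨ +-monoʳ-≤ ((2 * κ + 1) * suc μ) (≤-trans (+-monoˡ-≤ (K * K) (*-mono-≤ (n≤1+n κ) (n≤1+n κ)))
                                                        (≤-trans (≤-reflexive (trans (cong (λ K → K * K + K * K) K≡) (lem₄ k))) 8kk≤M)) ⟩
        (2 * κ + 1) * suc μ + suc μ                ≡⟨ lem₅ κ (suc μ) ⟩
        2 * suc κ * suc μ                          ≡⟨ cong (λ K → 2 * K * suc μ) K≡ ⟩
        2 * (2 * k) * suc μ                        ≤⟨ *-monoʳ-≤ (2 * (2 * k)) M≤ ⟩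
        2 * (2 * k) * (g * k + k)                  ≡⟨ lem₆ k g ⟩
        2 * k * (2 * k) * g + 2 * k * (2 * k)      ≡⟨ cong (λ K → K * K * g + K * K) K≡ ⟨
        K * K * g + K * K                          ∎))))
      where
      K : ℕ
      K = suc κ
      lem₁ : ∀ h K g κ → h * (K * (K * 1)) + (K * K * g + κ * κ) ≡ K * K * (g + h) + κ * κ
      lem₁ = solve-∀
      lem₂ : ∀ κ μ x → κ * (κ * 1) * μ + (x + κ * κ) ≡ κ * κ * suc μ + x
      lem₂ = solve-∀
      lem₃ : ∀ κ M → suc κ * suc κ * M + κ * κ ≡ κ * κ * M + ((2 * κ + 1) * M + κ * κ)
      lem₃ = solve-∀
      lem₄ : ∀ k → 2 * k * (2 * k) + 2 * k * (2 * k) ≡ 8 * (k * k)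
      lem₄ = solve-∀
      lem₅ : ∀ κ M → (2 * κ + 1) * M + M ≡ 2 * suc κ * M
      lem₅ = solve-∀
      lem₆ : ∀ k g → 2 * (2 * k) * (g * k + k) ≡ 2 * k * (2 * k) * g + 2 * k * (2 * k)
      lem₆ = solve-∀

  opaque
    quotient-pos : ∀ g k M .⦃ _ : NonZero k ⦄ → 8 * (k * k) ≤ M → M ≤ g * k + k → NonZero g
    quotient-pos (suc g) k M 8kk≤M M≤ = _
    quotient-pos zero    k M 8kk≤M M≤ = contradiction (≤-trans 8kk≤M M≤) (<⇒≱ (begin-strict
      k                <⟨ m<m+n k (>-nonZero⁻¹ k) ⟩
      k + k            ≤⟨ m≤m+n (k + k) (6 * k) ⟩
      k + k + 6 * k    ≡⟨ lem k ⟩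
      8 * (1 * k)      ≤⟨ *-monoʳ-≤ 8 (*-monoˡ-≤ k (>-nonZero⁻¹ k)) ⟩
      8 * (k * k)      ∎))
      where
      lem : ∀ k → k + k + 6 * k ≡ 8 * (1 * k)
      lem = solve-∀

  opaque
    dice : ∀ k → 8 * (k * k) ≤ 2 ^ (3 + (k + k))
    dice k = begin
      8 * (k * k)             ≤⟨ *-monoʳ-≤ 8 (*-mono-≤ (<⇒≤ (n<2^n k)) (<⇒≤ (n<2^n k))) ⟩
      2 ^ 3 * (2 ^ k * 2 ^ k) ≡⟨ cong (2 ^ 3 *_) (^-distribˡ-+-* 2 k k) ⟨
      2 ^ 3 * 2 ^ (k + k)     ≡⟨ ^-distribˡ-+-* 2 3 (k + k) ⟨
      2 ^ (3 + (k + k))       ∎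

  opaque
    parameters-from : ∀ u s M .⦃ _ : NonZero M ⦄ → 2 ^ s ≡ M → 8 * (suc (suc u) * suc (suc u)) ≤ M → Parameters u
    parameters-from u s M 2^s≡ 8kk≤M = record
      { s = s ; g = g ; r = M ∸ (g + g) ; μ = pred M ; g≢0 = g≢0 ; μ≢0 = μ≢0 ; 2^s≡ = trans 2^s≡ (sym sucμ) ; M≡ = trans sucμ (sym M-split)
      ; kg≤M = ≤-trans (≤-reflexive (*-comm k g)) (≤-trans gk≤M (≤-reflexive (sym M-split)))
      ; precise = precision k (suc (2 * suc u)) g (g + (M ∸ (g + g))) (pred M) (lem u) (trans sucμ (sym M-split)) (subst (_≤ g * k + k) (sym sucμ) M≤) (subst (8 * (k * k) ≤_) (sym sucμ) 8kk≤M) }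
      where
      k g : ℕ
      k = suc (suc u)
      g = M / k
      lem : ∀ u → suc (suc (2 * suc u)) ≡ 2 * suc (suc u)
      lem = solve-∀
      gk≤M : g * k ≤ M
      gk≤M = m/n*n≤m M k
      M≤ : M ≤ g * k + k
      M≤ = begin
        M                ≡⟨ m≡m%n+[m/n]*n M k ⟩
        M % k + g * k    ≤⟨ +-monoˡ-≤ (g * k) (<⇒≤ (m%n<n M k)) ⟩
        k + g * k        ≡⟨ +-comm k (g * k) ⟩
        g * k + k        ∎
      g≢0 : NonZero g
      g≢0 = quotient-pos g k M 8kk≤M M≤
      gg≤M : g + g ≤ M
      gg≤M = ≤-trans (≤-reflexive (lem′ g)) (≤-trans (*-monoʳ-≤ g (s≤s (s≤s (z≤n {u})))) gk≤M)
        where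
        lem′ : ∀ g → g + g ≡ g * 2
        lem′ = solve-∀
      M-split : g + (g + (M ∸ (g + g))) ≡ M
      M-split = trans (sym (+-assoc g g _)) (m+[n∸m]≡n gg≤M)
      sucμ : suc (pred M) ≡ M
      sucμ = suc-pred M
      μ≢0 : NonZero (pred M)
      μ≢0 = >-nonZero (≤-pred (≤-trans (+-mono-≤ (>-nonZero⁻¹ g ⦃ g≢0 ⦄) (>-nonZero⁻¹ g ⦃ g≢0 ⦄)) (≤-trans gg≤M (≤-reflexive (sym sucμ)))))

  opaque
    parameters : ∀ u → Parameters u
    parameters u = parameters-from u (3 + (k + k)) (2 ^ (3 + (k + k))) ⦃ m^n≢0 2 (3 + (k + k)) ⦄ refl (dice k)
      where
      k : ℕ
      k = suc (suc u)

  opaque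
    power-bound : ∀ h μ K κ e b .⦃ _ : NonZero K ⦄ → h * K ^ 2 ≤ κ ^ 2 * μ → 2 ^ e * κ ^ (2 * b) ≤ K ^ (2 * b) → 2 ^ e * h ^ b ≤ μ ^ b
    power-bound h μ K κ e b precise hyp = *-cancel-≤ (K ^ (2 * b)) ⦃ m^n≢0 K (2 * b) ⦄ (begin
      2 ^ e * h ^ b * K ^ (2 * b)       ≡⟨ trans (*-assoc (2 ^ e) (h ^ b) (K ^ (2 * b))) (cong (λ v → 2 ^ e * (h ^ b * v)) (sym (^-*-assoc K 2 b))) ⟩
      2 ^ e * (h ^ b * (K ^ 2) ^ b)     ≡⟨ cong (2 ^ e *_) (^-distribʳ-* b h (K ^ 2)) ⟨
      2 ^ e * (h * K ^ 2) ^ b           ≤⟨ *-monoʳ-≤ (2 ^ e) (^-monoˡ-≤ b precise) ⟩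
      2 ^ e * (κ ^ 2 * μ) ^ b           ≡⟨ cong (2 ^ e *_) (trans (^-distribʳ-* b (κ ^ 2) μ) (cong (_* μ ^ b) (^-*-assoc κ 2 b))) ⟩
      2 ^ e * (κ ^ (2 * b) * μ ^ b)     ≡⟨ *-assoc (2 ^ e) (κ ^ (2 * b)) (μ ^ b) ⟨
      2 ^ e * κ ^ (2 * b) * μ ^ b       ≤⟨ *-monoˡ-≤ (μ ^ b) hyp ⟩
      K ^ (2 * b) * μ ^ b               ≡⟨ *-comm (K ^ (2 * b)) (μ ^ b) ⟩
      μ ^ b * K ^ (2 * b)               ∎)

  opaque
    -- `2^-bound` for `κ = 2k - 1` and `d = 0`. Passing from `k` to `κ + 1 = 2k` doubles the
    -- exponent `b`, which produces the square in `(1 - 1/2k)²`.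
    double-bound : ∀ k N b e → suc (suc N) ≡ 2 * k → k * harmonicNum (suc N) (suc N) * e ≤ b * harmonicDen (suc N) (suc N) →
      2 ^ e * suc N ^ (2 * b) ≤ suc (suc N) ^ (2 * b)
    double-bound k N b e K≡ hyp = 2^-bound (suc N) 0 e (2 * b) (subst (λ K → K * harmonicNum (suc N) (suc N) * e ≤ 2 * b * harmonicDen (suc N) (suc N)) (sym K≡)
      (scaled k (harmonicNum (suc N) (suc N)) e b (harmonicDen (suc N) (suc N)) hyp))
      where
      lem₁ : ∀ k P e → 2 * k * P * e ≡ 2 * (k * P * e)
      lem₁ = solve-∀
      scaled : ∀ k P e b Q → k * P * e ≤ b * Q → 2 * k * P * e ≤ 2 * b * Q
      scaled k P e b Q hyp = ≤-trans (≤-reflexive (lem₁ k P e)) (≤-trans (*-monoʳ-≤ 2 hyp) (≤-reflexive (sym (*-assoc 2 b Q))))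

  opaque
    ratio≤1 : ∀ h μ κ K .⦃ _ : NonZero K ⦄ → κ ≤ K → h * K ^ 2 ≤ κ ^ 2 * μ → h ≤ μ
    ratio≤1 h μ κ K κ≤K precise = *-cancel-≤ (K ^ 2) ⦃ m^n≢0 K 2 ⦄ (≤-trans precise (≤-trans (*-monoˡ-≤ μ (^-monoˡ-≤ 2 κ≤K)) (≤-reflexive (*-comm (K ^ 2) μ))))

  -- 2 h / μ ≤ 2 (1 - 1/2k)² ≤ 2^(1 - 1/(k ln 2))
  opaque
    base-bound : ∀ k N κ K h μ a b .⦃ _ : NonZero b ⦄ .⦃ _ : NonZero k ⦄ .⦃ _ : NonZero K ⦄ → κ ≡ suc N → K ≡ suc κ → K ≡ 2 * k →
      h * K ^ 2 ≤ κ ^ 2 * μ → (∀ N → exponentApprox k N ℚ.≤ + a ℚ./ b) → (2 * h) ^ b ≤ 2 ^ a * μ ^ b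
    base-bound k N κ K h μ a b κ≡ Kκ K≡ precise exponent = choose (≤-total b a)
      where
      doubled : ∀ {κ K} e → κ ≡ suc N → K ≡ suc κ → K ≡ 2 * k → b ≡ a + e → 2 ^ e * κ ^ (2 * b) ≤ K ^ (2 * b)
      doubled e refl refl K≡ b≡ = double-bound k N b e K≡ (exponentApprox-≤ k N a b e b≡ (exponent N))
      large : ∀ e → b ≡ a + e → 2 ^ e * h ^ b ≤ μ ^ b → (2 * h) ^ b ≤ 2 ^ a * μ ^ b
      large e b≡ hyp = begin
        (2 * h) ^ b             ≡⟨ ^-distribʳ-* b 2 h ⟩
        2 ^ b * h ^ b           ≡⟨ cong (_* h ^ b) (trans (cong (2 ^_) b≡) (^-distribˡ-+-* 2 a e)) ⟩
        2 ^ a * 2 ^ e * h ^ b   ≡⟨ *-assoc (2 ^ a) (2 ^ e) (h ^ b) ⟩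
        2 ^ a * (2 ^ e * h ^ b) ≤⟨ *-monoʳ-≤ (2 ^ a) hyp ⟩
        2 ^ a * μ ^ b           ∎
      choose : (b ≤ a) ⊎ (a ≤ b) → (2 * h) ^ b ≤ 2 ^ a * μ ^ b
      -- For `a / b ≥ 1` no logarithm is involved and `h ≤ μ` suffices.
      choose (inj₁ b≤a) = ≤-trans (≤-reflexive (^-distribʳ-* b 2 h))
        (*-mono-≤ (^-monoʳ-≤ 2 b≤a) (^-monoˡ-≤ b (ratio≤1 h μ κ K (≤-trans (n≤1+n κ) (≤-reflexive (sym Kκ))) precise)))
      choose (inj₂ a≤b) = large (b ∸ a) (sym (m+[n∸m]≡n a≤b)) (power-bound h μ K κ (b ∸ a) b precise (doubled (b ∸ a) κ≡ Kκ K≡ (sym (m+[n∸m]≡n a≤b))))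

  opaque
    scaleⁿ-lower : ∀ a b m x → x * a ^ m ≤ scaleⁿ a (suc b) m x * suc b ^ m
    scaleⁿ-lower a b zero    x = ≤-refl
    scaleⁿ-lower a b (suc m) x = begin
      x * (a * a ^ m)                                ≡⟨ *-assoc x a (a ^ m) ⟨
      x * a * a ^ m                                  ≤⟨ *-monoˡ-≤ (a ^ m) (scale-lower a b x) ⟩
      scale a (suc b) x * suc b * a ^ m              ≡⟨ lem (scale a (suc b) x) (suc b) (a ^ m) ⟩
      suc b * (scale a (suc b) x * a ^ m)            ≤⟨ *-monoʳ-≤ (suc b) (scaleⁿ-lower a b m (scale a (suc b) x)) ⟩
      suc b * (scaleⁿ a (suc b) (suc m) x * suc b ^ m) ≡⟨ lem′ (suc b) (scaleⁿ a (suc b) (suc m) x) (suc b ^ m) ⟩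
      scaleⁿ a (suc b) (suc m) x * suc b ^ suc m     ∎
      where
      lem : ∀ x b p → x * b * p ≡ b * (x * p)
      lem = solve-∀
      lem′ : ∀ b x p → b * (x * p) ≡ x * (b * p)
      lem′ = solve-∀

  opaque
    -- Each rounding adds at most `b` before a multiplication by `a / (b+1) ≥ 1`. Relative to the
    -- growth that follows, the errors sum up to `m b` at most, hence a polynomial factor.
    scaleⁿ-upper : ∀ a b m x → suc b ≤ a → scaleⁿ a (suc b) m x * suc b ^ m ≤ a ^ m * (x + m * b)
    scaleⁿ-upper a b zero    x b<a = ≤-reflexive (lem x)
      where
      lem : ∀ x → x * 1 ≡ 1 * (x + 0)
      lem = solve-∀
    scaleⁿ-upper a b (suc m) x b<a = begin
      scaleⁿ a (suc b) (suc m) x * (suc b * suc b ^ m)  ≡⟨ lem (scaleⁿ a (suc b) (suc m) x) (suc b) (suc b ^ m) ⟩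
      scaleⁿ a (suc b) (suc m) x * suc b ^ m * suc b    ≤⟨ *-monoˡ-≤ (suc b) (scaleⁿ-upper a b m (scale a (suc b) x) b<a) ⟩
      a ^ m * (scale a (suc b) x + m * b) * suc b       ≡⟨ lem′ (a ^ m) (scale a (suc b) x) (m * b) (suc b) ⟩
      a ^ m * (scale a (suc b) x * suc b + m * b * suc b) ≤⟨ *-monoʳ-≤ (a ^ m) (+-mono-≤ (scale-upper a b x) (*-monoʳ-≤ (m * b) b<a)) ⟩
      a ^ m * ((x + b) * a + m * b * a)                 ≡⟨ lem″ a (a ^ m) x b (m * b) ⟩
      a ^ suc m * (x + suc m * b)                       ∎
      where
      lem : ∀ x b p → x * (b * p) ≡ x * p * b
      lem = solve-∀
      lem′ : ∀ p x y b → p * (x + y) * b ≡ p * (x * b + y * b)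
      lem′ = solve-∀
      lem″ : ∀ a p x b y → p * ((x + b) * a + y * a) ≡ a * p * (x + (b + y))
      lem″ = solve-∀

  opaque
    scale-1 : ∀ a x → scale a 1 x ≡ x * a
    scale-1 a x = ≤-antisym
      (≤-trans (≤-reflexive (sym (*-identityʳ _))) (≤-trans (scale-upper a 0 x) (≤-reflexive (cong (_* a) (+-identityʳ x)))))
      (≤-trans (scale-lower a 0 x) (≤-reflexive (*-identityʳ _)))

-- The total number of steps

module RunningTime where
  open PowerInequalities
  open LogTwoPowers using (^-swap)
  open Execution
  open Programs
  open Counters
  open Tapes
  open Parameterization

  open ≤-Reasoning

  loopTime≡ : ∀ c m → loopTime c m ≡ suc (m * suc c)
  loopTime≡ c zero    = refl
  loopTime≡ c (suc m) = cong suc (trans (cong (c +_) (loopTime≡ c m)) (+-suc c (m * suc c)))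

  drawSteps≡ : ∀ m → drawSteps m ≡ suc (m * 8)
  drawSteps≡ zero    = refl
  drawSteps≡ (suc m) = cong (8 +_) (drawSteps≡ m)

  private variable
    f f′ : ℕ → ℕ

  module Bounds (ρ : ℕ → ℕ) (1≤ρ : ∀ n → 1 ≤ ρ n) where

    -- All exponential bounds share the one function `ρ`, later `growth`. Since `ρ` may enter only
    -- once, `_⊠_` multiplies an exponential bound by a polynomial one.
    Poly Exp : (ℕ → ℕ) → Set
    Poly f = ∃[ C ] (∀ n → f n ≤ poly C n)
    Exp  f = ∃[ C ] (∀ n → f n ≤ poly C n * ρ n)

    opaque
      poly-+ : ∀ C C′ n → poly C n + poly C′ n ≤ poly (C + C′) n
      poly-+ C C′ n = ≤-trans (+-mono-≤ (*-monoʳ-≤ C (^-monoʳ-≤ (suc n) (m≤m+n C C′))) (*-monoʳ-≤ C′ (^-monoʳ-≤ (suc n) (m≤n+m C′ C))))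
        (≤-reflexive (sym (*-distribʳ-+ (suc n ^ (C + C′)) C C′)))

    opaque
      poly-* : ∀ C C′ n → poly C n * poly C′ n ≤ poly (C * C′ + (C + C′)) n
      poly-* C C′ n = ≤-trans (≤-reflexive (trans (lem C (suc n ^ C) C′ (suc n ^ C′)) (cong (C * C′ *_) (sym (^-distribˡ-+-* (suc n) C C′)))))
        (*-mono-≤ (m≤m+n (C * C′) (C + C′)) (^-monoʳ-≤ (suc n) (m≤n+m (C + C′) (C * C′))))
        where
        lem : ∀ a b c d → a * b * (c * d) ≡ a * c * (b * d)
        lem = solve-∀

    opaque
      const : ∀ a → Poly (λ _ → a)
      const a = a , λ n → ≤-trans (≤-reflexive (sym (*-identityʳ a))) (*-monoʳ-≤ a (m^n>0 (suc n) a))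

      size+1 : Poly suc
      size+1 = 1 , λ n → ≤-reflexive (sym (trans (*-identityˡ (suc n * 1)) (*-identityʳ (suc n))))

      size : Poly (λ n → n)
      size = 1 , λ n → ≤-trans (n≤1+n n) (proj₂ size+1 n)

      poly-self : ∀ c → Poly (poly c)
      poly-self c = c , λ n → ≤-refl

    infixl 6 _⊕_ _⊞_
    infixl 7 _⊛_ _⊠_

    opaque
      _⊕_ : Poly f → Poly f′ → Poly (λ n → f n + f′ n)
      (C , p) ⊕ (C′ , p′) = C + C′ , λ n → ≤-trans (+-mono-≤ (p n) (p′ n)) (poly-+ C C′ n)

      _⊛_ : Poly f → Poly f′ → Poly (λ n → f n * f′ n)
      (C , p) ⊛ (C′ , p′) = C * C′ + (C + C′) , λ n → ≤-trans (*-mono-≤ (p n) (p′ n)) (poly-* C C′ n)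

    s⊕ : Poly f → Poly (λ n → suc (f n))
    s⊕ p = const 1 ⊕ p

    opaque
      ≡Poly : (∀ n → f n ≡ f′ n) → Poly f′ → Poly f
      ≡Poly eq (C , p) = C , λ n → ≤-trans (≤-reflexive (eq n)) (p n)

      ≡Exp : (∀ n → f n ≡ f′ n) → Exp f′ → Exp f
      ≡Exp eq (C , p) = C , λ n → ≤-trans (≤-reflexive (eq n)) (p n)

    loop : Poly f → Poly f′ → Poly (λ n → loopTime (f n) (f′ n))
    loop {f} {f′} p q = ≡Poly (λ n → loopTime≡ (f n) (f′ n)) (s⊕ {f = λ n → f′ n * suc (f n)} (_⊛_ {f = f′} {f′ = λ n → suc (f n)} q (s⊕ p)))

    opaque
      poly⇒exp : Poly f → Exp f
      poly⇒exp (C , p) = C , λ n → ≤-trans (p n) (≤-trans (≤-reflexive (sym (*-identityʳ (poly C n)))) (*-monoʳ-≤ (poly C n) (1≤ρ n)))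

      exp-ρ : Exp ρ
      exp-ρ = proj₁ (const 1) , λ n → ≤-trans (≤-reflexive (sym (*-identityˡ (ρ n)))) (*-monoˡ-≤ (ρ n) (proj₂ (const 1) n))

      _⊞_ : Exp f → Exp f′ → Exp (λ n → f n + f′ n)
      (C , p) ⊞ (C′ , p′) = C + C′ , λ n → ≤-trans (+-mono-≤ (p n) (p′ n))
        (≤-trans (≤-reflexive (sym (*-distribʳ-+ (ρ n) (poly C n) (poly C′ n)))) (*-monoˡ-≤ (ρ n) (poly-+ C C′ n)))

      _⊠_ : Exp f → Poly f′ → Exp (λ n → f n * f′ n)
      (C , p) ⊠ (C′ , p′) = C * C′ + (C + C′) , λ n → ≤-trans (*-mono-≤ (p n) (p′ n))
        (≤-trans (≤-reflexive (lem (poly C n) (ρ n) (poly C′ n))) (*-monoˡ-≤ (ρ n) (poly-* C C′ n)))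
        where
        lem : ∀ a b c → a * b * c ≡ a * c * b
        lem = solve-∀

      exp-comm : Exp (λ n → f n * f′ n) → Exp (λ n → f′ n * f n)
      exp-comm {f = f} {f′} (C , p) = C , λ n → ≤-trans (≤-reflexive (*-comm (f′ n) (f n))) (p n)

    s⊞ : Exp f → Exp (λ n → suc (f n))
    s⊞ p = poly⇒exp (const 1) ⊞ p

    loop-often : Poly f → Exp f′ → Exp (λ n → loopTime (f n) (f′ n))
    loop-often {f} {f′} p q = ≡Exp (λ n → loopTime≡ (f n) (f′ n)) (s⊞ {f = λ n → f′ n * suc (f n)} (_⊠_ {f = f′} {f′ = λ n → suc (f n)} q (s⊕ p)))

    loop-long : Exp f → Poly f′ → Exp (λ n → loopTime (f n) (f′ n))
    loop-long {f} {f′} p q = ≡Exp (λ n → loopTime≡ (f n) (f′ n)) (s⊞ {f = λ n → f′ n * suc (f n)} (exp-comm {f = λ n → suc (f n)} {f′ = f′} (_⊠_ {f = λ n → suc (f n)} {f′ = f′} (s⊞ p) q)))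

  module _ (k s μ : ℕ) (a b K : ℕ) .⦃ _ : NonZero k ⦄ (b<a : suc b ≤ a) (1≤k : 1 ≤ k) where

    private
      M = suc μ
      ρ = growth k M a b K

    open Bounds ρ (λ n → ≤-trans 1≤k (scaleⁿ-inflationary a b n k b<a))

    programTime : ℕ → ℕ → ℕ
    programTime c n = suc (preludeTime k M a b K n + suc (drawSteps (bitsOf k M a b K n) +
      loopTime (mainTime k s n (stepsOf k M a b K n) (attemptsOf k M a b K n) (poly c n)) (roundsOf k M a b K n)))

    private
      poly-scale : ∀ a {f} → Poly f → Poly (λ n → scale a 1 (f n))
      poly-scale a {f} p = ≡Poly (λ n → scale-1 a (f n)) (_⊛_ {f = f} {f′ = λ _ → a} p (const a))

      exp-scale : ∀ a {f} → Exp f → Exp (λ n → scale a 1 (f n))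
      exp-scale a {f} p = ≡Exp (λ n → scale-1 a (f n)) (_⊠_ {f = f} {f′ = λ _ → a} p (const a))

      poly-T : Poly (stepsOf k M a b K)
      poly-T = poly-scale 8 size+1

      poly-E : Poly (attemptsOf k M a b K)
      poly-E = poly-scale M size+1

      poly-literal : Poly literalTime
      poly-literal = s⊕ (const 9 ⊕ s⊕ (loop (const 3) size ⊕ const 11))

      poly-find : ∀ c → Poly (λ n → findTime (falsifiedTime k n) (poly c n))
      poly-find c = s⊕ (const 3 ⊕ loop (s⊕ (const 5 ⊕ s⊕ (loop poly-literal (const k) ⊕ const 6))) (poly-self c))

      poly-set : Poly setTime
      poly-set = s⊕ (const 7 ⊕ s⊕ (loop (const 9) size ⊕ s⊕ (const 5 ⊕ loop (const 7) size)))

      poly-walk : ∀ c → Poly (λ n → walkTime k s (walkBodyTime k s (poly c n) n) (stepsOf k M a b K n))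
      poly-walk c = s⊕ (const 1 ⊕ loop (s⊕ (const 1 ⊕ s⊕ (poly-find c ⊕ s⊕ (const 3 ⊕ s⊕ (const (pickTime k s) ⊕ s⊕ poly-set))))) poly-T)

      poly-sample : Poly (λ n → sampleAllTime k s n (attemptsOf k M a b K n))
      poly-sample = s⊕ (const 3 ⊕ s⊕ (loop (s⊕ (const 7 ⊕ s⊕ (loop (const (suc (1 + chunkTime k s s))) poly-E ⊕ const (suc (3 + suc (2 + 5)))))) size ⊕ loop (const 7) size))

      poly-update : Poly updateTime
      poly-update = s⊕ (const 5 ⊕ s⊕ (loop (const (suc (7 + suc (3 + 3)))) size ⊕ s⊕ (const 3 ⊕ s⊕ (loop (const 3) size+1 ⊕ const (suc (4 + 3))))))

      poly-attempt : ∀ c → Poly (λ n → attemptTime k s n (stepsOf k M a b K n) (attemptsOf k M a b K n) (poly c n))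
      poly-attempt c = s⊕ (poly-sample ⊕ s⊕ (poly-walk c ⊕ s⊕ (poly-find c ⊕ s⊕ (s⊕ poly-update ⊕ const 3))))

      poly-main : ∀ c → Poly (λ n → mainTime k s n (stepsOf k M a b K n) (attemptsOf k M a b K n) (poly c n))
      poly-main c = s⊕ (const 1 ⊕ s⊕ (const 3 ⊕ loop (s⊕ (poly-attempt c ⊕ const 3)) poly-E))

      exp-rounds : Exp (roundsOf k M a b K)
      exp-rounds = exp-ρ ⊠ size+1

      exp-bits₁ : Exp (λ n → scale K 1 (roundsOf k M a b K n))
      exp-bits₁ = exp-scale K exp-rounds

      exp-scaleTime : ∀ a b {f} → Exp f → Exp (λ n → scaleTime a b (f n))
      exp-scaleTime a b p = s⊞ (poly⇒exp (const 1) ⊞ s⊞ (loop-often (const (suc (suc (b * 2) + suc (a * 2)))) p ⊞ poly⇒exp (const 3)))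

      exp-times : ∀ {f} → Exp f → Exp (λ n → timesTime (suc n) (f n))
      exp-times p = s⊞ (loop-often (s⊕ (const 3 ⊕ loop (const 3) size+1)) p ⊞ poly⇒exp (const 3))

      poly-scaleTime : ∀ a b → Exp (λ n → scaleTime a b (suc n))
      poly-scaleTime a b = exp-scaleTime a b (poly⇒exp size+1)

      exp-prelude : Exp (preludeTime k M a b K)
      exp-prelude =
        s⊞ (poly⇒exp (const 9) ⊞ s⊞ (poly⇒exp (loop (const 3) size) ⊞ s⊞ (poly⇒exp (const 1) ⊞
        s⊞ (poly-scaleTime 8 1 ⊞ s⊞ (poly⇒exp (const 3) ⊞ s⊞ (poly-scaleTime M 1 ⊞ s⊞ (poly⇒exp (const 3) ⊞
        s⊞ (poly⇒exp (const (suc (k * 2))) ⊞ s⊞ (poly⇒exp (const 5) ⊞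
        s⊞ (loop-long (s⊞ (poly⇒exp (const 1) ⊞ exp-scaleTime a (suc b) exp-ρ)) size ⊞
        s⊞ (exp-times exp-ρ ⊞ s⊞ (poly⇒exp (const 1) ⊞
        s⊞ (exp-scaleTime K 1 exp-rounds ⊞ s⊞ (exp-times exp-bits₁ ⊞ s⊞ (exp-times (exp-bits₁ ⊠ size+1) ⊞
        exp-times (exp-bits₁ ⊠ size+1 ⊠ size+1))))))))))))))))

      exp-draw : Exp (λ n → drawSteps (bitsOf k M a b K n))
      exp-draw = ≡Exp (λ n → drawSteps≡ (bitsOf k M a b K n)) (s⊞ (exp-bits₁ ⊠ size+1 ⊠ size+1 ⊠ size+1 ⊠ const 8))

      exp-program : ∀ c → Exp (programTime c)
      exp-program c = s⊞ (exp-prelude ⊞ s⊞ (exp-draw ⊞ loop-often (poly-main c) exp-rounds))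

    opaque
      programTime-bound : ∀ c → ∃[ C ] (∀ n → programTime c n * suc b ^ n ≤ poly C n * a ^ n)
      programTime-bound c = C₁ * C₂ + (C₁ + C₂) , λ n → begin
        programTime c n * suc b ^ n                       ≤⟨ *-monoˡ-≤ (suc b ^ n) (proj₂ (exp-program c) n) ⟩
        poly C₁ n * ρ n * suc b ^ n                       ≡⟨ *-assoc (poly C₁ n) (ρ n) (suc b ^ n) ⟩
        poly C₁ n * (ρ n * suc b ^ n)                     ≤⟨ *-monoʳ-≤ (poly C₁ n) (scaleⁿ-upper a b n k b<a) ⟩
        poly C₁ n * (a ^ n * (k + n * b))                 ≤⟨ *-monoʳ-≤ (poly C₁ n) (*-monoʳ-≤ (a ^ n) (proj₂ linear n)) ⟩
        poly C₁ n * (a ^ n * poly C₂ n)                   ≡⟨ lem (poly C₁ n) (a ^ n) (poly C₂ n) ⟩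
        poly C₁ n * poly C₂ n * a ^ n                     ≤⟨ *-monoˡ-≤ (a ^ n) (poly-* C₁ C₂ n) ⟩
        poly (C₁ * C₂ + (C₁ + C₂)) n * a ^ n              ∎
        where
        linear : Poly (λ n → k + n * b)
        linear = const k ⊕ size ⊛ const b
        C₁ C₂ : ℕ
        C₁ = proj₁ (exp-program c)
        C₂ = proj₁ linear
        lem : ∀ p a q → p * (a * q) ≡ p * q * a
        lem = solve-∀

  opaque
    -- Raising to the power `b` lets `x / y ≤ 2 ^ (a / b)` be used without roots.
    time-bound : ∀ t p x y n a b .⦃ _ : NonZero y ⦄ → t * y ^ n ≤ p * x ^ n → x ^ b ≤ 2 ^ a * y ^ b →
                 t ^ b ≤ p ^ b * 2 ^ (a * n)
    time-bound t p x y n a b hyp base = *-cancel-≤ ((y ^ n) ^ b) ⦃ m^n≢0 (y ^ n) b ⦃ m^n≢0 y n ⦄ ⦄ (begin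
      t ^ b * (y ^ n) ^ b              ≡⟨ ^-distribʳ-* b t (y ^ n) ⟨
      (t * y ^ n) ^ b                  ≤⟨ ^-monoˡ-≤ b hyp ⟩
      (p * x ^ n) ^ b                  ≡⟨ ^-distribʳ-* b p (x ^ n) ⟩
      p ^ b * (x ^ n) ^ b              ≡⟨ cong (p ^ b *_) (^-swap x n b) ⟩
      p ^ b * (x ^ b) ^ n              ≤⟨ *-monoʳ-≤ (p ^ b) (^-monoˡ-≤ n base) ⟩
      p ^ b * (2 ^ a * y ^ b) ^ n      ≡⟨ cong (p ^ b *_) (^-distribʳ-* n (2 ^ a) (y ^ b)) ⟩
      p ^ b * ((2 ^ a) ^ n * (y ^ b) ^ n) ≡⟨ cong₂ (λ u v → p ^ b * (u * v)) (^-*-assoc 2 a n) (^-swap y b n) ⟩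
      p ^ b * (2 ^ (a * n) * (y ^ n) ^ b) ≡⟨ *-assoc (p ^ b) (2 ^ (a * n)) ((y ^ n) ^ b) ⟨
      p ^ b * 2 ^ (a * n) * (y ^ n) ^ b   ∎)

-- Counting the outcomes of the whole program

module Assembly where
  open PowerInequalities
  open Execution
  open Algorithm
  open Programs using (#V; encodeBits; findTime; falsifiedTime; checkTime; attemptTime; roundTime; mainTime; walkBodyTime; walkTime; mainCmd; exec-main; machine; sampleAllTime)
  open Counters
  open Counting
  open Tapes
  open RandomWalks
  open Attempts
  open Amplification
  open Parameterization
  open RunningTime
  open LogTwo
  open import Data.Fin.Base using (zero)
  open import Data.Integer.Base using (+_)
  open import Data.List.Extrema.Nat using (xs≤max; argmax-sel)
  open import Data.List.Membership.Propositional using (_∈_; lose)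
  open import Data.List.Membership.Propositional.Properties using (∈-filter⁺; ∈-filter⁻; ∈-map⁺; ∈-map⁻; ∈-++⁺ˡ; ∈-++⁺ʳ)
  open import Data.List.Relation.Unary.All as All using (All; []; _∷_)
  open import Data.List.Relation.Unary.Any using (here)
  open import Data.Rational.Base as ℚ using (ℚ; 1ℚ)
  import Data.Rational.Properties as ℚ
  open import Data.Rational.Solver
  open import Relation.Unary using (Decidable)

  private variable
    n : ℕ

  ∈-bitStrings : ∀ (z : Vec Bool n) → z ∈ bitStrings n
  ∈-bitStrings []          = here refl
  ∈-bitStrings (false ∷ z) = ∈-++⁺ˡ (∈-map⁺ (false ∷_) (∈-bitStrings z))
  ∈-bitStrings (true ∷ z)  = ∈-++⁺ʳ (List.map (false ∷_) (bitStrings _)) (∈-map⁺ (true ∷_) (∈-bitStrings z))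

  ∈-Ω : ∀ (F : CNF n) {z} → Satisfies F z → z ∈ Ω F
  ∈-Ω F {z} p = ∈-filter⁺ (satisfies? F) (∈-bitStrings z) p

  farthest : ∀ (F : CNF n) z₀ → Satisfiable F → ∃[ x ] (Satisfies F x × dH z₀ x ≡ maxDistance F z₀)
  farthest F z₀ (z , sat) with argmax-sel id 0 (List.map (dH z₀) (Ω F))
  -- If the maximum is the default value 0, all distances are 0 and any satisfying assignment is
  -- farthest.
  ... | inj₁ max≡0 = z , sat , ≤-antisym (All.lookup (xs≤max 0 (List.map (dH z₀) (Ω F))) (∈-map⁺ (dH z₀) (∈-Ω F sat))) (≤-trans (≤-reflexive max≡0) z≤n)
  ... | inj₂ max∈ with ∈-map⁻ (dH z₀) max∈
  ...   | x , x∈Ω , eq = x , proj₂ (∈-filter⁻ (satisfies? F) {xs = bitStrings _} x∈Ω) , sym eq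

  open +-*-Solver using (_:+_; _:*_; _:-_; :-_; _:=_; con) renaming (solve to solveℚ)

  opaque
    /-≤ : ∀ p q d .⦃ _ : NonZero q ⦄ D → D * q ≤ d * q + p * D → (1ℚ ℚ.- + p ℚ./ q) ℚ.* fromℕ D ℚ.≤ fromℕ d
    /-≤ p q d D le = ℚ.*-cancelʳ-≤-pos fq ⦃ ℚ.normalize-pos q 1 ⦄ (ℚ-begin
      (1ℚ ℚ.- ρ) ℚ.* fD ℚ.* fq                  ≡⟨ solveℚ 3 (λ ρ D q → (con 1ℚ :+ :- ρ) :* D :* q := D :* q :+ :- (ρ :* q :* D)) refl ρ fD fq ⟩
      fD ℚ.* fq ℚ.- ρ ℚ.* fq ℚ.* fD              ≡⟨ cong₂ (λ u v → u ℚ.- v ℚ.* fD) (sym (fromℕ-* D q)) (/-*-cancel p q) ⟩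
      fromℕ (D * q) ℚ.- fp ℚ.* fD                ≤⟨ ℚ.+-monoˡ-≤ (ℚ.- (fp ℚ.* fD)) (fromℕ-mono-≤ le) ⟩
      fromℕ (d * q + p * D) ℚ.- fp ℚ.* fD        ≡⟨ cong (ℚ._- fp ℚ.* fD) (trans (fromℕ-+ (d * q) (p * D)) (cong₂ ℚ._+_ (fromℕ-* d q) (fromℕ-* p D))) ⟩
      fd ℚ.* fq ℚ.+ fp ℚ.* fD ℚ.- fp ℚ.* fD      ≡⟨ solveℚ 2 (λ x y → x :+ y :+ :- y := x) refl (fd ℚ.* fq) (fp ℚ.* fD) ⟩
      fd ℚ.* fq                                  ∎)
      where
      open ℚ.≤-Reasoning renaming (begin_ to ℚ-begin_)
      ρ fD fq fp fd : ℚ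
      ρ = + p ℚ./ q
      fD = fromℕ D
      fq = fromℕ q
      fp = fromℕ p
      fd = fromℕ d

  opaque
    /2^-≤ : ∀ n t X → 2 ^ n * 2 ^ t ≤ 2 ^ n * X + 2 ^ t → 1ℚ ℚ.- (1 /2^ n) ℚ.≤ X /2^ t
    /2^-≤ n t X le = ℚ.*-cancelʳ-≤-pos (fn ℚ.* ft) ⦃ ℚ.pos*pos⇒pos fn ⦃ fn>0 ⦄ ft ⦃ ft>0 ⦄ ⦄ (ℚ-begin
      (1ℚ ℚ.- ρ) ℚ.* (fn ℚ.* ft)                 ≡⟨ solveℚ 3 (λ ρ n t → (con 1ℚ :+ :- ρ) :* (n :* t) := n :* t :+ :- (ρ :* n :* t)) refl ρ fn ft ⟩
      fn ℚ.* ft ℚ.- ρ ℚ.* fn ℚ.* ft              ≡⟨ cong₂ (λ u v → u ℚ.- v ℚ.* ft) (sym (fromℕ-* (2 ^ n) (2 ^ t))) (/-*-cancel 1 (2 ^ n) ⦃ n≢0 ⦄) ⟩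
      fromℕ (2 ^ n * 2 ^ t) ℚ.- fromℕ 1 ℚ.* ft   ≤⟨ ℚ.+-monoˡ-≤ (ℚ.- (fromℕ 1 ℚ.* ft)) (fromℕ-mono-≤ le) ⟩
      fromℕ (2 ^ n * X + 2 ^ t) ℚ.- 1ℚ ℚ.* ft    ≡⟨ cong (ℚ._- 1ℚ ℚ.* ft) (trans (fromℕ-+ (2 ^ n * X) (2 ^ t)) (cong (ℚ._+ ft) (fromℕ-* (2 ^ n) X))) ⟩
      fn ℚ.* fX ℚ.+ ft ℚ.- 1ℚ ℚ.* ft             ≡⟨ solveℚ 3 (λ n x t → n :* x :+ t :+ :- (con 1ℚ :* t) := x :* n) refl fn fX ft ⟩
      fX ℚ.* fn                                  ≡⟨ cong (ℚ._* fn) (/-*-cancel X (2 ^ t) ⦃ t≢0 ⦄) ⟨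
      X /2^ t ℚ.* ft ℚ.* fn                      ≡⟨ solveℚ 3 (λ y t n → y :* t :* n := y :* (n :* t)) refl (X /2^ t) ft fn ⟩
      X /2^ t ℚ.* (fn ℚ.* ft)                    ∎)
      where
      open ℚ.≤-Reasoning renaming (begin_ to ℚ-begin_)
      n≢0 : NonZero (2 ^ n)
      n≢0 = m^n≢0 2 n
      t≢0 : NonZero (2 ^ t)
      t≢0 = m^n≢0 2 t
      ρ fn ft fX : ℚ
      ρ = 1 /2^ n
      fn = fromℕ (2 ^ n)
      ft = fromℕ (2 ^ t)
      fX = fromℕ X
      fn>0 : ℚ.Positive fn
      fn>0 = ℚ.normalize-pos (2 ^ n) 1 ⦃ _ ⦄ ⦃ n≢0 ⦄
      ft>0 : ℚ.Positive ft
      ft>0 = ℚ.normalize-pos (2 ^ t) 1 ⦃ _ ⦄ ⦃ t≢0 ⦄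

  findTime-mono : ∀ t {f f′} → f ≤ f′ → findTime t f ≤ findTime t f′
  findTime-mono t f≤ = s≤s (+-monoʳ-≤ 3 (loopTime-mono {t} ≤-refl f≤))

  mainTime-mono : ∀ k s .⦃ _ : NonZero k ⦄ n T c {f f′} → f ≤ f′ → mainTime k s n T c f ≤ mainTime k s n T c f′
  mainTime-mono k s n T c {f} {f′} f≤ = s≤s (s≤s (s≤s (+-monoʳ-≤ 3 (loopTime-mono {m = c} (s≤s (+-monoˡ-≤ 3 one)) ≤-refl))))
    where
    one : attemptTime k s n T c f ≤ attemptTime k s n T c f′
    one = s≤s (+-monoʳ-≤ (sampleAllTime k s n c) (s≤s (+-mono-≤
      (s≤s (s≤s (loopTime-mono {m = T} (s≤s (s≤s (s≤s (+-monoˡ-≤ _ (findTime-mono (falsifiedTime k n) f≤))))) ≤-refl)))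
      (s≤s (+-monoˡ-≤ _ (findTime-mono (falsifiedTime k n) f≤))))))

  opaque
    size-round : ∀ s n T e c m → e + c ≤ m → size (roundCode s n T e c) ≤ c * (n * (m * s + 1) + T * s)
    size-round s n T e zero    m le = z≤n
    size-round s n T e (suc c) m le = +-mono-≤
      (+-mono-≤ (*-monoʳ-≤ n (+-monoˡ-≤ 1 (≤-trans (≤-reflexive (cong (e *_) (*-identityʳ s))) (*-monoˡ-≤ s (≤-trans (m≤m+n e (suc c)) le)))))
        (≤-reflexive (cong (T *_) (*-identityʳ s))))
      (size-round s n T (suc e) c m (≤-trans (≤-reflexive (sym (+-suc e c))) le))

  opaque
    -- The origin of the constant `K`: each of `M ν` attempts uses fewer than `M ν` dice and one
    -- further bit per variable, and `8 ν` dice for the walk.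
    size-rounds : ∀ M s n R → let ν = suc n in
      R * size (roundCode s n (ν * 8) 0 (ν * M)) ≤ R * (M * (M * s + 1 + 8 * s)) * ν * ν * ν
    size-rounds M s n R = ≤-trans (*-monoʳ-≤ R (≤-trans (size-round s n (suc n * 8) 0 (suc n * M) (suc n * M) ≤-refl)
      (*-monoʳ-≤ (suc n * M) (+-mono-≤ (*-mono-≤ (n≤1+n n) (+-monoʳ-≤ (suc n * M * s) (s≤s (z≤n {n})))) (m≤n*m (suc n * 8 * s) (suc n))))))
      (≤-reflexive (lem R (suc n) M s))
      where
      lem : ∀ R ν M s → R * (ν * M * (ν * (ν * M * s + ν) + ν * (ν * 8 * s))) ≡ R * (M * (M * s + 1 + 8 * s)) * ν * ν * ν
      lem = solve-∀

  halted? : ∀ {v} (κ : Config v) → Dec (Halted κ)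
  halted? ([]    , σ) = yes refl
  halted? (_ ∷ _ , σ) = no λ ()

  indicator≤1 : ∀ {ℓ} {A : Set ℓ} (d : Dec A) → indicator d ≤ 1
  indicator≤1 (yes _) = ≤-refl
  indicator≤1 (no _)  = z≤n

  1≤indicator : ∀ {ℓ} {A : Set ℓ} (d : Dec A) → A → 1 ≤ indicator d
  1≤indicator (yes _) a = ≤-refl
  1≤indicator (no ¬a) a = contradiction a ¬a

  indicator-sound : ∀ {ℓ} {A : Set ℓ} (d : Dec A) → 1 ≤ indicator d → A
  indicator-sound (yes a) _ = a

  module _ (u : ℕ) .⦃ _ : NonZero u ⦄ (param : Parameters u) where
    open Parameters param

    private
      k h M a b K : ℕ
      k = suc (suc u)
      h = g + r
      M = suc μ
      a = 2 * h
      b = pred μ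
      K = M * (M * s + 1 + 8 * s)

    sucb≡μ : suc b ≡ μ
    sucb≡μ = suc-pred μ

    opaque
      sucb≤a : suc b ≤ a
      sucb≤a = ≤-trans (≤-reflexive sucb≡μ) (≤-trans (n≤1+n μ) (≤-trans (≤-reflexive M≡)
        (≤-trans (+-monoˡ-≤ h (m≤m+n g r)) (≤-reflexive (cong (λ m → h + m) (sym (+-identityʳ h)))))))

    program : Program
    program = 22 , (preludeCmd k M a b K ⨾ (drawCmd ⨾ mainCmd k s))

    module _ {n : ℕ} (F : CNF n) (z₀ : Assignment n) (|F| : Is k -CNF F) (c : ℕ) (F≤ : length F ≤ poly c n) where

      T E R N R₁ : ℕ
      T = stepsOf k M a b K n
      E = attemptsOf k M a b K n
      R = roundsOf k M a b K n
      N = bitsOf k M a b K n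
      R₁ = growth k M a b K n

      roundsCode : Code
      roundsCode = roundCode s n T 0 E ^^ R

      opaque
        size≤N : size roundsCode ≤ N
        size≤N = subst₂ (λ T E → R * size (roundCode s n T 0 E) ≤ N) (sym (scale-1 8 (suc n))) (sym (scale-1 M (suc n)))
          (≤-trans (size-rounds M s n R) (≤-reflexive (cong (λ B → B * suc n * suc n * suc n) (sym (scale-1 K R)))))

      -- `N` is a bound that is easy to compute; the surplus coins are tossed first and stay at the
      -- bottom of the tape.
      spare : ℕ
      spare = N ∸ size roundsCode

      initial : Best n
      initial = z₀ , 0

      opaque
        time : ℕ
        time = programTime k s μ a b K sucb≤a (s≤s z≤n) c n

        time≡ : time ≡ programTime k s μ a b K sucb≤a (s≤s z≤n) c n
        time≡ = refl

      opaque
        finish : ∀ x w → ∃[ e ] Exec (mainCmd k s) (drawing nil (encodeBits (writeBits roundsCode x w)) ⌜ T ⌝ⁿ ⌜ E ⌝ⁿ ⌜ R ⌝ⁿ ⌜ suc n ⌝ⁿ (encodeAssignment z₀) (encodeCNF F))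
          (loopTime (mainTime k s n T E (poly c n)) R)
          (machine k s F |F| z₀ T (encodeBits w) nil e nil ⌜ E ⌝ⁿ nil ⌜ suc n ⌝ⁿ (rounds k s F z₀ T 0 E x initial))
        finish x w =
          let e , run = exec-main k s F |F| z₀ T E x w initial z≤n
          in e , weaken (loopTime-mono (mainTime-mono k s n T E F≤) (≤-refl {R})) run

      final : El roundsCode → List Bool → Store #V
      final x w = machine k s F |F| z₀ T (encodeBits w) nil (proj₁ (finish x w)) nil ⌜ E ⌝ⁿ nil ⌜ suc n ⌝ⁿ (rounds k s F z₀ T 0 E x initial)

      preludeBound mainBound : ℕ
      preludeBound = preludeTime k M a b K n
      mainBound = loopTime (mainTime k s n T E (poly c n)) R

      opaque
        unfolding time

        time-split : time ≡ suc (preludeBound + suc (drawSteps N + mainBound))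
        time-split = refl

      drawn : List Bool → Store #V
      drawn w = drawing nil (encodeBits w) ⌜ T ⌝ⁿ ⌜ E ⌝ⁿ ⌜ R ⌝ⁿ ⌜ suc n ⌝ⁿ (encodeAssignment z₀) (encodeCNF F)

      opaque
        begun : Exec (preludeCmd k M a b K) (encodeInput F z₀ ∷ Vec.replicate 22 nil) preludeBound (drawing ⌜ N ⌝ⁿ nil ⌜ T ⌝ⁿ ⌜ E ⌝ⁿ ⌜ R ⌝ⁿ ⌜ suc n ⌝ⁿ (encodeAssignment z₀) (encodeCNF F))
        begun = exec-prelude k M a b K sucb≤a F z₀

      opaque
        finished : ∀ x w → Exec (mainCmd k s) (drawn (writeBits roundsCode x w)) mainBound (final x w)
        finished x w = proj₂ (finish x w)

      opaque
        count-tape : ∀ (ψ : Config #V → ℕ) →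
          2 ^ N * count ψ time (start program (encodeInput F z₀)) ≡ 2 ^ time * sumTape spare (λ w → sum roundsCode λ x → ψ ([] , final x w)) []
        count-tape ψ = subst (λ t → 2 ^ N * count ψ t (start program (encodeInput F z₀)) ≡ 2 ^ t * sumTape spare (λ w → sum roundsCode λ x → ψ ([] , final x w)) [])
          (sym time-split)
          (count-program ψ {pre = preludeCmd k M a b K} {main = mainCmd k s} {b₀ = preludeBound} {b₂ = mainBound}
            {σ = encodeInput F z₀ ∷ Vec.replicate 22 nil} {tb = ⌜ T ⌝ⁿ} {eb = ⌜ E ⌝ⁿ} {rc = ⌜ R ⌝ⁿ} {np = ⌜ suc n ⌝ⁿ} {z = encodeAssignment z₀} {f = encodeCNF F}
            N spare roundsCode {fin = final} (sym (m∸n+n≡m size≤N)) begun finished)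

      opaque
        -- Spare bits and all steps other than coin tosses contribute just powers of 2, so events
        -- have the same share among coin sequences as among elements of `roundsCode`.
        count-final : ∀ (ψ : Config #V → ℕ) (φ : El roundsCode → ℕ) → (∀ x w → ψ ([] , final x w) ≡ φ x) →
          2 ^ size roundsCode * count ψ time (start program (encodeInput F z₀)) ≡ 2 ^ time * sum roundsCode φ
        count-final ψ φ eq = cancel N spare (size roundsCode) (2 ^ time) (sum roundsCode φ) (sym (m∸n+n≡m size≤N)) (trans (count-tape ψ)
          (cong (2 ^ time *_) (trans (sumTape-cong spare (λ w → sum-cong roundsCode λ x → eq x w) []) (sumTape-const spare (sum roundsCode φ) []))))
          where
          lem : ∀ p q x → p * (q * x) ≡ q * (p * x)
          lem = solve-∀
          cancel : ∀ N r l p q {X} → N ≡ r + l → 2 ^ N * X ≡ p * (2 ^ r * q) → 2 ^ l * X ≡ p * q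
          cancel N r l p q {X} refl eq = *-cancelˡ-≡ (2 ^ l * X) (p * q) (2 ^ r) ⦃ m^n≢0 2 r ⦄ (trans (sym (*-assoc (2 ^ r) (2 ^ l) X))
            (trans (cong (_* X) (sym (^-distribˡ-+-* 2 r l))) (trans eq (lem p (2 ^ r) q))))

      opaque
        halts : HaltsWithin program (encodeInput F z₀) time
        halts ω = indicator-sound (halted? κ′) (count-full (λ κ → indicator (halted? κ)) (λ κ → indicator≤1 (halted? κ)) full ω)
          where
          κ′ : Config #V
          κ′ = run ω (start program (encodeInput F z₀))
          full : 2 ^ time ≤ count (λ κ → indicator (halted? κ)) time (start program (encodeInput F z₀))
          full = *-cancelˡ-≤ (2 ^ size roundsCode) ⦃ m^n≢0 2 (size roundsCode) ⦄ (≤-reflexive (sym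
            (trans (count-final (λ κ → indicator (halted? κ)) (λ _ → 1) (λ _ _ → refl))
            (trans (cong (2 ^ time *_) (trans (sum-const roundsCode 1) (*-identityʳ (2 ^ size roundsCode)))) (*-comm (2 ^ time) (2 ^ size roundsCode))))))

      module _ (x : Assignment n) (F[x] : Satisfies F x) (x-max : dH z₀ x ≡ maxDistance F z₀) where

        opaque
          8n≤T : 8 * n ≤ T
          8n≤T = ≤-trans (*-monoʳ-≤ 8 (n≤1+n n)) (≤-reflexive (trans (*-comm 8 (suc n)) (sym (scale-1 8 (suc n)))))

        succeeds : Success u g r s μ 2^s≡ M≡ kg≤M F |F| z₀ x F[x] T 8n≤T
        succeeds = success u g r s μ 2^s≡ M≡ kg≤M F |F| z₀ x F[x] T 8n≤T

        e* Λ : ℕ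
        e* = proj₁ succeeds
        Λ = proj₁ (proj₂ succeeds)

        open Walks k s g h (trans 2^s≡ M≡) (gk≤2^s u g r s μ 2^s≡ M≡ kg≤M F |F| z₀ x F[x] T 8n≤T) F |F| z₀ x F[x] (dH z₀ x) Λ using (Good; good?)
        open Keeping k s F z₀ T (satisfiable⇒nonEmpty {x = x} F[x]) Good good? proj₁ (λ (sat , far) sat′ near → sat′ , ≤-trans far (+-monoˡ-≤ Λ near)) using (GoodBest; allBad; badCount; goodCount; bad+good; sum-allBad; rounds-gains; goodCount-lower)

        opaque
          -- `growth` was chosen to be at least `k (2h/μ) ^ n`, the reciprocal of the success
          -- probability for `e*`, and `e* ≤ M n < M (n+1)` shows that `e*` is tried.
          frequent : total (roundCode s n T 0 E) ≤ goodCount 0 E * R₁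
          frequent = goodCount-lower e* R₁ 0 E z≤n e*<E (*-cancel-≤ (μ ^ n) ⦃ m^n≢0 μ n ⦄
            (≤-trans (proj₂ (proj₂ (proj₂ (proj₂ succeeds)))) (≤-trans (*-monoˡ-≤ I (≤-trans (scaleⁿ-lower a b n k) (≤-reflexive (cong (λ m → R₁ * m ^ n) sucb≡μ))))
              (≤-reflexive (lem R₁ (μ ^ n) I)))))
            where
            I : ℕ
            I = successes u g r s μ 2^s≡ M≡ kg≤M F |F| z₀ x F[x] T 8n≤T e* Λ
            e*<E : e* < E
            e*<E = ≤-trans (s≤s (proj₁ (proj₂ (proj₂ succeeds)))) (≤-trans (+-monoˡ-≤ (M * n) (s≤s (z≤n {μ}))) (≤-reflexive (trans (sym (*-suc M n)) (trans (*-comm M (suc n)) (sym (scale-1 M (suc n)))))))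
            lem : ∀ r m i → r * m * i ≡ i * r * m
            lem = solve-∀

        opaque
          -- Every outcome is favourable or bad in all rounds, and the outcomes of the second kind
          -- number `bad ^ R`.
          enough : ∀ (φ : El roundsCode → ℕ) → (∀ xs → GoodBest (rounds k s F z₀ T 0 E xs initial) → 1 ≤ φ xs) →
            2 ^ n * total roundsCode ≤ 2 ^ n * sum roundsCode φ + total roundsCode
          enough φ hyp = subst (λ m → 2 ^ n * m ≤ 2 ^ n * sum roundsCode φ + m) total≡
            (amplification bad good R₁ n (sum roundsCode φ) (subst NonZero (sym (bad+good 0 E)) (m^n≢0 2 (size (roundCode s n T 0 E))))
              (subst (_≤ good * R₁) (sym (bad+good 0 E)) frequent) covered)
            where
            bad good : ℕ
            bad  = badCount 0 E
            good = goodCount 0 E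
            total≡ : (bad + good) ^ R ≡ total roundsCode
            total≡ = trans (cong (_^ R) (bad+good 0 E)) (trans (^-*-assoc 2 (size (roundCode s n T 0 E)) R) (cong (2 ^_) (*-comm (size (roundCode s n T 0 E)) R)))
            either : ∀ xs → 1 ≤ φ xs + allBad 0 E xs
            either xs with rounds-gains 0 E xs initial (inj₁ refl)
            ... | inj₁ eq = ≤-trans (≤-reflexive (sym eq)) (m≤n+m (allBad 0 E xs) (φ xs))
            ... | inj₂ gb = ≤-trans (hyp xs gb) (m≤m+n (φ xs) (allBad 0 E xs))
            covered : (bad + good) ^ R ≤ sum roundsCode φ + bad ^ R
            covered = ≤-trans (≤-reflexive (trans total≡ (sym (trans (sum-const roundsCode 1) (*-identityʳ (total roundsCode))))))
              (≤-trans (sum-mono roundsCode either) (≤-reflexive (trans (sum-+ roundsCode φ (allBad 0 E)) (cong (λ m → sum roundsCode φ + m) (sum-allBad 0 E R)))))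

        opaque
          GoodBest⇒FarSolution : ∀ 3≤k best → GoodBest best → FarSolution (approxRatio k 3≤k) F z₀ (encodeAssignment (proj₁ best))
          GoodBest⇒FarSolution 3≤k (w , _) ((sat , near) , _) = lose (∈-Ω F sat) (refl ,
            subst (λ D → approxRatio k 3≤k ℚ.* fromℕ D ℚ.≤ fromℕ (dH z₀ w)) x-max
              (/-≤ (4 * suc u) (u ^ 2) (dH z₀ w) ⦃ m^n≢0 u 2 ⦄ (dH z₀ x)
                (far-enough (dH z₀ x) (dH z₀ w) Λ u near (proj₁ (proj₂ (proj₂ (proj₂ succeeds)))))))

      module _ (3≤k : 3 ≤ k) where

        far? : Decidable (FarSolution (approxRatio k 3≤k) F z₀)
        far? = farSolution? (approxRatio k 3≤k) F z₀

        far : El roundsCode → ℕ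
        far xs = indicator (far? (encodeAssignment (proj₁ (rounds k s F z₀ T 0 E xs initial))))

        opaque
          probability : Satisfiable F → 1ℚ ℚ.- (1 /2^ n) ℚ.≤ PrOutput program (encodeInput F z₀) time far?
          probability satisfiable = /2^-≤ n time _ (subst (λ X → 2 ^ n * 2 ^ time ≤ 2 ^ n * X + 2 ^ time)
            (sym (filter-count time (start program (encodeInput F z₀)) (λ κ → far? (output κ)))) (via (farthest F z₀ satisfiable)))
            where
            ψ : Config #V → ℕ
            ψ κ = indicator (far? (output κ))
            via : ∃[ x ] (Satisfies F x × dH z₀ x ≡ maxDistance F z₀) →
                  2 ^ n * 2 ^ time ≤ 2 ^ n * count ψ time (start program (encodeInput F z₀)) + 2 ^ time
            via (x , F[x] , x-max) = rescale (total roundsCode) (2 ^ time) (2 ^ n) (sum roundsCode far) (count ψ time (start program (encodeInput F z₀)))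
              (count-final ψ far (λ _ _ → refl))
              (enough x F[x] x-max far (λ xs best →
                1≤indicator (far? (encodeAssignment (proj₁ (rounds k s F z₀ T 0 E xs initial)))) (GoodBest⇒FarSolution x F[x] x-max 3≤k _ best)))
              ⦃ m^n≢0 2 (size roundsCode) ⦄

open PowerInequalities
open Execution
open Algorithm
open Counters
open Counting
open RandomWalks
open Attempts
open Amplification
open Parameterization
open RunningTime
open Assembly
open import Data.Integer.Base using (+_)
open import Data.Rational.Base as ℚ using (ℚ; 1ℚ)

lemma2 : (k : ℕ) (3≤k : 3 ≤ k) →
    ∃[ P ] ((c : ℕ) → ∃[ C ]
    ((n : ℕ) (F : CNF n) (z₀ : Assignment n) →
    Is k -CNF F → length F ≤ poly c n →
    ∃[ t ] (t ≤ poly C n ·2^[ exponent k 3≤k · n ]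
    × HaltsWithin P (encodeInput F z₀) t
    × (Satisfiable F →
    1ℚ ℚ.- (1 /2^ n)
    ℚ.≤ PrOutput P (encodeInput F z₀) t
    (farSolution? (approxRatio k 3≤k) F z₀)))))
lemma2 (suc (suc (suc v))) 3≤k@(s≤s (s≤s (s≤s z≤n))) =
  program (suc v) (parameters (suc v)) , λ c →
  let open Parameters (parameters (suc v))
      k = suc (suc (suc v))
      b<a = sucb≤a (suc v) (parameters (suc v))
      C , bound = programTime-bound k s μ (2 * (g + r)) (pred μ) (suc μ * (suc μ * s + 1 + 8 * s)) b<a (s≤s z≤n) c
  in C , λ n F z₀ |F| F≤ →
    time (suc v) (parameters (suc v)) F z₀ |F| c F≤ ,
    (λ p q exp → time-bound (time (suc v) (parameters (suc v)) F z₀ |F| c F≤) (poly C n) (2 * (g + r)) (suc (pred μ)) n p q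
      (subst (λ t → t * suc (pred μ) ^ n ≤ poly C n * (2 * (g + r)) ^ n) (sym (time≡ (suc v) (parameters (suc v)) F z₀ |F| c F≤)) (bound n))
      -- For `k = v + 3` these are `N = 2k - 2`, `κ = 2k - 1` and `K = 2k`: one partial sum serves
      -- for all rationals `p / q`.
      (base-bound k (2 * suc (suc v)) (suc (2 * suc (suc v))) (suc (suc (2 * suc (suc v)))) (g + r) (suc (pred μ)) p q refl refl (double′ (suc v))
        (subst (λ m → (g + r) * suc (suc (2 * suc (suc v))) ^ 2 ≤ suc (2 * suc (suc v)) ^ 2 * m) (sym (sucb≡μ (suc v) (parameters (suc v)))) precise) exp)) ,
    halts (suc v) (parameters (suc v)) F z₀ |F| c F≤ ,
    probability (suc v) (parameters (suc v)) F z₀ |F| c F≤ 3≤k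
  where
  double′ : ∀ u → suc (suc (2 * suc u)) ≡ 2 * suc (suc u)
  double′ = solve-∀
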